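{- Let $\sigma=\lambda/\nu$ be a balanced skew shape of height $a$ and width $b$, and let $w\in\mathfrak{S}_n$ be a skew vexillary permutation of shape $\sigma$. Then the weak order interval $[e,w]$ is toggle CDE (tCDE) with edge density $ab/(a+b)$; that is, $\mathbb{E}(\mu;\mathrm{ddeg})=\mathbb{E}(\mathrm{uni}_{[e,w]};\mathrm{ddeg})=ab/(a+b)$ for every toggle-symmetric probability distribution $\mu$ on $[e,w]$.
   Context: Weak order: For $w\in\mathfrak{S}_n$, $\mathrm{Inv}(w)=\{(i,j): 1\le i<j\le n,\ w(i)>w(j)\}$ and $\mathrm{Inv}^{ -1}(w)=\mathrm{Inv}(w^{ -1})$. Weak order on $\mathfrak{S}_n$ is: $u\le w$ iff $\mathrm{Inv}^{ -1}(u)\subseteq \mathrm{Inv}^{ -1}(w)$; equivalently, it is the partial order whose cover relations are $u\lessdot us_k$ with $u(k)<u(k+1)$, $s_k$ the simple transposition of $k,k+1$. $e$ is the identity; $[e,w]=\{u:e\le u\le w\}$. Every such interval is a finite semidistributive lattice. $\mathrm{ddeg}(p)$ is the number of elements of the poset covered by $p$; $\mathrm{uni}_P$ is the uniform distribution on $P$; $\mathbb{E}(\mu;f)$ is expectation of $f$ under $\mu$; the edge density of $P$ is $\mathbb{E}(\mathrm{uni}_P;\mathrm{ddeg})$. Toggling: A finite lattice $L$ is semidistributive if every element has a canonical join representation and a canonical meet representation (equivalently, $x\vee y=x\vee z$ implies $x\vee y=x\vee(y\wedge z)$, and dually). For such $L$ and a cover relation $x\lessdot y$, put $\gamma(x\lessdot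 y)=\min\{z\in L:x\vee z=y\}$, which exists and lies in the set $\mathrm{Irr}(L)$ of join-irreducible elements. For each $y$, each $p\in\mathrm{Irr}(L)$ labels at most one cover relation involving $y$. For $p\in\mathrm{Irr}(L)$: $\mathcal{T}^+_p(y)=1$ if there is $z$ with $y\lessdot z$, $\gamma(y\lessdot z)=p$, and $0$ otherwise; $\mathcal{T}^-_p(y)=1$ if there is $x$ with $x\lessdot y$, $\gamma(x\lessdot y)=p$, and $0$ otherwise; $\mathcal{T}_p=\mathcal{T}^+_p-\mathcal{T}^-_p$. A probability distribution $\mu$ on $L$ is toggle-symmetric if $\mathbb{E}(\mu;\mathcal{T}_p)=0$ for all $p\in\mathrm{Irr}(L)$. $L$ is tCDE if $\mathbb{E}(\mu;\mathrm{ddeg})=\mathbb{E}(\mathrm{uni}_L;\mathrm{ddeg})$ for every toggle-symmetric $\mu$ on $L$. Shapes: A diagram is a finite subset of $\mathbb{Z}^2$ of boxes $(i,j)$ in matrix coordinates ($i$ = row, increasing downwards; $j$ = column, increasing rightwards). A partition $\lambda$ is identified with its Young diagram $\{(i,j):1\le i\le \ell(\lambda),1\le j\le\lambda_i\}$. For partitions with $\nu_i\le\lambda_i$ for all $i$, the skew shape $\sigma=\lambda/\nu$ is the set difference of the Young diagrams. $\sigma$ is connected if the Hasse diagram of the poset on its boxes (with order induced from the componentwise order on $\mathbb{Z}^2$) is connected (in particular nonempty). A connected $\sigma$ has height $a$ and width $b$ if $[a]\times[b]$ is the smallest rectangle containing $\sigma$ up to translation. Translate $\sigma$ into $[a]\times[b]$;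 its main antidiagonal is the line joining the northeast and southwest corners of the boundary of this rectangle. A corner of $\sigma$ is a point where two line segments that are part of the boundary of $\sigma$ meet; it is outward if no box of $\sigma$ intersects both line segments (except at the corner point). (Equivalently, outward corners are the lattice points, at the southeast corner of position $(p,q)$, such that exactly three of $(p,q),(p,q+1),(p+1,q),(p+1,q+1)$ lie in $\sigma$; such a point is on the main antidiagonal iff $pb+qa=ab$.) $\sigma$ is balanced if it is connected and all its outward corners lie exactly on its main antidiagonal. Skew vexillary: The Rothe diagram of $w$ is $\{(i,w(j)):(i,j)\in \mathrm{Inv}(w)\}$. $w$ is skew vexillary of shape $\sigma$ if its Rothe diagram can be transformed to $\sigma$ by some permutation of rows and columns (rows and columns being permuted separately). -}

module Defs where

open import Level using (Level; _⊔_; 0ℓ)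
open import Algebra.Apartness.Bundles using (HeytingField; HeytingCommutativeRing)
import Algebra.Apartness.Properties.HeytingCommutativeRing as HCRProperties
open import Algebra.Bundles using (CommutativeRing)
import Algebra.Properties.Monoid.Mult as Mult
import Algebra.Properties.Ring as RingProperties
open import Data.Bool.Base using (if_then_else_)
open import Data.Fin.Base as Fin using (Fin; inject₁)
import Data.Fin.Induction as Fin
open import Data.Fin.Patterns using (0F; 1F)
open import Data.Fin.Permutation as Perm
  using (Permutation′; _⟨$⟩ʳ_; _⟨$⟩ˡ_; insert; remove; insert-remove)
import Data.Fin.Properties as Fin
open import Data.Integer.Base as ℤ using (ℤ; +_; +[1+_]; ∣_∣; 1ℤ)
open import Data.List.Base
  using (List; []; _∷_; length; filter; foldr; map; allFin; cartesianProductWith)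
import Data.List.Membership.Setoid as Membership
import Data.List.Membership.Setoid.Properties as Membership
import Data.List.Membership.Propositional.Properties as Membershipₚ
open import Data.List.Relation.Unary.All as All using (All; []; _∷_)
open import Data.List.Relation.Unary.AllPairs using ([]; _∷_)
open import Data.List.Relation.Unary.Any as Any using (here; there)
open import Data.List.Relation.Unary.Enumerates.Setoid using (IsEnumeration)
open import Data.List.Relation.Unary.Linked using (Linked)
open import Data.List.Relation.Unary.Unique.Setoid using (Unique)
import Data.List.Relation.Unary.Unique.Setoid.Properties as Unique
import Data.List.Relation.Unary.Unique.Propositional.Properties as Uniqueₚ
open import Data.Nat.Base as ℕ using (ℕ; zero; suc; z≤n)
import Data.Nat.Properties as ℕ
open import Data.Product.Base using (Σ; ∃; ∃₂; _×_; _,_; proj₁; proj₂)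
open import Data.Product.Relation.Binary.Pointwise.NonDependent using (Pointwise)
open import Data.Sum.Base using (_⊎_; inj₁; inj₂)
open import Function.Base using (_∘_)
open import Function.Bundles using (_⇔_; _↔_; module Inverse; module Equivalence)
open import Relation.Binary.Bundles using (Setoid; DecPoset)
open import Relation.Binary.Construct.Closure.Equivalence using (EqClosure)
import Relation.Binary.Construct.NonStrictToStrict as ToStrict
import Relation.Binary.Construct.On as On
open import Relation.Binary.Core using (Rel)
open import Relation.Binary.Definitions as B using (_Respects_; tri<; tri≈; tri>)
import Relation.Binary.Properties.Poset as PosetProperties
open import Relation.Binary.PropositionalEquality.Core
  using (_≡_; refl; sym; trans; cong; subst; subst₂)
import Relation.Binary.PropositionalEquality.Properties as ≡
open import Relation.Binary.Structures using (IsStrictPartialOrder)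
open import Relation.Nullary.Decidable
  using (Dec; yes; no; does; map′; ¬?; _×-dec_; _→-dec_)
open import Relation.Nullary.Negation using (¬_; contradiction)
open import Relation.Unary using (Pred; Decidable; _⊆_; _∈_; _∉_; _∖_)

private
  variable
    c ℓ ℓ₁ ℓ₂ : Level

------------------------------------------------------------------------
-- Scalars

-- An arbitrary ordered field stands in for ℝ.  Only `_<_` is given, and
-- `x ≤ y` means `¬ (y < x)`, so that constructive as well as classical
-- models of ℝ are instances.
record OrderedField c ℓ₁ ℓ₂ : Set (Level.suc (c ⊔ ℓ₁ ⊔ ℓ₂)) where
  infix 4 _<_ _≤_
  field
    heytingField : HeytingField c ℓ₁ ℓ₂
  open HeytingField heytingField public
  field
    _<_                  : Rel Carrier ℓ₂
    <-isStrictPartialOrder : IsStrictPartialOrder _≈_ _<_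
    #⇔<⊎>                : ∀ x y → x # y ⇔ (x < y ⊎ y < x)
    +-monoˡ-<            : ∀ x y z → x < y → x + z < y + z
    *-pos                : ∀ x y → 0# < x → 0# < y → 0# < x * y

  _≤_ : Rel Carrier ℓ₂
  x ≤ y = ¬ (y < x)

  private
    module < = IsStrictPartialOrder <-isStrictPartialOrder
    open HCRProperties heytingCommutativeRing using (1#0)
    open CommutativeRing (HeytingCommutativeRing.commutativeRing heytingCommutativeRing)
      using (ring; +-monoid)
    open RingProperties ring using (-1*x≈-x; -‿involutive)
    open Mult +-monoid using () renaming (_×_ to _·_)

  fromℕ : ℕ → Carrier
  fromℕ n = n · 1#

  0<1 : 0# < 1#
  0<1 with Equivalence.to (#⇔<⊎> 1# 0#) 1#0
  ... | inj₂ 0<1 = 0<1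
  ... | inj₁ 1<0 = <.<-respʳ-≈ -1*-1≈1 (*-pos (- 1#) (- 1#) 0<-1 0<-1)
    where
    module E = IsStrictPartialOrder.Eq <-isStrictPartialOrder
    0<-1 : 0# < - 1#
    0<-1 = <.<-respˡ-≈ (-‿inverseʳ 1#)
             (<.<-respʳ-≈ (+-identityˡ (- 1#)) (+-monoˡ-< 1# 0# (- 1#) 1<0))
    -1*-1≈1 : - 1# * - 1# ≈ 1#
    -1*-1≈1 = E.trans (-1*x≈-x (- 1#)) (-‿involutive 1#)

  0<fromℕ-suc : ∀ n → 0# < fromℕ (suc n)
  0<fromℕ-suc zero    = <.<-respʳ-≈ (<.Eq.sym (+-identityʳ 1#)) 0<1
  0<fromℕ-suc (suc n) = <.trans (0<fromℕ-suc n)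
    (<.<-respˡ-≈ (+-identityˡ (fromℕ (suc n))) (+-monoˡ-< 0# 1# (fromℕ (suc n)) 0<1))

  infixl 7 _/ℕ_

  -- Total, with `x /ℕ 0 = 0#`.  `#⇒invertible` inverts the difference
  -- `fromℕ (suc n) - 0#`.
  _/ℕ_ : Carrier → ℕ → Carrier
  x /ℕ zero  = 0#
  x /ℕ suc n = x * proj₁ (#⇒invertible
    (Equivalence.from (#⇔<⊎> (fromℕ (suc n)) 0#) (inj₂ (0<fromℕ-suc n))))

------------------------------------------------------------------------
-- Finite posets

Covers : {A : Set c} → Rel A ℓ → Rel A (c ⊔ ℓ)
Covers _<_ x y = x < y × (∀ z → ¬ (x < z × z < y))

record FinitePoset c ℓ₁ ℓ₂ : Set (Level.suc (c ⊔ ℓ₁ ⊔ ℓ₂)) where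
  infix 4 _⋖_
  field
    decPoset : DecPoset c ℓ₁ ℓ₂
  open DecPoset decPoset public
  setoid : Setoid c ℓ₁
  setoid = Eq.setoid
  field
    elements : List Carrier
    complete : IsEnumeration setoid elements
    unique   : Unique setoid elements

  open PosetProperties poset public using (_<_; <-respʳ-≈; <-respˡ-≈)

  size : ℕ
  size = length elements

  ∃? : {Q : Pred Carrier ℓ} → Q Respects _≈_ → Decidable Q → Dec (∃ Q)
  ∃? resp Q? = map′ Any.satisfied
    (λ (x , q) → Membership.lose setoid resp (complete x) q) (Any.any? Q? elements)

  ∀? : {Q : Pred Carrier ℓ} → Q Respects _≈_ → Decidable Q → Dec (∀ x → Q x)
  ∀? resp Q? = map′ (λ qs x → All.lookupₛ setoid resp qs (complete x))
    (λ q → All.universal q elements) (All.all? Q? elements)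

  _<?_ : B.Decidable _<_
  x <? y = (x ≤? y) ×-dec ¬? (x ≟ y)

  _⋖_ : Rel Carrier (c ⊔ ℓ₁ ⊔ ℓ₂)
  _⋖_ = Covers _<_

  _⋖?_ : B.Decidable _⋖_
  x ⋖? y = (x <? y) ×-dec
    ∀? (λ u≈v ¬q (p , q) → ¬q (<-respʳ-≈ (Eq.sym u≈v) p , <-respˡ-≈ (Eq.sym u≈v) q))
       (λ z → ¬? ((x <? z) ×-dec (z <? y)))

  ⋖-resp-≈ : ∀ {x x′ y y′} → x ≈ x′ → y ≈ y′ → x ⋖ y → x′ ⋖ y′
  ⋖-resp-≈ x≈ y≈ (x<y , none) =
    <-respˡ-≈ x≈ (<-respʳ-≈ y≈ x<y) ,
    λ z (p , q) → none z (<-respˡ-≈ (Eq.sym x≈) p , <-respʳ-≈ (Eq.sym y≈) q)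

  ddeg : Carrier → ℕ
  ddeg y = length (filter (_⋖? y) elements)

  -- `IsJoin x y j` says x ∨ y = j.
  IsJoin : Carrier → Carrier → Carrier → Set (c ⊔ ℓ₂)
  IsJoin x y j = x ≤ j × y ≤ j × (∀ u → x ≤ u → y ≤ u → j ≤ u)

  IsJoin? : ∀ x y j → Dec (IsJoin x y j)
  IsJoin? x y j = (x ≤? j) ×-dec ((y ≤? j) ×-dec
    ∀? (λ u≈v h x≤ y≤ → ≤-respʳ-≈ u≈v
          (h (≤-respʳ-≈ (Eq.sym u≈v) x≤) (≤-respʳ-≈ (Eq.sym u≈v) y≤)))
       (λ u → (x ≤? u) →-dec ((y ≤? u) →-dec (j ≤? u))))

  IsJoin-resp-≈ : ∀ {x x′ y y′ j j′} → x ≈ x′ → y ≈ y′ → j ≈ j′ →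
                  IsJoin x y j → IsJoin x′ y′ j′
  IsJoin-resp-≈ x≈ y≈ j≈ (x≤j , y≤j , least) =
    ≤-respˡ-≈ x≈ (≤-respʳ-≈ j≈ x≤j) ,
    ≤-respˡ-≈ y≈ (≤-respʳ-≈ j≈ y≤j) ,
    λ u x≤u y≤u → ≤-respˡ-≈ j≈
      (least u (≤-respˡ-≈ (Eq.sym x≈) x≤u) (≤-respˡ-≈ (Eq.sym y≈) y≤u))

  JoinIrreducible : Pred Carrier (c ⊔ ℓ₁ ⊔ ℓ₂)
  JoinIrreducible p =
    ¬ (∀ x → p ≤ x) × (∀ x y → IsJoin x y p → p ≈ x ⊎ p ≈ y)

  -- `IsLabel x y p` says γ(x ⋖ y) = p, that is, p = min {z : x ∨ z = y}.
  IsLabel : Carrier → Carrier → Carrier → Set (c ⊔ ℓ₂)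
  IsLabel x y p = IsJoin x p y × (∀ z → IsJoin x z y → p ≤ z)

  IsLabel? : ∀ x y p → Dec (IsLabel x y p)
  IsLabel? x y p = IsJoin? x p y ×-dec
    ∀? (λ u≈v h j → ≤-respʳ-≈ u≈v (h (IsJoin-resp-≈ Eq.refl (Eq.sym u≈v) Eq.refl j)))
       (λ z → IsJoin? x z y →-dec (p ≤? z))

  IsLabel-resp-≈ : ∀ {x x′ y y′ p} → x ≈ x′ → y ≈ y′ → IsLabel x y p → IsLabel x′ y′ p
  IsLabel-resp-≈ x≈ y≈ (join , min) =
    IsJoin-resp-≈ x≈ Eq.refl y≈ join ,
    λ z j → min z (IsJoin-resp-≈ (Eq.sym x≈) Eq.refl (Eq.sym y≈) j)

  LabelsUp : Carrier → Carrier → Set (c ⊔ ℓ₁ ⊔ ℓ₂)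
  LabelsUp p y = ∃ λ z → y ⋖ z × IsLabel y z p

  LabelsUp? : ∀ p y → Dec (LabelsUp p y)
  LabelsUp? p y = ∃?
    (λ z≈ (c , l) → ⋖-resp-≈ Eq.refl z≈ c , IsLabel-resp-≈ Eq.refl z≈ l)
    (λ z → (y ⋖? z) ×-dec IsLabel? y z p)

  LabelsDown : Carrier → Carrier → Set (c ⊔ ℓ₁ ⊔ ℓ₂)
  LabelsDown p y = ∃ λ x → x ⋖ y × IsLabel x y p

  LabelsDown? : ∀ p y → Dec (LabelsDown p y)
  LabelsDown? p y = ∃?
    (λ x≈ (c , l) → ⋖-resp-≈ x≈ Eq.refl c , IsLabel-resp-≈ x≈ Eq.refl l)
    (λ x → (x ⋖? y) ×-dec IsLabel? x y p)

------------------------------------------------------------------------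
-- Toggling

module Toggling {k k₁ k₂ c ℓ₁ ℓ₂}
  (K : OrderedField k k₁ k₂) (P : FinitePoset c ℓ₁ ℓ₂) where

  private
    module K = OrderedField K
    module P = FinitePoset P

  ∑ : (P.Carrier → K.Carrier) → K.Carrier
  ∑ f = foldr K._+_ K.0# (map f P.elements)

  record Distribution : Set (k ⊔ k₁ ⊔ k₂ ⊔ c ⊔ ℓ₁) where
    field
      weight : P.Carrier → K.Carrier
      congr  : ∀ {x y} → x P.≈ y → weight x K.≈ weight y
      nonneg : ∀ x → K.0# K.≤ weight x
      total  : ∑ weight K.≈ K.1#

  𝔼 : (P.Carrier → K.Carrier) → (P.Carrier → K.Carrier) → K.Carrier
  𝔼 weight f = ∑ (λ x → weight x K.* f x)

  uni : P.Carrier → K.Carrier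
  uni _ = K.1# K./ℕ P.size

  ddeg : P.Carrier → K.Carrier
  ddeg x = K.fromℕ (P.ddeg x)

  edgeDensity : K.Carrier
  edgeDensity = 𝔼 uni ddeg

  indicator : {A : Set ℓ} → Dec A → K.Carrier
  indicator A? = if does A? then K.1# else K.0#

  𝒯⁺ 𝒯⁻ 𝒯 : P.Carrier → P.Carrier → K.Carrier
  𝒯⁺ p y = indicator (P.LabelsUp? p y)
  𝒯⁻ p y = indicator (P.LabelsDown? p y)
  𝒯  p y = 𝒯⁺ p y K.- 𝒯⁻ p y

  ToggleSymmetric : Distribution → Set (k₁ ⊔ c ⊔ ℓ₁ ⊔ ℓ₂)
  ToggleSymmetric μ =
    ∀ p → P.JoinIrreducible p → 𝔼 (Distribution.weight μ) (𝒯 p) K.≈ K.0#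

  -- Meant for semidistributive lattices P, such as intervals of the weak order.
  IsTCDE : Set (k ⊔ k₁ ⊔ k₂ ⊔ c ⊔ ℓ₁ ⊔ ℓ₂)
  IsTCDE = (μ : Distribution) → ToggleSymmetric μ →
           𝔼 (Distribution.weight μ) ddeg K.≈ edgeDensity

------------------------------------------------------------------------
-- Intervals

private
  module Restrict (S : Setoid c ℓ₁) {Q : Pred (Setoid.Carrier S) ℓ}
    (resp : Q Respects (Setoid._≈_ S)) (Q? : Decidable Q) where

    open Setoid S renaming (Carrier to A)

    T : Setoid _ _
    T = On.setoid {B = Σ A Q} S proj₁

    restrict : List A → List (Σ A Q)
    restrict [] = []
    restrict (x ∷ xs) with Q? x
    ... | yes q = (x , q) ∷ restrict xs
    ... | no  _ = restrict xs

    restrict-∈ : ∀ y {xs} → Membership._∈_ S (proj₁ y) xs →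
                 Membership._∈_ T y (restrict xs)
    restrict-∈ (y , q) {x ∷ xs} y∈ with Q? x | y∈
    ... | yes _ | here y≈x  = here y≈x
    ... | yes _ | there y∈′ = there (restrict-∈ (y , q) y∈′)
    ... | no ¬q | here y≈x  = contradiction (resp y≈x q) ¬q
    ... | no _  | there y∈′ = restrict-∈ (y , q) y∈′

    restrict-All : ∀ {r} {R : Pred A r} {xs} → All R xs → All (R ∘ proj₁) (restrict xs)
    restrict-All [] = []
    restrict-All {xs = x ∷ _} (r ∷ rs) with Q? x
    ... | yes _ = r ∷ restrict-All rs
    ... | no  _ = restrict-All rs

    restrict-unique : ∀ xs → Unique S xs → Unique T (restrict xs)
    restrict-unique [] [] = []
    restrict-unique (x ∷ xs) (x≉ ∷ u) with Q? x
    ... | yes _ = restrict-All x≉ ∷ restrict-unique xs u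
    ... | no  _ = restrict-unique xs u

interval : (P : FinitePoset c ℓ₁ ℓ₂) → FinitePoset.Carrier P → FinitePoset.Carrier P →
           FinitePoset (c ⊔ ℓ₂) ℓ₁ ℓ₂
interval P x y = record
  { decPoset = On.decPoset {B = ∃ λ u → x ≤ u × u ≤ y} decPoset proj₁
  ; elements = restrict elements
  ; complete = λ v → restrict-∈ v (complete (proj₁ v))
  ; unique   = restrict-unique elements unique
  }
  where
  open FinitePoset P
  open Restrict setoid {Q = λ u → x ≤ u × u ≤ y}
    (λ u≈v (p , q) → ≤-respʳ-≈ u≈v p , ≤-respˡ-≈ u≈v q)
    (λ u → (x ≤? u) ×-dec (u ≤? y))

------------------------------------------------------------------------
-- Weak order

module _ {n : ℕ} where

  Inv : Permutation′ n → Pred (Fin n × Fin n) 0ℓ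
  Inv w (i , j) = i Fin.< j × (w ⟨$⟩ʳ j) Fin.< (w ⟨$⟩ʳ i)

  Inv⁻¹ : Permutation′ n → Pred (Fin n × Fin n) 0ℓ
  Inv⁻¹ w = Inv (Perm.flip w)

  infix 4 _≤ʷ_
  _≤ʷ_ : Rel (Permutation′ n) 0ℓ
  u ≤ʷ w = Inv⁻¹ u ⊆ Inv⁻¹ w

  Inv? : ∀ w → Decidable (Inv w)
  Inv? w (i , j) = (i Fin.<? j) ×-dec ((w ⟨$⟩ʳ j) Fin.<? (w ⟨$⟩ʳ i))

private
  strictMono⇒inflationary : ∀ {n} (f : Fin n → Fin n) →
    (∀ {k l} → k Fin.< l → f k Fin.< f l) → ∀ k → k Fin.≤ f k
  strictMono⇒inflationary {suc n} f mono = Fin.<-weakInduction (λ k → k Fin.≤ f k) z≤n step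
    where
    step : ∀ i → inject₁ i Fin.≤ f (inject₁ i) → Fin.suc i Fin.≤ f (Fin.suc i)
    step i h = ℕ.≤-<-trans (subst (ℕ._≤ Fin.toℕ (f (inject₁ i))) (Fin.toℕ-inject₁ i) h)
      (mono (ℕ.s≤s (ℕ.≤-reflexive (Fin.toℕ-inject₁ i))))

  module Antisym {n} (u w : Permutation′ n) (u≤w : u ≤ʷ w) (w≤u : w ≤ʷ u) where

    f : Fin n → Fin n
    f k = w ⟨$⟩ˡ (u ⟨$⟩ʳ k)

    mono : ∀ {k l} → k Fin.< l → f k Fin.< f l
    mono {k} {l} k<l with Fin.<-cmp (u ⟨$⟩ʳ k) (u ⟨$⟩ʳ l)
    ... | tri> _ _ j<i = proj₂ (u≤w
      (j<i , subst₂ Fin._<_ (sym (Perm.inverseˡ u)) (sym (Perm.inverseˡ u)) k<l))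
    ... | tri≈ _ i≡j _ = contradiction
      (trans (sym (Perm.inverseˡ u)) (trans (cong (u ⟨$⟩ˡ_) i≡j) (Perm.inverseˡ u)))
      (Fin.<⇒≢ k<l)
    ... | tri< i<j _ _ with Fin.<-cmp (f k) (f l)
    ...   | tri< fk<fl _ _ = fk<fl
    ...   | tri≈ _ fk≡fl _ = contradiction
      (trans (sym (Perm.inverseʳ w)) (trans (cong (w ⟨$⟩ʳ_) fk≡fl) (Perm.inverseʳ w)))
      (Fin.<⇒≢ i<j)
    ...   | tri> _ _ fl<fk = contradiction k<l (ℕ.<-asym
      (subst₂ Fin._<_ (Perm.inverseˡ u) (Perm.inverseˡ u) (proj₂ (w≤u (i<j , fl<fk)))))

  ≤ʷ-antisym : ∀ {n} (u w : Permutation′ n) → u ≤ʷ w → w ≤ʷ u → u Perm.≈ w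
  ≤ʷ-antisym u w u≤w w≤u k =
    trans (sym (Perm.inverseʳ w)) (cong (w ⟨$⟩ʳ_) (sym k≡fk))
    where
    module UW = Antisym u w u≤w w≤u
    module WU = Antisym w u w≤u u≤w
    gf : WU.f (UW.f k) ≡ k
    gf = trans (cong (u ⟨$⟩ˡ_) (Perm.inverseʳ w)) (Perm.inverseˡ u)
    k≡fk : k ≡ UW.f k
    k≡fk = Fin.≤-antisym
      (strictMono⇒inflationary UW.f UW.mono k)
      (subst (UW.f k Fin.≤_) gf (strictMono⇒inflationary WU.f WU.mono (UW.f k)))

  ≈⇒≤ʷ : ∀ {n} (u w : Permutation′ n) → u Perm.≈ w → u ≤ʷ w
  ≈⇒≤ʷ u w u≈w {i , j} (i<j , v) = i<j , subst₂ Fin._<_ (eq j) (eq i) v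
    where
    eq : ∀ i → u ⟨$⟩ˡ i ≡ w ⟨$⟩ˡ i
    eq i = trans (cong (u ⟨$⟩ˡ_) (trans (sym (Perm.inverseʳ w)) (sym (u≈w (w ⟨$⟩ˡ i)))))
                 (Perm.inverseˡ u)

  _≤ʷ?_ : ∀ {n} → B.Decidable (_≤ʷ_ {n})
  u ≤ʷ? w = map′ (λ h {(i , j)} → h i j) (λ h i j → h {i , j})
    (Fin.all? λ i → Fin.all? λ j →
      Inv? (Perm.flip u) (i , j) →-dec Inv? (Perm.flip w) (i , j))

  weakDecPoset : ℕ → DecPoset 0ℓ 0ℓ 0ℓ
  weakDecPoset n = record
    { Carrier = Permutation′ n
    ; _≈_ = Perm._≈_
    ; _≤_ = _≤ʷ_
    ; isDecPartialOrder = record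
      { isPartialOrder = record
        { isPreorder = record
          { isEquivalence = record
            { refl  = λ _ → refl
            ; sym   = λ p i → sym (p i)
            ; trans = λ p q i → trans (p i) (q i)
            }
          ; reflexive = λ {u} {w} → ≈⇒≤ʷ u w
          ; trans     = λ p q x → q (p x)
          }
        ; antisym = λ {u} {w} → ≤ʷ-antisym u w
        }
      ; _≟_  = λ u w → Fin.all? λ i → (u ⟨$⟩ʳ i) Fin.≟ (w ⟨$⟩ʳ i)
      ; _≤?_ = _≤ʷ?_
      }
    }

  permSetoid : ℕ → Setoid 0ℓ 0ℓ
  permSetoid n = DecPoset.Eq.setoid (weakDecPoset n)

  permutations : ∀ n → List (Permutation′ n)
  permutations zero    = Perm.id ∷ []
  permutations (suc n) = cartesianProductWith (insert 0F) (allFin (suc n)) (permutations n)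

  insert-cong : ∀ {n} {i j : Fin (suc n)} {π ρ : Permutation′ n} →
                i ≡ j → π Perm.≈ ρ → insert 0F i π Perm.≈ insert 0F j ρ
  insert-cong i≡j π≈ρ 0F          = i≡j
  insert-cong {i = i} refl π≈ρ (Fin.suc k) = cong (Fin.punchIn i) (π≈ρ k)

  insert-injective : ∀ {n} {i j : Fin (suc n)} {π ρ : Permutation′ n} →
                     insert 0F i π Perm.≈ insert 0F j ρ → i ≡ j × π Perm.≈ ρ
  insert-injective {i = i} {π = π} {ρ} eq with eq 0F
  ... | refl = refl , λ k → Fin.punchIn-injective i (π ⟨$⟩ʳ k) (ρ ⟨$⟩ʳ k) (eq (Fin.suc k))

  permutations-complete : ∀ n → IsEnumeration (permSetoid n) (permutations n)
  permutations-complete zero    π = here λ ()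
  permutations-complete (suc n) π =
    Membership.∈-resp-≈ (permSetoid (suc n)) {permutations (suc n)}
      {insert 0F (π ⟨$⟩ʳ 0F) (remove 0F π)} {π} (insert-remove 0F π)
      (Membership.∈-cartesianProductWith⁺
        (≡.setoid (Fin (suc n))) (permSetoid n) (permSetoid (suc n))
        (λ {i} {j} {ρ} {τ} → insert-cong {π = ρ} {ρ = τ})
        (Membershipₚ.∈-allFin (π ⟨$⟩ʳ 0F)) (permutations-complete n (remove 0F π)))

  permutations-unique : ∀ n → Unique (permSetoid n) (permutations n)
  permutations-unique zero    = [] ∷ []
  permutations-unique (suc n) =
    Unique.cartesianProductWith⁺
      (≡.setoid (Fin (suc n))) (permSetoid n) (permSetoid (suc n))
      {xs = allFin (suc n)} {ys = permutations n} (insert 0F) (λ {i} {j} {ρ} {τ} → insert-injective {π = ρ} {ρ = τ})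
      (Uniqueₚ.allFin⁺ (suc n)) (permutations-unique n)

WeakOrder : ℕ → FinitePoset 0ℓ 0ℓ 0ℓ
WeakOrder n = record
  { decPoset = weakDecPoset n
  ; elements = permutations n
  ; complete = permutations-complete n
  ; unique   = permutations-unique n
  }

[e,_] : ∀ {n} → Permutation′ n → FinitePoset 0ℓ 0ℓ 0ℓ
[e,_] {n} w = interval (WeakOrder n) Perm.id w

------------------------------------------------------------------------
-- Shapes

-- Boxes are (row , column) in matrix coordinates.
Diagram : Set₁
Diagram = Pred (ℤ × ℤ) 0ℓ

record Partition : Set where
  field
    parts      : List ℕ
    decreasing : Linked ℕ._≥_ parts
    positive   : All (0 ℕ.<_) parts

-- 1-indexed, and 0 outside the list.
nth : List ℕ → ℕ → ℕ
nth []       _             = 0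
nth (x ∷ xs) zero          = 0
nth (x ∷ xs) (suc zero)    = x
nth (x ∷ xs) (suc (suc i)) = nth xs (suc i)

part : Partition → ℕ → ℕ
part lam = nth (Partition.parts lam)

young : Partition → Diagram
young lam (i , j) =
  (1ℤ ℤ.≤ i × i ℤ.≤ + length (Partition.parts lam)) ×
  (1ℤ ℤ.≤ j × j ℤ.≤ + part lam ∣ i ∣)

record SkewShape : Set where
  field
    outer inner : Partition
    contained   : ∀ i → part inner i ℕ.≤ part outer i

  diagram : Diagram
  diagram = young outer ∖ young inner

_≤ᵇ_ _<ᵇ_ : Rel (ℤ × ℤ) 0ℓ
_≤ᵇ_ = Pointwise ℤ._≤_ ℤ._≤_
_<ᵇ_ = ToStrict._<_ _≡_ _≤ᵇ_

_⊢_<_ : Diagram → Rel (ℤ × ℤ) 0ℓ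
D ⊢ x < y = x ∈ D × y ∈ D × x <ᵇ y

Connected : Diagram → Set
Connected D = ∃ D × (∀ x y → x ∈ D → y ∈ D → EqClosure (Covers (D ⊢_<_)) x y)

translate : ℤ → ℤ → Diagram → Diagram
translate r c D (i , j) = D (i ℤ.- r , j ℤ.- c)

Rectangle : ℕ → ℕ → Diagram
Rectangle a b (i , j) = (1ℤ ℤ.≤ i × i ℤ.≤ + a) × (1ℤ ℤ.≤ j × j ℤ.≤ + b)

FitsIn : Diagram → ℕ → ℕ → Set
FitsIn D a b = ∃₂ λ r c → translate r c D ⊆ Rectangle a b

HasHeightWidth : Diagram → ℕ → ℕ → Set
HasHeightWidth D a b =
  FitsIn D a b × (∀ a′ b′ → FitsIn D a′ b′ → a ℕ.≤ a′ × b ℕ.≤ b′)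

Xor : Set → Set → Set
Xor A B = (A × ¬ B) ⊎ (¬ A × B)

module _ (D : Diagram) (p q : ℤ) where

  -- The lattice point (p , q) is the southeast corner of the box (p , q).
  -- The four boxes around it are `around s t`, where s = 0, 1 for north,
  -- south and t = 0, 1 for west, east.
  around : Fin 2 → Fin 2 → ℤ × ℤ
  around s t = p ℤ.+ + Fin.toℕ s , q ℤ.+ + Fin.toℕ t

  -- The unit segments issuing from the point lie on the boundary of D when
  -- they separate a box of D from a box not in D.
  HorizontalBoundary : Fin 2 → Set
  HorizontalBoundary t = Xor (around 0F t ∈ D) (around 1F t ∈ D)

  VerticalBoundary : Fin 2 → Set
  VerticalBoundary s = Xor (around s 0F ∈ D) (around s 1F ∈ D)

  -- `around s t` is the only box meeting both the horizontal segment t and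
  -- the vertical segment s away from the point itself.
  OutwardCorner : Set
  OutwardCorner = ∃₂ λ s t →
    HorizontalBoundary t × VerticalBoundary s × around s t ∉ D

-- The line through the northeast corner (0 , b) and the southwest corner
-- (a , 0) of the rectangle, in the coordinates of lattice points above.
OnMainAntidiagonal : ℕ → ℕ → ℤ → ℤ → Set
OnMainAntidiagonal a b p q = p ℤ.* + b ℤ.+ q ℤ.* + a ≡ + a ℤ.* + b

Balanced : Diagram → Set
Balanced D = Connected D ×
  (∀ a b → HasHeightWidth D a b →
   ∀ r c → translate r c D ⊆ Rectangle a b →
   ∀ p q → OutwardCorner (translate r c D) p q → OnMainAntidiagonal a b p q)

------------------------------------------------------------------------
-- Skew vexillary permutations

module _ {n : ℕ} where

  position : Fin n → ℤ
  position i = +[1+ Fin.toℕ i ]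

  rothe : Permutation′ n → Diagram
  rothe w (x , y) =
    ∃₂ λ i j → Inv w (i , j) × x ≡ position i × y ≡ position (w ⟨$⟩ʳ j)

  -- Rows and columns are permuted by bijections of ℤ, since the shape need
  -- not lie in the square [n] × [n] containing the Rothe diagram.
  SkewVexillary : Permutation′ n → SkewShape → Set
  SkewVexillary w σ = ∃₂ λ (ρ κ : ℤ ↔ ℤ) → ∀ x y →
    (x , y) ∈ rothe w ⇔ (Inverse.to ρ x , Inverse.to κ y) ∈ SkewShape.diagram σ

{-# OPTIONS --safe #-}
module Submission where

-- For values I < J of w, call (I , J) a box when w inverts it, in row J and
-- column I.  Suppose that a box is a rook: whenever (x , J) and (I , y) are boxes,
-- so is (x , y).  In a word u ≤ w every letter standing between I and J then
-- shares a row or a column, but not both, with (I , J).  Hence the passages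
-- between row-J letters and column-I letters in this stretch alternate, and
-- counting them with signs gives 1.  Each passage is an ascent or a descent
-- whose side of I and J is visible in its label, so up to toggles the count is
-- the number of descents with larger letter J plus the number with smaller
-- letter I: for every toggle-symmetric distribution these two expectations add
-- up to 1.  In a balanced shape the boxes met by the main antidiagonal are
-- rooks, because any obstruction produces an outward corner strictly off the
-- antidiagonal.  Summing over ab points equidistributed along the antidiagonal
-- counts every row b times and every column a times, so (a + b) E(ddeg) = ab.

open import Level using (Level)
open import Defs
open import Algebra.Apartness.Bundles using (HeytingCommutativeRing)
open import Algebra.Bundles using (AbelianGroup; CommutativeRing)
import Algebra.Properties.Group as GroupProperties
open import Data.Bool.Base using (if_then_else_)
open import Data.Empty using (⊥-elim)
open import Data.Fin.Base as Fin
  using (Fin; zero; suc; inject₁; toℕ; fromℕ; fromℕ<; _↑ˡ_; _↑ʳ_; combine; remQuot; cast; opposite)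
open import Data.Fin.Patterns using (0F; 1F)
open import Data.Fin.Permutation as Perm using (Permutation′; _⟨$⟩ʳ_; _⟨$⟩ˡ_; _∘ₚ_)
import Data.Fin.Permutation.Components as PC
import Data.Fin.Properties as Fin
open import Data.Integer.Base as ℤ using (ℤ; +_; +[1+_]; 1ℤ; +≤+)
import Data.Integer.Properties as ℤ
open import Data.List.Base using (List; []; _∷_; foldr; map; filter; length)
open import Data.List.Relation.Unary.All as All using (All; []; _∷_)
open import Data.List.Relation.Unary.AllPairs using ([]; _∷_)
open import Data.List.Relation.Unary.Any using (Any; here; there)
open import Data.List.Relation.Unary.Linked using (Linked; []; [-]; _∷_)
open import Data.List.Relation.Unary.Unique.Setoid using (Unique)
open import Data.Nat.Base as ℕ using (ℕ; zero; suc; z≤n; s≤s)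
import Data.Nat.Properties as ℕ
open import Data.Product.Base using (∃; ∃₂; _×_; _,_; proj₁; proj₂; swap)
open import Data.Product.Properties using (≡-dec)
open import Data.Sum.Base using (_⊎_; inj₁; inj₂)
open import Function.Base using (_∘_)
open import Function.Bundles
  using (_↔_; _⇔_; module Inverse; module Equivalence; module Injection)
open import Function.Properties.Inverse using (↔⇒↣)
open import Relation.Binary.Construct.Closure.Equivalence using (EqClosure)
open import Relation.Binary.Construct.Closure.ReflexiveTransitive using (ε; _◅_)
open import Relation.Binary.Construct.Closure.Symmetric using (fwd; bwd)
open import Relation.Binary.Core using (Rel)
open import Relation.Binary.Definitions using (tri<; tri≈; tri>; _Respects_)
open import Relation.Binary.PropositionalEquality.Core as ≡
  using (_≡_; _≢_; cong; cong₂; subst; subst₂)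
open import Relation.Nullary.Decidable
  using (Dec; yes; no; does; _×-dec_; _→-dec_; ¬?; decidable-stable)
open import Relation.Nullary.Negation using (¬_; contradiction)
open import Relation.Unary using (Pred; Decidable; _⊆_; _∈_)

-- The obstacle is that toggles are indexed by labels alone, so one coefficient has to serve every
-- cover with a given label, whether the cover is seen from its lower or from its upper end. The
-- label of `swapAt k z ⋖ z` is the least permutation below `z` that inverts the two swapped
-- letters. Its only descent is at these letters, so it remembers them; when they form a passage it
-- also remembers, by the rook condition, on which side of them `I` and `J` stand in `z`. A passage
-- can therefore be weighted by `side`: the sign telling which of `I` and `J` comes first, and zero
-- outside their stretch. The coefficient is read at the upper end of the cover. If the swap moves
-- `I` or `J` itself, the sign at the lower end differs, and the two indicators in `descentCoeff`
-- correct this. Seen from below, the correction restores the sign exactly. Seen from above, it is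
-- left over, and what is left over is precisely the descents with larger letter `J` or smaller
-- letter `I`.

private
  variable
    m n : ℕ
    c ℓ ℓ₁ ℓ₂ : Level

-- Permutations are read as words: `u ⟨$⟩ʳ k` is the letter at position k, and
-- `u ⟨$⟩ˡ v` is the position of the letter v.

transpose-first : (i j : Fin n) → PC.transpose i j i ≡ j
transpose-first i j with i Fin.≟ i
... | yes _   = ≡.refl
... | no i≢i = contradiction ≡.refl i≢i

transpose-second : (i j : Fin n) → PC.transpose i j j ≡ i
transpose-second i j with j Fin.≟ i
... | yes j≡i = j≡i
... | no _ with j Fin.≟ j
...   | yes _  = ≡.refl
...   | no j≢j = contradiction ≡.refl j≢j

transpose-other : {i j k : Fin n} → k ≢ i → k ≢ j → PC.transpose i j k ≡ k
transpose-other {i = i} {j} {k} k≢i k≢j with k Fin.≟ i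
... | yes k≡i = contradiction k≡i k≢i
... | no _ with k Fin.≟ j
...   | yes k≡j = contradiction k≡j k≢j
...   | no _    = ≡.refl

inject₁<suc : (k : Fin m) → inject₁ k Fin.< suc k
inject₁<suc k = s≤s (ℕ.≤-reflexive (Fin.toℕ-inject₁ k))

≤inject₁⇒<suc : {p : Fin (suc m)} (k : Fin m) → p Fin.≤ inject₁ k → p Fin.< suc k
≤inject₁⇒<suc k p≤k = ℕ.≤-<-trans p≤k (inject₁<suc k)

<suc⇒≤inject₁ : {p : Fin (suc m)} (k : Fin m) → p Fin.< suc k → p Fin.≤ inject₁ k
<suc⇒≤inject₁ k p<k = subst (_ ℕ.≤_) (≡.sym (Fin.toℕ-inject₁ k)) (ℕ.s≤s⁻¹ p<k)

inject₁<⇒suc≤ : {p : Fin (suc m)} (k : Fin m) → inject₁ k Fin.< p → suc k Fin.≤ p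
inject₁<⇒suc≤ {p = p} k = subst (λ x → suc x ℕ.≤ toℕ p) (Fin.toℕ-inject₁ k)

≤⇒≡⊎< : {p q : Fin n} → p Fin.≤ q → p ≡ q ⊎ p Fin.< q
≤⇒≡⊎< {p = p} {q} p≤q with p Fin.≟ q
... | yes p≡q = inj₁ p≡q
... | no  p≢q = inj₂ (Fin.≤∧≢⇒< p≤q p≢q)

-- The arguments of `PC.transpose` are in the order in which the inverse of `swapAt k u` unfolds, so
-- this applies directly to positions of letters. Only the two neighbours can change their relative
-- order, since no position lies between them.
transpose-mono : (k : Fin m) {p q : Fin (suc m)} → p Fin.< q →
  ¬ (p ≡ inject₁ k × q ≡ suc k) →
  PC.transpose (suc k) (inject₁ k) p Fin.< PC.transpose (suc k) (inject₁ k) q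
transpose-mono k {p} {q} p<q other =
  go p<q other (p Fin.≟ inject₁ k) (p Fin.≟ suc k) (q Fin.≟ inject₁ k) (q Fin.≟ suc k)
  where
  i j : _
  i = inject₁ k
  j = suc k
  go : ∀ {p q} → p Fin.< q → ¬ (p ≡ i × q ≡ j) →
    Dec (p ≡ i) → Dec (p ≡ j) → Dec (q ≡ i) → Dec (q ≡ j) →
    PC.transpose j i p Fin.< PC.transpose j i q
  go p<q other (yes ≡.refl) _ _ (yes ≡.refl) = contradiction (≡.refl , ≡.refl) other
  go p<q other (yes ≡.refl) _ (yes ≡.refl) (no _) = contradiction p<q (ℕ.<-irrefl ≡.refl)
  go p<q other (yes ≡.refl) _ (no q≢i) (no q≢j) =
    subst₂ Fin._<_ (≡.sym (transpose-second j i)) (≡.sym (transpose-other q≢j q≢i))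
      (Fin.≤∧≢⇒< (inject₁<⇒suc≤ k p<q) (q≢j ∘ ≡.sym))
  go p<q other (no _) (yes ≡.refl) (yes ≡.refl) _ = contradiction p<q (ℕ.<-asym (inject₁<suc k))
  go p<q other (no _) (yes ≡.refl) (no _) (yes ≡.refl) = contradiction p<q (ℕ.<-irrefl ≡.refl)
  go p<q other (no _) (yes ≡.refl) (no q≢i) (no q≢j) =
    subst₂ Fin._<_ (≡.sym (transpose-first j i)) (≡.sym (transpose-other q≢j q≢i))
      (ℕ.<-trans (inject₁<suc k) p<q)
  go p<q other (no p≢i) (no p≢j) (yes ≡.refl) _ =
    subst₂ Fin._<_ (≡.sym (transpose-other p≢j p≢i)) (≡.sym (transpose-second j i))
      (ℕ.<-trans p<q (inject₁<suc k))
  go p<q other (no p≢i) (no p≢j) (no _) (yes ≡.refl) =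
    subst₂ Fin._<_ (≡.sym (transpose-other p≢j p≢i)) (≡.sym (transpose-first j i))
      (Fin.≤∧≢⇒< (<suc⇒≤inject₁ k p<q) p≢i)
  go p<q other (no p≢i) (no p≢j) (no q≢i) (no q≢j) =
    subst₂ Fin._<_ (≡.sym (transpose-other p≢j p≢i)) (≡.sym (transpose-other q≢j q≢i)) p<q

strictMono-between : (f : Fin (suc m) → Fin n) {i j : Fin (suc m)} → i Fin.< j →
  (∀ k → i Fin.≤ inject₁ k → suc k Fin.≤ j → f (inject₁ k) Fin.< f (suc k)) → f i Fin.< f j
strictMono-between {suc m} f {zero} {suc zero} _ step = step zero z≤n (s≤s z≤n)
strictMono-between {suc m} f {zero} {suc (suc j)} _ step = ℕ.<-trans (step zero z≤n (s≤s z≤n))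
  (strictMono-between (f ∘ suc) {zero} {suc j} (s≤s z≤n) λ k _ k≤j → step (suc k) z≤n (s≤s k≤j))
strictMono-between {suc m} f {suc i} {suc j} (s≤s i<j) step =
  strictMono-between (f ∘ suc) i<j λ k i≤k k≤j → step (suc k) (s≤s i≤k) (s≤s k≤j)

-- The paper's u s_k.
swapAt : Fin m → Permutation′ (suc m) → Permutation′ (suc m)
swapAt k u = Perm.transpose (inject₁ k) (suc k) ∘ₚ u

Ascent Descent : Permutation′ (suc m) → Fin m → Set
Ascent  u k = u ⟨$⟩ʳ inject₁ k Fin.< u ⟨$⟩ʳ suc k
Descent u k = u ⟨$⟩ʳ suc k Fin.< u ⟨$⟩ʳ inject₁ k

Ascent? : (u : Permutation′ (suc m)) (k : Fin m) → Dec (Ascent u k)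
Ascent? u k = (u ⟨$⟩ʳ inject₁ k) Fin.<? (u ⟨$⟩ʳ suc k)

Descent? : (u : Permutation′ (suc m)) (k : Fin m) → Dec (Descent u k)
Descent? u k = (u ⟨$⟩ʳ suc k) Fin.<? (u ⟨$⟩ʳ inject₁ k)

ʳ-injective : (u : Permutation′ n) {p q : Fin n} → u ⟨$⟩ʳ p ≡ u ⟨$⟩ʳ q → p ≡ q
ʳ-injective u = Injection.injective (↔⇒↣ u)

ˡ-injective : (u : Permutation′ n) {v w : Fin n} → u ⟨$⟩ˡ v ≡ u ⟨$⟩ˡ w → v ≡ w
ˡ-injective u = ʳ-injective (Perm.flip u)

position⇒letter : (u : Permutation′ n) {v p : Fin n} → u ⟨$⟩ˡ v ≡ p → v ≡ u ⟨$⟩ʳ p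
position⇒letter u eq = ≡.trans (≡.sym (Perm.inverseʳ u)) (cong (u ⟨$⟩ʳ_) eq)

≈⇒ˡ : (u w : Permutation′ n) → u Perm.≈ w → ∀ v → u ⟨$⟩ˡ v ≡ w ⟨$⟩ˡ v
≈⇒ˡ u w u≈w v = ʳ-injective u (≡.trans (Perm.inverseʳ u)
  (≡.trans (≡.sym (Perm.inverseʳ w)) (≡.sym (u≈w (w ⟨$⟩ˡ v)))))

ascent∨descent : (u : Permutation′ (suc m)) (k : Fin m) → Ascent u k ⊎ Descent u k
ascent∨descent u k with Fin.<-cmp (u ⟨$⟩ʳ inject₁ k) (u ⟨$⟩ʳ suc k)
... | tri< a _ _ = inj₁ a
... | tri≈ _ e _ = contradiction (ʳ-injective u e) (Fin.<⇒≢ (inject₁<suc k))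
... | tri> _ _ d = inj₂ d

swapAt-first : (k : Fin m) (u : Permutation′ (suc m)) → swapAt k u ⟨$⟩ʳ inject₁ k ≡ u ⟨$⟩ʳ suc k
swapAt-first k u = cong (u ⟨$⟩ʳ_) (transpose-first (inject₁ k) (suc k))

swapAt-second : (k : Fin m) (u : Permutation′ (suc m)) → swapAt k u ⟨$⟩ʳ suc k ≡ u ⟨$⟩ʳ inject₁ k
swapAt-second k u = cong (u ⟨$⟩ʳ_) (transpose-second (inject₁ k) (suc k))

swapAt-involutive : (k : Fin m) (u : Permutation′ (suc m)) → swapAt k (swapAt k u) Perm.≈ u
swapAt-involutive k u p = cong (u ⟨$⟩ʳ_) (τ² p)
  where
  τ² : ∀ p → PC.transpose (inject₁ k) (suc k) (PC.transpose (inject₁ k) (suc k) p) ≡ p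
  τ² p = go (p Fin.≟ inject₁ k) (p Fin.≟ suc k)
    where
    go : ∀ {p} → Dec (p ≡ inject₁ k) → Dec (p ≡ suc k) →
      PC.transpose (inject₁ k) (suc k) (PC.transpose (inject₁ k) (suc k) p) ≡ p
    go (yes ≡.refl) _ = ≡.trans (cong (PC.transpose _ _) (transpose-first (inject₁ k) (suc k)))
                            (transpose-second (inject₁ k) (suc k))
    go (no _) (yes ≡.refl) = ≡.trans (cong (PC.transpose _ _) (transpose-second (inject₁ k) (suc k)))
                                 (transpose-first (inject₁ k) (suc k))
    go (no p≢i) (no p≢j) = ≡.trans (cong (PC.transpose _ _) (transpose-other p≢i p≢j))
                                 (transpose-other p≢i p≢j)

swapAt-cong : (k : Fin m) (u v : Permutation′ (suc m)) → u Perm.≈ v → swapAt k u Perm.≈ swapAt k v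
swapAt-cong k u v u≈v p = u≈v _

≤ʷ-reflexive : (u w : Permutation′ n) → u Perm.≈ w → u ≤ʷ w
≤ʷ-reflexive {n} u w = FinitePoset.reflexive (WeakOrder n) {u} {w}

ascent⇒≤ : (k : Fin m) (u : Permutation′ (suc m)) → Ascent u k → u ≤ʷ swapAt k u
ascent⇒≤ k u asc {x , y} (x<y , py<px) = x<y , transpose-mono k py<px λ (ey , ex) →
  ℕ.<-asym x<y (subst₂ Fin._<_ (≡.sym (position⇒letter u ey)) (≡.sym (position⇒letter u ex)) asc)

swapAt-Inv⁻¹ : (k : Fin m) (u : Permutation′ (suc m)) {x y : Fin (suc m)} →
  Inv⁻¹ (swapAt k u) (x , y) →
  Inv⁻¹ u (x , y) ⊎ (x ≡ u ⟨$⟩ʳ inject₁ k × y ≡ u ⟨$⟩ʳ suc k)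
swapAt-Inv⁻¹ k u {x} {y} (x<y , inv) with Fin.<-cmp (u ⟨$⟩ˡ y) (u ⟨$⟩ˡ x)
... | tri< py<px _ _ = inj₁ (x<y , py<px)
... | tri≈ _ e _ = contradiction (≡.sym (ˡ-injective u e)) (Fin.<⇒≢ x<y)
... | tri> _ _ px<py with ((u ⟨$⟩ˡ x) Fin.≟ inject₁ k) ×-dec ((u ⟨$⟩ˡ y) Fin.≟ suc k)
...   | yes (ex , ey) = inj₂ (position⇒letter u ex , position⇒letter u ey)
...   | no other      = contradiction (transpose-mono k px<py other) (ℕ.<-asym inv)

descent-Inv⁻¹ : (k : Fin m) (u : Permutation′ (suc m)) → Descent u k →
  Inv⁻¹ u (u ⟨$⟩ʳ suc k , u ⟨$⟩ʳ inject₁ k)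
descent-Inv⁻¹ k u desc =
  desc , subst₂ Fin._<_ (≡.sym (Perm.inverseˡ u)) (≡.sym (Perm.inverseˡ u)) (inject₁<suc k)

ascent-¬Inv⁻¹ : (k : Fin m) (u : Permutation′ (suc m)) →
  ¬ Inv⁻¹ u (u ⟨$⟩ʳ inject₁ k , u ⟨$⟩ʳ suc k)
ascent-¬Inv⁻¹ k u (_ , inv) = ℕ.<-asym (inject₁<suc k)
  (subst₂ Fin._<_ (Perm.inverseˡ u) (Perm.inverseˡ u) inv)

swapAt-descent : (k : Fin m) (u : Permutation′ (suc m)) → Ascent u k → Descent (swapAt k u) k
swapAt-descent k u = subst₂ Fin._<_ (≡.sym (swapAt-second k u)) (≡.sym (swapAt-first k u))

swapAt-ascent : (k : Fin m) (u : Permutation′ (suc m)) → Descent u k → Ascent (swapAt k u) k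
swapAt-ascent k u = subst₂ Fin._<_ (≡.sym (swapAt-first k u)) (≡.sym (swapAt-second k u))

descent⇒≥ : (k : Fin m) (u : Permutation′ (suc m)) → Descent u k → swapAt k u ≤ʷ u
descent⇒≥ k u desc i = ≤ʷ-reflexive (swapAt k (swapAt k u)) u (swapAt-involutive k u)
  (ascent⇒≤ k (swapAt k u) (swapAt-ascent k u desc) i)

descent-¬Inv⁻¹ : (k : Fin m) (u : Permutation′ (suc m)) →
  ¬ Inv⁻¹ (swapAt k u) (u ⟨$⟩ʳ suc k , u ⟨$⟩ʳ inject₁ k)
descent-¬Inv⁻¹ k u = subst₂ (λ x y → ¬ Inv⁻¹ (swapAt k u) (x , y))
  (swapAt-first k u) (swapAt-second k u) (ascent-¬Inv⁻¹ k (swapAt k u))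

Inv⁻¹-swapAt : (k : Fin m) (u : Permutation′ (suc m)) {x y : Fin (suc m)} →
  Inv⁻¹ u (x , y) →
  Inv⁻¹ (swapAt k u) (x , y) ⊎ (x ≡ u ⟨$⟩ʳ suc k × y ≡ u ⟨$⟩ʳ inject₁ k)
Inv⁻¹-swapAt k u inv
  with swapAt-Inv⁻¹ k (swapAt k u)
         (≤ʷ-reflexive u (swapAt k (swapAt k u)) (≡.sym ∘ swapAt-involutive k u) inv)
... | inj₁ inv′ = inj₁ inv′
... | inj₂ (ex , ey) = inj₂ (≡.trans ex (swapAt-first k u) , ≡.trans ey (swapAt-second k u))

-- If `u` inverted the pair at every descent of `z`, then the position in `u` of the successive
-- letters of `z` would increase at every step: at a descent by assumption, at an ascent because
-- inversions of `u` are inversions of `z`. Both words would then order all letters alike. Hence a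
-- strict relation is witnessed at a single descent, and adjacent swaps give all covers.
¬≤⇒descent : (u z : Permutation′ (suc m)) → u ≤ʷ z → ¬ z ≤ʷ u →
  ∃ λ k → Descent z k × ¬ Inv⁻¹ u (z ⟨$⟩ʳ suc k , z ⟨$⟩ʳ inject₁ k)
¬≤⇒descent u z u≤z z≰u with Fin.any? (λ k → Descent? z k ×-dec ¬? (Inv? (Perm.flip u) (_ , _)))
... | yes found = found
... | no none = ⊥-elim (z≰u z≤u)
  where
  f : _
  f p = u ⟨$⟩ˡ (z ⟨$⟩ʳ p)
  step : ∀ k → f (inject₁ k) Fin.< f (suc k)
  step k with Fin.<-cmp (f (inject₁ k)) (f (suc k)) | ascent∨descent z k
  ... | tri< lt _ _ | _ = lt
  ... | tri≈ _ e _  | _ =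
    contradiction (ʳ-injective z (ˡ-injective u e)) (Fin.<⇒≢ (inject₁<suc k))
  ... | tri> _ _ gt | inj₁ asc  = contradiction (u≤z (asc , gt)) (ascent-¬Inv⁻¹ k z)
  ... | tri> _ _ gt | inj₂ desc =
    contradiction (k , desc , λ (_ , lt) → ℕ.<-asym gt lt) none
  z≤u : z ≤ʷ u
  z≤u {x , y} (x<y , inv) = x<y ,
    subst₂ Fin._<_ (cong (u ⟨$⟩ˡ_) (Perm.inverseʳ z)) (cong (u ⟨$⟩ˡ_) (Perm.inverseʳ z))
      (strictMono-between f inv λ k _ _ → step k)

module _ (P : FinitePoset c ℓ₁ ℓ₂) (Q : Pred (FinitePoset.Carrier P) ℓ)
  (resp : Q Respects (FinitePoset._≈_ P)) (Q? : Decidable Q) where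

  private
    module P = FinitePoset P

    scan : ∃ Q → (xs : List P.Carrier) → ∃ λ x → Q x × All (λ y → Q y → ¬ (y P.< x)) xs
    scan (x₀ , q₀) [] = x₀ , q₀ , []
    scan start (y ∷ ys) with scan start ys
    ... | x , q , min with Q? y | y P.<? x
    ...   | yes qy | yes (y≤x , y≉x) = y , qy , (λ _ (_ , y≉y) → y≉y P.Eq.refl) ∷
      All.map (λ h qz (z≤y , z≉y) → h qz (P.trans z≤y y≤x ,
        λ z≈x → y≉x (P.antisym y≤x (P.≤-respˡ-≈ z≈x z≤y)))) min
    ...   | yes _  | no y≮x = x , q , (λ _ → y≮x) ∷ min
    ...   | no ¬qy | _      = x , q , (λ qy → contradiction qy ¬qy) ∷ min

  ∃-minimal : ∃ Q → ∃ λ x → Q x × (∀ y → Q y → ¬ (y P.< x))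
  ∃-minimal start with scan start P.elements
  ... | x , q , min = x , q , λ y → All.lookupₛ P.setoid
    (λ y≈z h qz z<x → h (resp (P.Eq.sym y≈z) qz) (P.<-respˡ-≈ (P.Eq.sym y≈z) z<x))
    min (P.complete y)

-- Labels of cover relations

-- Permutations with exactly one descent are the Grassmannian permutations other than the identity,
-- which are the join-irreducible elements of weak order.
SoleDescent : Permutation′ (suc m) → Fin m → Set
SoleDescent p l = Descent p l × (∀ l′ → Descent p l′ → l′ ≡ l)

SoleDescent? : (p : Permutation′ (suc m)) (l : Fin m) → Dec (SoleDescent p l)
SoleDescent? p l = Descent? p l ×-dec Fin.all? λ l′ → Descent? p l′ →-dec (l′ Fin.≟ l)

module _ (p : Permutation′ (suc m)) {l : Fin m} (sole : SoleDescent p l) where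

  ascents-before : {i j : Fin (suc m)} → i Fin.< j → j Fin.≤ inject₁ l →
    p ⟨$⟩ʳ i Fin.< p ⟨$⟩ʳ j
  ascents-before i<j j≤l = strictMono-between (p ⟨$⟩ʳ_) i<j step
    where
    step : ∀ k → _ → _ → Ascent p k
    step k _ k<j with ascent∨descent p k
    ... | inj₁ asc = asc
    ... | inj₂ desc = contradiction (subst (λ k → suc k Fin.≤ inject₁ l) (proj₂ sole k desc)
      (ℕ.≤-trans k<j j≤l)) (ℕ.<⇒≱ (inject₁<suc l))

  ascents-after : {i j : Fin (suc m)} → i Fin.< j → suc l Fin.≤ i →
    p ⟨$⟩ʳ i Fin.< p ⟨$⟩ʳ j
  ascents-after i<j l<i = strictMono-between (p ⟨$⟩ʳ_) i<j step
    where
    step : ∀ k → _ → _ → Ascent p k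
    step k i≤k _ with ascent∨descent p k
    ... | inj₁ asc = asc
    ... | inj₂ desc = contradiction (subst (λ k → suc l Fin.≤ inject₁ k) (proj₂ sole k desc)
      (ℕ.≤-trans l<i i≤k)) (ℕ.<⇒≱ (inject₁<suc l))

  soleDescent-Inv⁻¹ : {x y : Fin (suc m)} → Inv⁻¹ p (x , y) →
    (p ⟨$⟩ˡ y) Fin.≤ inject₁ l × suc l Fin.≤ (p ⟨$⟩ˡ x)
  soleDescent-Inv⁻¹ {x} {y} (x<y , inv)
    with (p ⟨$⟩ˡ x) Fin.≤? inject₁ l | (p ⟨$⟩ˡ y) Fin.≤? inject₁ l
  ... | yes x≤l | _ = contradiction
    (subst₂ Fin._<_ (Perm.inverseʳ p) (Perm.inverseʳ p) (ascents-before inv x≤l)) (ℕ.<-asym x<y)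
  ... | no x≰l | yes y≤l = y≤l , inject₁<⇒suc≤ l (ℕ.≰⇒> x≰l)
  ... | no x≰l | no y≰l = contradiction
    (subst₂ Fin._<_ (Perm.inverseʳ p) (Perm.inverseʳ p)
      (ascents-after inv (inject₁<⇒suc≤ l (ℕ.≰⇒> y≰l)))) (ℕ.<-asym x<y)

id-least : (u : Permutation′ n) → Perm.id ≤ʷ u
id-least u (x<y , y<x) = contradiction x<y (ℕ.<-asym y<x)

-- Together with `swapAt≤⇒≤` this sorts the elements below `z` by one bit: those that do not invert
-- the two letters at `k` lie below `swapAt k z`, and those that do reach `z` once joined with it.
-- Covers, joins and labels are all decided by this bit.
≤⇒Inv⁻¹-swapAt : (k : Fin m) (z t : Permutation′ (suc m)) →
  t ≤ʷ z → ¬ Inv⁻¹ t (z ⟨$⟩ʳ suc k , z ⟨$⟩ʳ inject₁ k) → t ≤ʷ swapAt k z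
≤⇒Inv⁻¹-swapAt k z t t≤z none inv with Inv⁻¹-swapAt k z (t≤z inv)
... | inj₁ inv′ = inv′
... | inj₂ (≡.refl , ≡.refl) = contradiction inv none

swapAt≤⇒≤ : (k : Fin m) (z t : Permutation′ (suc m)) →
  swapAt k z ≤ʷ t → Inv⁻¹ t (z ⟨$⟩ʳ suc k , z ⟨$⟩ʳ inject₁ k) → z ≤ʷ t
swapAt≤⇒≤ k z t u≤t inv inv′ with Inv⁻¹-swapAt k z inv′
... | inj₁ inv″ = u≤t inv″
... | inj₂ (≡.refl , ≡.refl) = inv

swapAt-≢ : (k : Fin m) (z : Permutation′ (suc m)) → Descent z k → ¬ z ≤ʷ swapAt k z
swapAt-≢ k z desc z≤u = descent-¬Inv⁻¹ k z (z≤u (descent-Inv⁻¹ k z desc))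

-- Joins are replaced by inversions: at a descent `k`, an element `q` below `z` has join `z` with
-- `swapAt k z` exactly when it inverts the two letters at `k`. So `least` says that `label` is the
-- label of this cover.
record Label (z : Permutation′ (suc m)) (k : Fin m) : Set where
  field
    label         : Permutation′ (suc m)
    label≤        : label ≤ʷ z
    place         : Fin m
    sole          : SoleDescent label place
    larger        : label ⟨$⟩ʳ inject₁ place ≡ z ⟨$⟩ʳ inject₁ k
    smaller       : label ⟨$⟩ʳ suc place ≡ z ⟨$⟩ʳ suc k
    least         : ∀ q → q ≤ʷ z → Inv⁻¹ q (z ⟨$⟩ʳ suc k , z ⟨$⟩ʳ inject₁ k) → label ≤ʷ q

  label-Inv⁻¹ : Inv⁻¹ label (z ⟨$⟩ʳ suc k , z ⟨$⟩ʳ inject₁ k)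
  label-Inv⁻¹ = subst₂ (λ x y → Inv⁻¹ label (x , y)) smaller larger
    (descent-Inv⁻¹ place label (proj₁ sole))

module _ (z : Permutation′ (suc m)) (k : Fin m)
  (p : Permutation′ (suc m)) (p≤z : p ≤ʷ z) {l : Fin m} (sole : SoleDescent p l)
  (larger  : p ⟨$⟩ʳ inject₁ l ≡ z ⟨$⟩ʳ inject₁ k)
  (smaller : p ⟨$⟩ʳ suc l ≡ z ⟨$⟩ʳ suc k) where

  private
    x y : Fin (suc m)
    x = z ⟨$⟩ʳ suc k
    y = z ⟨$⟩ʳ inject₁ k

    px : p ⟨$⟩ˡ x ≡ suc l
    px = ≡.trans (cong (p ⟨$⟩ˡ_) (≡.sym smaller)) (Perm.inverseˡ p)
    py : p ⟨$⟩ˡ y ≡ inject₁ l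
    py = ≡.trans (cong (p ⟨$⟩ˡ_) (≡.sym larger)) (Perm.inverseˡ p)
    zx : z ⟨$⟩ˡ x ≡ suc k
    zx = Perm.inverseˡ z
    zy : z ⟨$⟩ˡ y ≡ inject₁ k
    zy = Perm.inverseˡ z

    before⇒≤ : ∀ {β} → (p ⟨$⟩ˡ β) Fin.≤ inject₁ l → β Fin.≤ y
    before⇒≤ le with ≤⇒≡⊎< le
    ... | inj₁ e  = Fin.≤-reflexive (≡.trans (position⇒letter p e) larger)
    ... | inj₂ lt = ℕ.<⇒≤ (subst₂ Fin._<_ (Perm.inverseʳ p) larger
      (ascents-before p sole lt Fin.≤-refl))

    after⇒≥ : ∀ {α} → suc l Fin.≤ (p ⟨$⟩ˡ α) → x Fin.≤ α
    after⇒≥ le with ≤⇒≡⊎< le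
    ... | inj₁ e  = Fin.≤-reflexive (≡.trans (≡.sym smaller) (≡.sym (position⇒letter p (≡.sym e))))
    ... | inj₂ lt = ℕ.<⇒≤ (subst₂ Fin._<_ smaller (Perm.inverseʳ p)
      (ascents-after p sole lt Fin.≤-refl))

  -- An inversion (α, β) of `p` straddles its descent: β stands weakly before `y`, then comes `x`,
  -- then weakly later α, and x ≤ α < β ≤ y. If `q` had `y` before β, so would `z`; but `p`, hence
  -- `z`, has β before `x`, and nothing fits between the neighbours `y` and `x` of `z`. The bound
  -- for α is symmetric.
  soleDescent-least : ∀ q → q ≤ʷ z → Inv⁻¹ q (x , y) → p ≤ʷ q
  soleDescent-least q q≤z inv-q {α , β} inv@(α<β , _) =
    α<β , ℕ.≤-<-trans qβ≤qy (ℕ.<-≤-trans (proj₂ inv-q) qx≤qα)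
    where
    pβ≤l : (p ⟨$⟩ˡ β) Fin.≤ inject₁ l
    pβ≤l = proj₁ (soleDescent-Inv⁻¹ p sole inv)
    l<pα : suc l Fin.≤ (p ⟨$⟩ˡ α)
    l<pα = proj₂ (soleDescent-Inv⁻¹ p sole inv)
    zβ<zx : x Fin.< β → (z ⟨$⟩ˡ β) Fin.< (z ⟨$⟩ˡ x)
    zβ<zx x<β = proj₂ (p≤z (x<β , subst ((p ⟨$⟩ˡ β) Fin.<_) (≡.sym px) (≤inject₁⇒<suc l pβ≤l)))
    zy<zα : α Fin.< y → (z ⟨$⟩ˡ y) Fin.< (z ⟨$⟩ˡ α)
    zy<zα α<y = proj₂ (p≤z (α<y , subst (Fin._< (p ⟨$⟩ˡ α)) (≡.sym py)
      (ℕ.<-≤-trans (inject₁<suc l) l<pα)))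
    qβ≤qy : (q ⟨$⟩ˡ β) Fin.≤ (q ⟨$⟩ˡ y)
    qβ≤qy with (q ⟨$⟩ˡ β) Fin.≤? (q ⟨$⟩ˡ y) | ≤⇒≡⊎< (before⇒≤ pβ≤l)
    ... | yes le | _ = le
    ... | no _ | inj₁ β≡y = Fin.≤-reflexive (cong (q ⟨$⟩ˡ_) β≡y)
    ... | no ≰ | inj₂ β<y = contradiction (zβ<zx (ℕ.≤-<-trans (after⇒≥ l<pα) α<β))
      (ℕ.≤⇒≯ (subst (Fin._≤ (z ⟨$⟩ˡ β)) (≡.sym zx) (inject₁<⇒suc≤ k
        (subst (Fin._< (z ⟨$⟩ˡ β)) zy (proj₂ (q≤z (β<y , ℕ.≰⇒> ≰)))))))
    qx≤qα : (q ⟨$⟩ˡ x) Fin.≤ (q ⟨$⟩ˡ α)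
    qx≤qα with (q ⟨$⟩ˡ x) Fin.≤? (q ⟨$⟩ˡ α) | ≤⇒≡⊎< (after⇒≥ l<pα)
    ... | yes le | _ = le
    ... | no _ | inj₁ x≡α = Fin.≤-reflexive (cong (q ⟨$⟩ˡ_) x≡α)
    ... | no ≰ | inj₂ x<α = contradiction (zy<zα (ℕ.<-≤-trans α<β (before⇒≤ pβ≤l)))
      (ℕ.≤⇒≯ (subst ((z ⟨$⟩ˡ α) Fin.≤_) (≡.sym zy) (<suc⇒≤inject₁ k
        (subst ((z ⟨$⟩ˡ α) Fin.<_) zx (proj₂ (q≤z (x<α , ℕ.≰⇒> ≰)))))))

-- A minimal permutation below z that still inverts the two letters swapped at k
-- has no other descent.
minimal⇒label : (z : Permutation′ (suc m)) (k : Fin m) (p : Permutation′ (suc m)) →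
  p ≤ʷ z → Inv⁻¹ p (z ⟨$⟩ʳ suc k , z ⟨$⟩ʳ inject₁ k) →
  (∀ l → Descent p l → ¬ Inv⁻¹ (swapAt l p) (z ⟨$⟩ʳ suc k , z ⟨$⟩ʳ inject₁ k)) →
  Label z k
minimal⇒label {m} z k p p≤z inv minimal
  with ¬≤⇒descent Perm.id p (λ {i} → id-least p {i})
         (λ p≤id → ℕ.<-asym (proj₁ inv) (proj₂ (p≤id inv)))
... | l , desc , _ = record
  { label = p ; label≤ = p≤z ; place = l ; sole = sole
  ; larger = ≡.sym (proj₂ (only l desc)) ; smaller = ≡.sym (proj₁ (only l desc))
  ; least = soleDescent-least z k p p≤z sole
      (≡.sym (proj₂ (only l desc))) (≡.sym (proj₁ (only l desc)))
  }
  where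
  only : ∀ l → Descent p l →
    z ⟨$⟩ʳ suc k ≡ p ⟨$⟩ʳ suc l × z ⟨$⟩ʳ inject₁ k ≡ p ⟨$⟩ʳ inject₁ l
  only l d with Inv⁻¹-swapAt l p inv
  ... | inj₁ inv′ = contradiction inv′ (minimal l d)
  ... | inj₂ eqs  = eqs
  sole : SoleDescent p l
  sole = desc , λ l′ d → Fin.suc-injective (ʳ-injective p
    (≡.trans (≡.sym (proj₁ (only l′ d))) (proj₁ (only l desc))))

-- Finiteness only provides a minimal element among those below `z` that invert the pair; that it is
-- the least one comes from `soleDescent-least`.
descentLabel : (z : Permutation′ (suc m)) (k : Fin m) → Descent z k → Label z k
descentLabel {m} z k desc = fromMinimal
  (∃-minimal (WeakOrder (suc m)) Q (λ {q} {r} → resp {q} {r})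
    (λ q → (q W.≤? z) ×-dec Inv? (Perm.flip q) (x , y))
    (z , (λ {i} inv → inv) , descent-Inv⁻¹ k z desc))
  where
  module W = FinitePoset (WeakOrder (suc m))
  x y : Fin (suc m)
  x = z ⟨$⟩ʳ suc k
  y = z ⟨$⟩ʳ inject₁ k
  Q : Permutation′ (suc m) → Set
  Q q = q ≤ʷ z × Inv⁻¹ q (x , y)
  resp : Q Respects Perm._≈_
  resp {q} {r} q≈r (q≤z , inv) =
    (λ {i} i∈ → q≤z (≤ʷ-reflexive r q (≡.sym ∘ q≈r) i∈)) , ≤ʷ-reflexive q r q≈r inv
  fromMinimal : (∃ λ p → Q p × (∀ q → Q q → ¬ (q W.< p))) → Label z k
  fromMinimal (p , (p≤z , inv) , minimal) = minimal⇒label z k p p≤z inv λ l d inv′ →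
    minimal (swapAt l p)
      ((λ {i} i∈ → p≤z (descent⇒≥ l p d i∈)) , inv′)
      ((λ {i} → descent⇒≥ l p d {i}) ,
       λ eq → swapAt-≢ l p d (λ {i} → ≤ʷ-reflexive p (swapAt l p) (≡.sym ∘ eq) {i}))

-- Covers, labels and join-irreducible elements of the interval.

module LowerInterval {m : ℕ} (w : Permutation′ (suc m)) where

  module P = FinitePoset [e, w ]

  below : (u : Permutation′ (suc m)) → u ≤ʷ w → P.Carrier
  below u u≤w = u , (λ {i} → id-least u {i}) , (λ {i} → u≤w {i})

  below-≤ : (x : P.Carrier) → proj₁ x ≤ʷ w
  below-≤ x = proj₂ (proj₂ x)

  lower : (z : P.Carrier) (k : Fin m) → Descent (proj₁ z) k → P.Carrier
  lower z k desc = below (swapAt k (proj₁ z))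
    λ i → below-≤ z (descent⇒≥ k (proj₁ z) desc i)

  lower-⋖ : (z : P.Carrier) (k : Fin m) (desc : Descent (proj₁ z) k) → lower z k desc P.⋖ z
  lower-⋖ z k desc =
    ((λ {i} → descent⇒≥ k (proj₁ z) desc {i}) ,
     λ eq → swapAt-≢ k (proj₁ z) desc
       (λ {i} → ≤ʷ-reflexive (proj₁ z) (swapAt k (proj₁ z)) (≡.sym ∘ eq) {i})) ,
    λ t (u<t , t<z) → none t u<t t<z (Inv? (Perm.flip (proj₁ t)) _)
    where
    none : ∀ t → lower z k desc P.< t → t P.< z →
      ¬ Dec (Inv⁻¹ (proj₁ t) (proj₁ z ⟨$⟩ʳ suc k , proj₁ z ⟨$⟩ʳ inject₁ k))
    none t (u≤t , _) (t≤z , t≉z) (yes inv) = t≉z (P.antisym {t} {z} (λ {i} → t≤z {i})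
      λ {i} → swapAt≤⇒≤ k (proj₁ z) (proj₁ t) (λ {i} → u≤t {i}) inv {i})
    none t (u≤t , u≉t) (t≤z , _) (no ¬inv) =
      u≉t (P.antisym {lower z k desc} {t} (λ {i} → u≤t {i})
        λ {i} → ≤⇒Inv⁻¹-swapAt k (proj₁ z) (proj₁ t) (λ {i} → t≤z {i}) ¬inv {i})

  <⇒≤-lower : ∀ {x z} → x P.< z → ∃₂ λ k (desc : Descent (proj₁ z) k) → x P.≤ lower z k desc
  <⇒≤-lower {x} {z} (x≤z , x≉z)
    with ¬≤⇒descent (proj₁ x) (proj₁ z) (λ {i} → x≤z {i})
           (λ z≤x → x≉z (P.antisym {x} {z} (λ {i} → x≤z {i}) (λ {i} → z≤x {i})))
  ... | k , desc , ¬inv = k , desc ,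
    λ {i} → ≤⇒Inv⁻¹-swapAt k (proj₁ z) (proj₁ x) (λ {i} → x≤z {i}) ¬inv {i}

  ⋖⇒lower : ∀ {x z} → x P.⋖ z → ∃₂ λ k (desc : Descent (proj₁ z) k) → x P.≈ lower z k desc
  ⋖⇒lower {x} {z} (x<z , none) =
    split (<⇒≤-lower {x} {z} x<z) λ k desc → x P.≟ lower z k desc
    where
    split : (∃₂ λ k (desc : Descent (proj₁ z) k) → x P.≤ lower z k desc) →
      (∀ k desc → Dec (x P.≈ lower z k desc)) →
      ∃₂ λ k (desc : Descent (proj₁ z) k) → x P.≈ lower z k desc
    split (k , desc , x≤u) x≈u? = k , desc , decidable-stable (x≈u? k desc) λ x≉u →
      none (lower z k desc) (((λ {i} → x≤u {i}) , x≉u) , proj₁ (lower-⋖ z k desc))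

  upper : (u : P.Carrier) (k : Fin m) → swapAt k (proj₁ u) ≤ʷ w → P.Carrier
  upper u k ≤w = below (swapAt k (proj₁ u)) λ i → ≤w i

  upper-⋖ : (u : P.Carrier) (k : Fin m) (≤w : swapAt k (proj₁ u) ≤ʷ w) →
    Ascent (proj₁ u) k → u P.⋖ upper u k ≤w
  upper-⋖ u k ≤w asc = P.⋖-resp-≈ {lower z k desc} {u} {z} {z}
    (swapAt-involutive k (proj₁ u)) (P.Eq.refl {z}) (lower-⋖ z k desc)
    where
    z : P.Carrier
    z = upper u k ≤w
    desc : Descent (proj₁ z) k
    desc = swapAt-descent k (proj₁ u) asc

  ⋖⇒upper : ∀ {u z} → u P.⋖ z →
    ∃ λ k → Ascent (proj₁ u) k × proj₁ z Perm.≈ swapAt k (proj₁ u)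
  ⋖⇒upper {u} {z} u⋖z = split (⋖⇒lower {u} {z} u⋖z)
    where
    split : (∃₂ λ k (desc : Descent (proj₁ z) k) → u P.≈ lower z k desc) →
      ∃ λ k → Ascent (proj₁ u) k × proj₁ z Perm.≈ swapAt k (proj₁ u)
    split (k , desc , u≈) = k ,
      subst₂ Fin._<_ (≡.sym (u≈ (inject₁ k))) (≡.sym (u≈ (suc k)))
        (swapAt-ascent k (proj₁ z) desc) ,
      λ p → ≡.trans (≡.sym (swapAt-involutive k (proj₁ z) p))
        (≡.sym (swapAt-cong k (proj₁ u) (swapAt k (proj₁ z)) u≈ p))

  γ : (z : P.Carrier) (k : Fin m) → Descent (proj₁ z) k → P.Carrier
  γ z k desc = below (Label.label L) λ i → below-≤ z (Label.label≤ L i)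
    where
    L : Label (proj₁ z) k
    L = descentLabel (proj₁ z) k desc

  γ-isLabel : (z : P.Carrier) (k : Fin m) (desc : Descent (proj₁ z) k) →
    P.IsLabel (lower z k desc) z (γ z k desc)
  γ-isLabel z k desc =
    ((λ {i} → descent⇒≥ k (proj₁ z) desc {i}) , (λ {i} → L.label≤ {i}) ,
     λ t u≤t p≤t {i} → swapAt≤⇒≤ k (proj₁ z) (proj₁ t) (λ {i} → u≤t {i}) (p≤t L.label-Inv⁻¹) {i}) ,
    λ q (_ , q≤z , join) {i} → L.least (proj₁ q) (λ {i} → q≤z {i})
      (inverted q (λ {i} → q≤z {i}) (λ t u≤t q≤t {i} → join t u≤t q≤t {i}) (Inv? (Perm.flip (proj₁ q)) _)) {i}
    where
    module L = Label (descentLabel (proj₁ z) k desc)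
    inverted : ∀ q → q P.≤ z → (∀ t → lower z k desc P.≤ t → q P.≤ t → z P.≤ t) →
      Dec (Inv⁻¹ (proj₁ q) (proj₁ z ⟨$⟩ʳ suc k , proj₁ z ⟨$⟩ʳ inject₁ k)) →
      Inv⁻¹ (proj₁ q) (proj₁ z ⟨$⟩ʳ suc k , proj₁ z ⟨$⟩ʳ inject₁ k)
    inverted q q≤z join (yes inv) = inv
    -- Otherwise `lower z k desc` would be an upper bound of itself and `q`, and so would lie above
    -- their join `z`.
    inverted q q≤z join (no ¬inv) = ⊥-elim (swapAt-≢ k (proj₁ z) desc
      (λ {i} → join (lower z k desc) (λ {i} inv → inv)
        (λ {i} → ≤⇒Inv⁻¹-swapAt k (proj₁ z) (proj₁ q) (λ {i} → q≤z {i}) ¬inv {i}) {i}))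

  label-unique : ∀ {x z p q} → P.IsLabel x z p → P.IsLabel x z q → p P.≈ q
  label-unique {x} {z} {p} {q} (join-p , min-p) (join-q , min-q) =
    P.antisym {p} {q} (λ {i} → min-p q join-q {i}) (λ {i} → min-q p join-p {i})

  γ-unique : ∀ {x z p} (k : Fin m) (desc : Descent (proj₁ z) k) →
    x P.≈ lower z k desc → P.IsLabel x z p → p P.≈ γ z k desc
  γ-unique {x} {z} {p} k desc x≈ lab = label-unique {lower z k desc} {z} {p} {γ z k desc}
    (P.IsLabel-resp-≈ {x} {lower z k desc} {z} {z} {p} x≈ (P.Eq.refl {z}) lab)
    (γ-isLabel z k desc)

  join-unique : ∀ {x p z z′} → P.IsJoin x p z → P.IsJoin x p z′ → z P.≈ z′
  join-unique {x} {p} {z} {z′} (x≤z , p≤z , least) (x≤z′ , p≤z′ , least′) =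
    P.antisym {z} {z′} (λ {i} → least z′ (λ {i} → x≤z′ {i}) (λ {i} → p≤z′ {i}) {i})
      (λ {i} → least′ z (λ {i} → x≤z {i}) (λ {i} → p≤z {i}) {i})

  soleDescent-≈ : ∀ {p q : Permutation′ (suc m)} {l l′} → p Perm.≈ q →
    SoleDescent p l → SoleDescent q l′ → l ≡ l′
  soleDescent-≈ p≈q (desc , _) (_ , only) =
    only _ (subst₂ Fin._<_ (p≈q _) (p≈q _) desc)

  -- A label has one descent, so it determines the letters there. For two lower covers of one
  -- element, or two upper covers of one element, this recovers the position of the swap from the
  -- label.
  γ-smaller : (z z′ : P.Carrier) {k k′ : Fin m}
    (desc : Descent (proj₁ z) k) (desc′ : Descent (proj₁ z′) k′) →
    γ z k desc P.≈ γ z′ k′ desc′ → proj₁ z ⟨$⟩ʳ suc k ≡ proj₁ z′ ⟨$⟩ʳ suc k′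
  γ-smaller z z′ {k} {k′} desc desc′ eq =
    ≡.trans (≡.sym L.smaller) (≡.trans (eq (suc L.place))
      (≡.trans (cong (λ l → L′.label ⟨$⟩ʳ suc l) place≡) L′.smaller))
    where
    module L = Label (descentLabel (proj₁ z) k desc)
    module L′ = Label (descentLabel (proj₁ z′) k′ desc′)
    place≡ : L.place ≡ L′.place
    place≡ = soleDescent-≈ {L.label} {L′.label} eq L.sole L′.sole

  γ-injective : (z : P.Carrier) {k k′ : Fin m}
    (desc : Descent (proj₁ z) k) (desc′ : Descent (proj₁ z) k′) →
    γ z k desc P.≈ γ z k′ desc′ → k ≡ k′
  γ-injective z desc desc′ eq =
    Fin.suc-injective (ʳ-injective (proj₁ z) (γ-smaller z z desc desc′ eq))

  isLabel-≈ : ∀ {x z p q} → p P.≈ q → P.IsLabel x z p → P.IsLabel x z q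
  isLabel-≈ {x} {z} {p} {q} p≈q (join , min) =
    P.IsJoin-resp-≈ {x} {x} {p} {q} {z} {z} (P.Eq.refl {x}) p≈q (P.Eq.refl {z}) join ,
    λ t j → P.≤-respˡ-≈ {t} {p} {q} p≈q (min t j)

  labelled-lower-unique : ∀ {x x′ z p} →
    x P.⋖ z → P.IsLabel x z p → x′ P.⋖ z → P.IsLabel x′ z p → x P.≈ x′
  labelled-lower-unique {x} {x′} {z} {p} x⋖z lab x′⋖z lab′ =
    split (⋖⇒lower {x} {z} x⋖z) (⋖⇒lower {x′} {z} x′⋖z)
    where
    same : ∀ {k k′ desc desc′} → k ≡ k′ →
      x P.≈ lower z k desc → x′ P.≈ lower z k′ desc′ → x P.≈ x′
    same ≡.refl x≈ x′≈ i = ≡.trans (x≈ i) (≡.sym (x′≈ i))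
    split : (∃₂ λ k (desc : Descent (proj₁ z) k) → x P.≈ lower z k desc) →
      (∃₂ λ k (desc : Descent (proj₁ z) k) → x′ P.≈ lower z k desc) → x P.≈ x′
    split (k , desc , x≈) (k′ , desc′ , x′≈) = same {k} {k′} {desc} {desc′}
      (γ-injective z desc desc′
        (P.Eq.trans {γ z k desc} {p} {γ z k′ desc′}
          (P.Eq.sym {p} {γ z k desc} (γ-unique {x} {z} {p} k desc x≈ lab))
          (γ-unique {x′} {z} {p} k′ desc′ x′≈ lab′))) x≈ x′≈

  -- Everything strictly below `p` lies below its unique lower cover, which therefore bounds the
  -- join of any two such elements.
  soleDescent⇒joinIrreducible : (p : P.Carrier) {l : Fin m} →
    SoleDescent (proj₁ p) l → P.JoinIrreducible p
  soleDescent⇒joinIrreducible p {l} (desc , only) = not-bottom , irreducible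
    where
    not-bottom : ¬ (∀ x → p P.≤ x)
    not-bottom bottom =
      swapAt-≢ l (proj₁ p) desc λ {i} → bottom (lower p l desc) {i}
    ≤lower : ∀ {x} → x P.< p → x P.≤ lower p l desc
    ≤lower {x} x<p = subst-place (<⇒≤-lower {x} {p} x<p)
      where
      subst-place : (∃₂ λ k (d : Descent (proj₁ p) k) → x P.≤ lower p k d) → x P.≤ lower p l desc
      subst-place (k , d , x≤) {i} =
        subst (λ k → proj₁ x ≤ʷ swapAt k (proj₁ p)) (only k d) (λ {i} → x≤ {i}) {i}
    irreducible : ∀ x y → P.IsJoin x y p → p P.≈ x ⊎ p P.≈ y
    irreducible x y (x≤p , y≤p , least) with x P.≟ p | y P.≟ p
    ... | yes x≈p | _ = inj₁ (≡.sym ∘ x≈p)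
    ... | no _ | yes y≈p = inj₂ (≡.sym ∘ y≈p)
    ... | no x≉p | no y≉p = ⊥-elim (swapAt-≢ l (proj₁ p) desc
      λ {i} → least (lower p l desc)
        (λ {i} → ≤lower {x} ((λ {i} → x≤p {i}) , x≉p) {i})
        (λ {i} → ≤lower {y} ((λ {i} → y≤p {i}) , y≉p) {i}) {i})

-- Sums over a commutative ring

module Sums {r ρ} (R : CommutativeRing r ρ) where

  open CommutativeRing R hiding (zero)
  open import Algebra.Properties.Ring ring using (-‿+-comm; -0#≈0#)
  open import Algebra.Properties.Semiring.Sum semiring public
    using (sum; sum-cong-≋; ∑-distrib-+; ∑-comm; *-distribˡ-sum; sum-replicate; sum-replicate-zero)
  open import Algebra.Properties.Semiring.Mult semiring public using (×-assoc-*; ×-homo-+) renaming (_×_ to _·_)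
  open import Relation.Binary.Reasoning.Setoid setoid

  private
    variable
      a b : Level
      A : Set a
      B : Set b

  -- Unfolds to the same term as `indicator`, so that over the field `toggle` and `𝒯` agree by
  -- definition.
  ind : Dec A → Carrier
  ind A? = if does A? then 1# else 0#

  ind-yes : (A? : Dec A) → A → ind A? ≈ 1#
  ind-yes (yes _) _ = refl
  ind-yes (no ¬a) a = contradiction a ¬a

  ind-no : (A? : Dec A) → ¬ A → ind A? ≈ 0#
  ind-no (yes a) ¬a = contradiction a ¬a
  ind-no (no _)  _  = refl

  ind-cong : (A? : Dec A) (B? : Dec B) → (A → B) → (B → A) → ind A? ≈ ind B?
  ind-cong (yes a) B? f _ = sym (ind-yes B? (f a))
  ind-cong (no ¬a) B? _ g = sym (ind-no B? (¬a ∘ g))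

  sum-zero : (f : Fin n → Carrier) → (∀ i → f i ≈ 0#) → sum f ≈ 0#
  sum-zero {n} f f≈0 = trans (sum-cong-≋ f≈0) (sum-replicate-zero n)

  sum-single : (f : Fin n → Carrier) (i : Fin n) → (∀ j → j ≢ i → f j ≈ 0#) → sum f ≈ f i
  sum-single {suc n} f zero    zeros = trans
    (+-congˡ (sum-zero (f ∘ suc) λ j → zeros (suc j) λ ())) (+-identityʳ _)
  sum-single {suc n} f (suc i) zeros = trans
    (+-cong (zeros zero λ ()) (sum-single (f ∘ suc) i λ j j≢i → zeros (suc j) (j≢i ∘ Fin.suc-injective)))
    (+-identityˡ _)

  sum-neg : (f : Fin n → Carrier) → sum (λ i → - f i) ≈ - sum f
  sum-neg {zero}  f = sym -0#≈0#
  sum-neg {suc n} f = trans (+-congˡ (sum-neg (f ∘ suc))) (-‿+-comm _ _)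

  sum-distrib-minus : (f g : Fin n → Carrier) → sum (λ i → f i - g i) ≈ sum f - sum g
  sum-distrib-minus f g = trans (∑-distrib-+ f (λ i → - g i)) (+-congˡ (sum-neg g))

  sum-const : ∀ n x → sum {n} (λ _ → x) ≈ (n · 1#) * x
  sum-const n x = trans (sum-replicate n) (sym (trans (×-assoc-* n 1# x) (·-cong n (*-identityˡ x))))
    where open import Algebra.Properties.Monoid.Mult +-monoid using () renaming (×-congʳ to ·-cong)

  sum-+ : ∀ m {n} (f : Fin (m ℕ.+ n) → Carrier) →
    sum f ≈ sum (λ i → f (i ↑ˡ n)) + sum (λ i → f (m ↑ʳ i))
  sum-+ zero    f = sym (+-identityˡ _)
  sum-+ (suc m) f = trans (+-congˡ (sum-+ m (f ∘ suc))) (sym (+-assoc _ _ _))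

  sum-combine : ∀ m n (f : Fin (m ℕ.* n) → Carrier) →
    sum f ≈ sum (λ i → sum (λ j → f (combine {m} {n} i j)))
  sum-combine zero    n f = refl
  sum-combine (suc m) n f = trans (sum-+ n f) (+-congˡ (sum-combine m n (λ i → f (n ↑ʳ i))))

  sum-quotient : ∀ m n (f : Fin m → Carrier) →
    sum (λ t → f (proj₁ (remQuot {m} n t))) ≈ (n · 1#) * sum f
  sum-quotient m n f = begin
    sum (λ t → f (proj₁ (remQuot {m} n t)))                                ≈⟨ sum-combine m n _ ⟩
    sum (λ i → sum (λ j → f (proj₁ (remQuot {m} n (combine {m} {n} i j)))))
      ≈⟨ sum-cong-≋ (λ i → sum-cong-≋ λ j → reflexive (cong (f ∘ proj₁) (Fin.remQuot-combine {m} {n} i j))) ⟩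
    sum (λ i → sum {n} (λ j → f i))                                        ≈⟨ sum-cong-≋ (λ i → sum-const n (f i)) ⟩
    sum (λ i → (n · 1#) * f i)                                             ≈⟨ *-distribˡ-sum (n · 1#) f ⟨
    (n · 1#) * sum f                                                       ∎

  sum-cast : ∀ {m n} (eq : m ≡ n) (f : Fin n → Carrier) → sum (λ i → f (cast eq i)) ≈ sum f
  sum-cast ≡.refl f = sum-cong-≋ λ i → reflexive (cong f (Fin.cast-is-id ≡.refl i))

  -- The couples (t / b , t / a) with t < ab list every row b times and every
  -- column a times.
  sum-antidiagonal : ∀ a b {x} (f : Fin a → Carrier) (g : Fin b → Carrier) →
    sum f ≈ x → sum g ≈ x →
    (∀ (t : Fin (a ℕ.* b)) →
       f (proj₁ (remQuot {a} b t)) + g (proj₁ (remQuot {b} a (cast (ℕ.*-comm a b) t))) ≈ 1#) →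
    ((a ℕ.+ b) · 1#) * x ≈ (a ℕ.* b) · 1#
  sum-antidiagonal a b {x} f g f≈x g≈x each = begin
    ((a ℕ.+ b) · 1#) * x                    ≈⟨ *-congʳ (×-homo-+ 1# a b) ⟩
    (a · 1# + b · 1#) * x                   ≈⟨ *-congʳ (+-comm _ _) ⟩
    (b · 1# + a · 1#) * x                   ≈⟨ distribʳ x _ _ ⟩
    (b · 1#) * x + (a · 1#) * x             ≈⟨ +-cong (*-congˡ f≈x) (*-congˡ g≈x) ⟨
    (b · 1#) * sum f + (a · 1#) * sum g     ≈⟨ +-cong (sum-quotient a b f)
      (trans (sum-cast (ℕ.*-comm a b) _) (sum-quotient b a g)) ⟨
    sum F + sum G                           ≈⟨ ∑-distrib-+ F G ⟨
    sum (λ t → F t + G t)                   ≈⟨ sum-cong-≋ each ⟩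
    sum {a ℕ.* b} (λ _ → 1#)                ≈⟨ sum-replicate (a ℕ.* b) ⟩
    (a ℕ.* b) · 1#                          ∎
    where
    F G : Fin (a ℕ.* b) → Carrier
    F t = f (proj₁ (remQuot {a} b t))
    G t = g (proj₁ (remQuot {b} a (cast (ℕ.*-comm a b) t)))

  -- A sum over a tail instead of a stretch: the tail from `I` minus the tail from `J` is the signed
  -- sum over the stretch between them, whichever comes first.
  telescope : (f : Fin (suc m) → Carrier) (i : Fin (suc m)) →
    sum (λ k → ind (i Fin.≤? inject₁ k) * (f (suc k) - f (inject₁ k))) ≈ f (fromℕ m) - f i
  telescope {zero}  f zero = sym (-‿inverseʳ _)
  telescope {suc m} f zero = begin
    1# * (f (suc zero) - f zero) + sum (λ k → ind (zero {m} Fin.≤? inject₁ k) * (f (suc (suc k)) - f (suc (inject₁ k))))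
      ≈⟨ +-cong (*-identityˡ _) (telescope (f ∘ suc) zero) ⟩
    (f (suc zero) - f zero) + (f (suc (fromℕ m)) - f (suc zero)) ≈⟨ +-comm _ _ ⟩
    (f (suc (fromℕ m)) - f (suc zero)) + (f (suc zero) - f zero) ≈⟨ +-assoc _ _ _ ⟩
    f (suc (fromℕ m)) + (- f (suc zero) + (f (suc zero) - f zero)) ≈⟨ +-congˡ (sym (+-assoc _ _ _)) ⟩
    f (suc (fromℕ m)) + ((- f (suc zero) + f (suc zero)) - f zero) ≈⟨ +-congˡ (+-congʳ (-‿inverseˡ _)) ⟩
    f (suc (fromℕ m)) + (0# - f zero) ≈⟨ +-congˡ (+-identityˡ _) ⟩
    f (suc (fromℕ m)) - f zero ∎
  telescope {suc m} f (suc i) = begin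
    0# * (f (suc zero) - f zero) +
    sum (λ k → ind (suc i Fin.≤? suc (inject₁ k)) * (f (suc (suc k)) - f (suc (inject₁ k))))
      ≈⟨ trans (+-congʳ (zeroˡ _)) (+-identityˡ _) ⟩
    sum (λ k → ind (suc i Fin.≤? suc (inject₁ k)) * (f (suc (suc k)) - f (suc (inject₁ k))))
      ≈⟨ sum-cong-≋ {m} (λ k → *-congʳ {f (suc (suc k)) - f (suc (inject₁ k))}
           (ind-cong (suc i Fin.≤? suc (inject₁ k)) (i Fin.≤? inject₁ k) ℕ.s≤s⁻¹ s≤s)) ⟩
    sum (λ k → ind (i Fin.≤? inject₁ k) * (f (suc (suc k)) - f (suc (inject₁ k))))
      ≈⟨ telescope (f ∘ suc) i ⟩
    f (suc (fromℕ m)) - f (suc i) ∎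

  listSum : (A → Carrier) → List A → Carrier
  listSum f xs = foldr _+_ 0# (map f xs)

  listSum-cong : {f g : A → Carrier} → (∀ x → f x ≈ g x) → ∀ xs → listSum f xs ≈ listSum g xs
  listSum-cong f≈g []       = refl
  listSum-cong f≈g (x ∷ xs) = +-cong (f≈g x) (listSum-cong f≈g xs)

  listSum-zero : (xs : List A) → listSum (λ _ → 0#) xs ≈ 0#
  listSum-zero []       = refl
  listSum-zero (x ∷ xs) = trans (+-identityˡ _) (listSum-zero xs)

  listSum-+ : (f g : A → Carrier) (xs : List A) →
    listSum (λ x → f x + g x) xs ≈ listSum f xs + listSum g xs
  listSum-+ f g []       = sym (+-identityʳ _)
  listSum-+ f g (x ∷ xs) = begin
    (f x + g x) + listSum (λ x → f x + g x) xs ≈⟨ +-congˡ (listSum-+ f g xs) ⟩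
    (f x + g x) + (F + G)                      ≈⟨ +-assoc _ _ _ ⟩
    f x + (g x + (F + G))                      ≈⟨ +-congˡ (sym (+-assoc _ _ _)) ⟩
    f x + ((g x + F) + G)                      ≈⟨ +-congˡ (+-congʳ (+-comm _ _)) ⟩
    f x + ((F + g x) + G)                      ≈⟨ +-congˡ (+-assoc _ _ _) ⟩
    f x + (F + (g x + G))                      ≈⟨ sym (+-assoc _ _ _) ⟩
    (f x + F) + (g x + G)                      ∎
    where
    F G : Carrier
    F = listSum f xs
    G = listSum g xs

  listSum-*ˡ : (c : Carrier) (f : A → Carrier) (xs : List A) →
    listSum (λ x → c * f x) xs ≈ c * listSum f xs
  listSum-*ˡ c f []       = sym (zeroʳ c)
  listSum-*ˡ c f (x ∷ xs) = trans (+-congˡ (listSum-*ˡ c f xs)) (sym (distribˡ c _ _))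

  listSum-neg : (f : A → Carrier) (xs : List A) → listSum (λ x → - f x) xs ≈ - listSum f xs
  listSum-neg f []       = sym -0#≈0#
  listSum-neg f (x ∷ xs) = trans (+-congˡ (listSum-neg f xs)) (-‿+-comm _ _)

  listSum-minus : (f g : A → Carrier) (xs : List A) →
    listSum (λ x → f x - g x) xs ≈ listSum f xs - listSum g xs
  listSum-minus f g xs = trans (listSum-+ f (λ x → - g x) xs) (+-congˡ (listSum-neg g xs))

  listSum-swap : (f : A → B → Carrier) (xs : List A) (ys : List B) →
    listSum (λ x → listSum (f x) ys) xs ≈ listSum (λ y → listSum (λ x → f x y) xs) ys
  listSum-swap f []       ys = sym (listSum-zero ys)
  listSum-swap f (x ∷ xs) ys =
    trans (+-congˡ (listSum-swap f xs ys)) (sym (listSum-+ (f x) _ ys))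

  listSum-sum : (f : A → Fin n → Carrier) (xs : List A) →
    listSum (λ x → sum (f x)) xs ≈ sum (λ k → listSum (λ x → f x k) xs)
  listSum-sum {n = n} f []       = sym (sum-zero {n} _ λ _ → refl)
  listSum-sum         f (x ∷ xs) =
    trans (+-congˡ (listSum-sum f xs)) (sym (∑-distrib-+ (f x) _))

  length-filter : {Q : Pred A ℓ} (Q? : Decidable Q) (xs : List A) →
    length (filter Q? xs) · 1# ≈ listSum (λ x → ind (Q? x)) xs
  length-filter Q? [] = refl
  length-filter Q? (x ∷ xs) with Q? x
  ... | yes _ = +-congˡ (length-filter Q? xs)
  ... | no _  = trans (length-filter Q? xs) (sym (+-identityˡ _))

  module OverPoset {c ℓ₁ ℓ₂} (P : FinitePoset c ℓ₁ ℓ₂) where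

    private
      module P = FinitePoset P

    listSum-point : (f : P.Carrier → Carrier) → (∀ {x y} → x P.≈ y → f x ≈ f y) →
      ∀ q → listSum (λ p → f p * ind (p P.≟ q)) P.elements ≈ f q
    listSum-point f f-cong q = go P.elements P.unique (P.complete q)
      where
      absent : ∀ {xs} → All (λ p → ¬ (p P.≈ q)) xs → listSum (λ p → f p * ind (p P.≟ q)) xs ≈ 0#
      absent [] = refl
      absent {x ∷ xs} (x≉q ∷ rest) = trans
        (+-cong (trans (*-congˡ (ind-no (x P.≟ q) x≉q)) (zeroʳ _)) (absent rest)) (+-identityˡ _)
      go : ∀ xs → Unique P.setoid xs → Any (q P.≈_) xs →
        listSum (λ p → f p * ind (p P.≟ q)) xs ≈ f q
      go (x ∷ xs) (x≉ ∷ _) (here q≈x) = trans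
        (+-cong (trans (*-congˡ (ind-yes (x P.≟ q) (P.Eq.sym q≈x))) (trans (*-identityʳ _) (f-cong (P.Eq.sym q≈x))))
          (absent (All.map (λ x≉y y≈q → x≉y (P.Eq.sym (P.Eq.trans y≈q q≈x))) x≉))) (+-identityʳ _)
      go (x ∷ xs) (x≉ ∷ u) (there q∈) = trans
        (+-cong (trans (*-congˡ (ind-no (x P.≟ q) (x≉q q∈))) (zeroʳ _)) (go xs u q∈)) (+-identityˡ _)
        where
        x≉q : Any (q P.≈_) xs → ¬ (x P.≈ q)
        x≉q q∈ x≈q with All.lookupAny x≉ q∈
        ... | x≉y , q≈y = x≉y (P.Eq.trans x≈q q≈y)

    -- Since the witness is unique up to `≈`, existence can be counted. This turns "some cover at
    -- this element is labelled p" into a sum over edges, where the order of summation can be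
    -- exchanged.
    listSum-ind-∃ : ∀ {ℓ} {M : Pred P.Carrier ℓ} (M? : Decidable M) → M Respects P._≈_ →
      (∀ {z z′} → M z → M z′ → z P.≈ z′) → (∃M? : Dec (∃ M)) →
      ind ∃M? ≈ listSum (λ z → ind (M? z)) P.elements
    listSum-ind-∃ {M = M} M? resp uniq (no ¬∃) = sym (trans
      (listSum-cong (λ z → ind-no (M? z) λ Mz → ¬∃ (z , Mz)) P.elements) (listSum-zero P.elements))
    listSum-ind-∃ {M = M} M? resp uniq (yes (q , Mq)) = sym (begin
      listSum (λ z → ind (M? z)) P.elements             ≈⟨ listSum-cong (λ z → trans (ind-cong (M? z) (z P.≟ q)
                                                            (λ Mz → uniq Mz Mq) (λ z≈q → resp (P.Eq.sym z≈q) Mq))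
                                                            (sym (*-identityˡ _))) P.elements ⟩
      listSum (λ z → 1# * ind (z P.≟ q)) P.elements     ≈⟨ listSum-point (λ _ → 1#) (λ _ → refl) q ⟩
      1#                                                ∎)

    -- The dependent form of `ind`: the label at position k can only be formed from a proof that k
    -- is a descent or can be raised.
    fromDec : ∀ {b} {B : Set b} → (B → Carrier) → Dec B → Carrier
    fromDec v (yes b) = v b
    fromDec v (no _)  = 0#

    module _ {a b} (A : Pred P.Carrier a) (A? : Decidable A) (resp : A Respects P._≈_)
      {m : ℕ} (B : Fin m → Set b) (B? : ∀ k → Dec (B k)) (g : ∀ k → B k → P.Carrier)
      (sound : ∀ k b → A (g k b))
      (covers : ∀ p → A p → ∃ λ k → B k × (∀ b → p P.≈ g k b))
      (injective : ∀ {k k′} b b′ → g k b P.≈ g k′ b′ → k ≡ k′) where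

      private
        ind-fibre : ∀ p → ind (A? p) ≈ sum (λ k → fromDec (λ b → ind (p P.≟ g k b)) (B? k))
        ind-fibre p with A? p
        ... | no ¬Ap = sym (sum-zero _ λ k → zeros k (B? k))
          where
          zeros : ∀ k (B? : Dec (B k)) → fromDec (λ b → ind (p P.≟ g k b)) B? ≈ 0#
          zeros k (yes b) = ind-no (p P.≟ g k b) λ p≈ → ¬Ap (resp (P.Eq.sym p≈) (sound k b))
          zeros k (no _)  = refl
        ... | yes Ap with covers p Ap
        ...   | k₀ , b₀ , p≈ = sym (trans
          (sum-single _ k₀ λ k k≢k₀ → zeros k k≢k₀ (B? k)) (one (B? k₀)))
          where
          zeros : ∀ k → k ≢ k₀ → (B? : Dec (B k)) → fromDec (λ b → ind (p P.≟ g k b)) B? ≈ 0#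
          zeros k k≢k₀ (yes b) = ind-no (p P.≟ g k b) λ p≈′ →
            k≢k₀ (injective b b₀ (P.Eq.trans (P.Eq.sym p≈′) (p≈ b₀)))
          zeros k k≢k₀ (no _)  = refl
          one : (B? : Dec (B k₀)) → fromDec (λ b → ind (p P.≟ g k₀ b)) B? ≈ 1#
          one (yes b) = ind-yes (p P.≟ g k₀ b) (p≈ b)
          one (no ¬b) = contradiction b₀ ¬b

      -- Reindexes a sum over the elements in `A` by the positions k, as `g` hits every such element
      -- exactly once up to `≈`. The hypothesis `covers` speaks about every proof of `B k`, because
      -- the proof found by `B? k` need not be the one that came with the element.
      listSum-fibres : (f : P.Carrier → Carrier) → (∀ {x y} → x P.≈ y → f x ≈ f y) →
        listSum (λ p → f p * ind (A? p)) P.elements ≈ sum (λ k → fromDec (λ b → f (g k b)) (B? k))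
      listSum-fibres f f-cong = begin
        listSum (λ p → f p * ind (A? p)) P.elements
          ≈⟨ listSum-cong (λ p → trans (*-congˡ (ind-fibre p)) (*-distribˡ-sum (f p) (at p))) P.elements ⟩
        listSum (λ p → sum (λ k → f p * at p k)) P.elements
          ≈⟨ listSum-sum (λ p k → f p * at p k) P.elements ⟩
        sum (λ k → listSum (λ p → f p * at p k) P.elements)
          ≈⟨ sum-cong-≋ {m} (λ k → fibre k (B? k)) ⟩
        sum (λ k → fromDec (λ b → f (g k b)) (B? k)) ∎
        where
        at : P.Carrier → Fin m → Carrier
        at p k = fromDec (λ b → ind (p P.≟ g k b)) (B? k)
        fibre : ∀ k (B? : Dec (B k)) →
          listSum (λ p → f p * fromDec (λ b → ind (p P.≟ g k b)) B?) P.elements ≈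
          fromDec (λ b → f (g k b)) B?
        fibre k (yes b) = listSum-point f f-cong (g k b)
        fibre k (no _)  = trans (listSum-cong (λ p → zeroʳ (f p)) P.elements) (listSum-zero P.elements)

-- Rooks

module Rook {m : ℕ} (w : Permutation′ (suc m)) (I J : Fin (suc m))
  (box : Inv⁻¹ w (I , J))
  (full : ∀ {x y} → Inv⁻¹ w (x , J) → Inv⁻¹ w (I , y) → Inv⁻¹ w (x , y)) where

  Inverted : Fin (suc m) → Fin (suc m) → Set
  Inverted x y = Inv⁻¹ w (x , y)

  Inverted? : ∀ x y → Dec (Inverted x y)
  Inverted? x y = Inv? (Perm.flip w) (x , y)

  -- With x = y = v, `full` would make `v` inverted with itself.
  exclusive : ∀ {v} → Inverted v J → ¬ Inverted I v
  exclusive vJ Iv = ℕ.<-irrefl ≡.refl (proj₁ (full vJ Iv))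

  ≢⇒<∨> : ∀ {n} {x y : Fin n} → x ≢ y → x Fin.< y ⊎ y Fin.< x
  ≢⇒<∨> {x = x} {y} x≢y with Fin.<-cmp x y
  ... | tri< lt _ _ = inj₁ lt
  ... | tri≈ _ eq _ = contradiction eq x≢y
  ... | tri> _ _ gt = inj₂ gt

  module _ (u : Permutation′ (suc m)) (u≤w : u ≤ʷ w) where

    -- In `w` the letter `J` precedes `I`. If v < J and `v` is not a row-`J` letter, then `w` has
    -- `v` before `J`, hence before `I`; then v < I is impossible, since `u` already has `I` before
    -- `v`, and I < v makes `v` a column-`I` letter. If J < v, then `u`, hence `w`, has `v` before
    -- `J`, and again `v` precedes `I` in `w`.
    inside-IJ : ∀ {v} → (u ⟨$⟩ˡ I) Fin.< (u ⟨$⟩ˡ v) → (u ⟨$⟩ˡ v) Fin.< (u ⟨$⟩ˡ J) →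
      Inverted v J ⊎ Inverted I v
    inside-IJ {v} I<v v<J with Inverted? v J | Inverted? I v
    ... | yes vJ | _ = inj₁ vJ
    ... | no _ | yes Iv = inj₂ Iv
    ... | no ¬vJ | no ¬Iv with ≢⇒<∨> {x = v} {J} (λ { ≡.refl → ℕ.<-irrefl ≡.refl v<J })
    ...   | inj₁ v<J′ with ≢⇒<∨> {x = w ⟨$⟩ˡ v} {w ⟨$⟩ˡ J}
                         (Fin.<⇒≢ v<J′ ∘ ˡ-injective w)
    ...     | inj₂ Jv = contradiction (v<J′ , Jv) ¬vJ
    ...     | inj₁ vJ with ≢⇒<∨> {x = v} {I} (λ { ≡.refl → ℕ.<-irrefl ≡.refl I<v })
    ...       | inj₁ v<I = contradiction (proj₂ (u≤w (v<I , I<v)))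
      (ℕ.<-asym (ℕ.<-trans vJ (proj₂ box)))
    ...       | inj₂ I<v′ = contradiction (I<v′ , ℕ.<-trans vJ (proj₂ box)) ¬Iv
    inside-IJ {v} I<v v<J | no ¬vJ | no ¬Iv | inj₂ J<v = contradiction
      (ℕ.<-trans (proj₁ box) J<v , ℕ.<-trans (proj₂ (u≤w (J<v , v<J))) (proj₂ box)) ¬Iv

    inside-JI : ∀ {v} → (u ⟨$⟩ˡ J) Fin.< (u ⟨$⟩ˡ v) → (u ⟨$⟩ˡ v) Fin.< (u ⟨$⟩ˡ I) →
      Inverted v J ⊎ Inverted I v
    inside-JI {v} J<v v<I with ≢⇒<∨> {x = v} {J} (λ { ≡.refl → ℕ.<-irrefl ≡.refl J<v })
    ... | inj₁ v<J = inj₁ (u≤w (v<J , J<v))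
    ... | inj₂ J<v′ = inj₂ (u≤w (ℕ.<-trans (proj₁ box) J<v′ , v<I))

    private
      letter : ∀ {v p} → u ⟨$⟩ˡ v ≡ p → u ⟨$⟩ʳ p ≡ v
      letter eq = ≡.sym (position⇒letter u eq)

      at : ∀ {p} → u ⟨$⟩ˡ (u ⟨$⟩ʳ p) ≡ p
      at = Perm.inverseˡ u

    -- The ends of the stretch are settled by `box` itself: `I` is a row-`J` letter and `J` is a
    -- column-`I` letter.
    between-IJ : ∀ {p} → (u ⟨$⟩ˡ I) Fin.≤ p → p Fin.≤ (u ⟨$⟩ˡ J) →
      Inverted (u ⟨$⟩ʳ p) J ⊎ Inverted I (u ⟨$⟩ʳ p)
    between-IJ {p} I≤p p≤J with ≤⇒≡⊎< I≤p | ≤⇒≡⊎< p≤J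
    ... | inj₁ I≡p | _ = inj₁ (subst (λ v → Inverted v J) (≡.sym (letter I≡p)) box)
    ... | inj₂ _ | inj₁ p≡J = inj₂ (subst (Inverted I) (≡.sym (letter (≡.sym p≡J))) box)
    ... | inj₂ I<p | inj₂ p<J = inside-IJ
      (subst ((u ⟨$⟩ˡ I) Fin.<_) (≡.sym at) I<p) (subst (Fin._< (u ⟨$⟩ˡ J)) (≡.sym at) p<J)

    between-JI : ∀ {p} → (u ⟨$⟩ˡ J) Fin.≤ p → p Fin.≤ (u ⟨$⟩ˡ I) →
      Inverted (u ⟨$⟩ʳ p) J ⊎ Inverted I (u ⟨$⟩ʳ p)
    between-JI {p} J≤p p≤I with ≤⇒≡⊎< J≤p | ≤⇒≡⊎< p≤I
    ... | inj₁ J≡p | _ = inj₂ (subst (Inverted I) (≡.sym (letter J≡p)) box)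
    ... | inj₂ _ | inj₁ p≡I = inj₁ (subst (λ v → Inverted v J) (≡.sym (letter (≡.sym p≡I))) box)
    ... | inj₂ J<p | inj₂ p<I = inside-JI
      (subst ((u ⟨$⟩ˡ J) Fin.<_) (≡.sym at) J<p) (subst (Fin._< (u ⟨$⟩ˡ I)) (≡.sym at) p<I)

  -- For the label p of z s_k ⋖ z, the letters I and J are on the same side of the
  -- descent in p and in z, so that the coefficients below depend on p alone.
  module _ (z : Permutation′ (suc m)) (z≤w : z ≤ʷ w) (k : Fin m)
    (p : Permutation′ (suc m)) (p≤z : p ≤ʷ z) (l : Fin m)
    (larger  : p ⟨$⟩ʳ inject₁ l ≡ z ⟨$⟩ʳ inject₁ k)
    (smaller : p ⟨$⟩ʳ suc l ≡ z ⟨$⟩ʳ suc k)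
    (inRow : Inverted (z ⟨$⟩ʳ suc k) J) (inCol : Inverted I (z ⟨$⟩ʳ inject₁ k)) where

    private
      x y : Fin (suc m)
      x = z ⟨$⟩ʳ suc k
      y = z ⟨$⟩ʳ inject₁ k
      px : p ⟨$⟩ˡ x ≡ suc l
      px = ≡.trans (cong (p ⟨$⟩ˡ_) (≡.sym smaller)) (Perm.inverseˡ p)
      py : p ⟨$⟩ˡ y ≡ inject₁ l
      py = ≡.trans (cong (p ⟨$⟩ˡ_) (≡.sym larger)) (Perm.inverseˡ p)
      zx : z ⟨$⟩ˡ x ≡ suc k
      zx = Perm.inverseˡ z
      zy : z ⟨$⟩ˡ y ≡ inject₁ k
      zy = Perm.inverseˡ z

      ≤⇒<x : ∀ {q : Permutation′ (suc m)} {j v} → q ⟨$⟩ˡ x ≡ suc j →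
        (q ⟨$⟩ˡ v) Fin.≤ inject₁ j → (q ⟨$⟩ˡ v) Fin.< (q ⟨$⟩ˡ x)
      ≤⇒<x {q} {j} {v} eq le = subst ((q ⟨$⟩ˡ v) Fin.<_) (≡.sym eq) (≤inject₁⇒<suc j le)

      ≰⇒y< : ∀ {q : Permutation′ (suc m)} {j v} → q ⟨$⟩ˡ y ≡ inject₁ j →
        ¬ ((q ⟨$⟩ˡ v) Fin.≤ inject₁ j) → (q ⟨$⟩ˡ y) Fin.< (q ⟨$⟩ˡ v)
      ≰⇒y< {q} {j} {v} eq ≰ = subst (Fin._< (q ⟨$⟩ˡ v)) (≡.sym eq) (ℕ.≰⇒> ≰)

    -- If x < I, then `I` before `x` is an inversion of `p` and persists in `z`. If I < x, then `x`
    -- before `I` in `z` would make `x` a column-`I` letter, although it is already in row `J`. The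
    -- other three lemmas use the same two arguments as far as they are called for.
    I-forth : (p ⟨$⟩ˡ I) Fin.≤ inject₁ l → (z ⟨$⟩ˡ I) Fin.≤ inject₁ k
    I-forth pI≤l = decidable-stable ((z ⟨$⟩ˡ I) Fin.≤? inject₁ k) λ ≰ →
      absurd ≰ (≢⇒<∨> {x = x} {I} x≢I)
      where
      pI<px : (p ⟨$⟩ˡ I) Fin.< (p ⟨$⟩ˡ x)
      pI<px = ≤⇒<x {p} px pI≤l
      x≢I : x ≢ I
      x≢I x≡I = ℕ.<-irrefl (cong (toℕ ∘ (p ⟨$⟩ˡ_)) (≡.sym x≡I)) pI<px
      absurd : ¬ ((z ⟨$⟩ˡ I) Fin.≤ inject₁ k) → ¬ (x Fin.< I ⊎ I Fin.< x)
      absurd ≰ (inj₁ x<I) = ≰ (<suc⇒≤inject₁ k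
        (subst ((z ⟨$⟩ˡ I) Fin.<_) zx (proj₂ (p≤z (x<I , pI<px)))))
      absurd ≰ (inj₂ I<x) = exclusive inRow (z≤w (I<x ,
        subst (Fin._< (z ⟨$⟩ˡ I)) (≡.sym zx) (Fin.≤∧≢⇒< (inject₁<⇒suc≤ k (ℕ.≰⇒> ≰))
          λ e → x≢I (≡.sym (position⇒letter z (≡.sym e))))))

    I-back : (z ⟨$⟩ˡ I) Fin.≤ inject₁ k → (p ⟨$⟩ˡ I) Fin.≤ inject₁ l
    I-back zI≤k = decidable-stable ((p ⟨$⟩ˡ I) Fin.≤? inject₁ l) λ ≰ →
      ℕ.<⇒≱ (proj₂ (p≤z (proj₁ inCol , ≰⇒y< {p} py ≰)))
        (subst ((z ⟨$⟩ˡ I) Fin.≤_) (≡.sym zy) zI≤k)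

    J-forth : (p ⟨$⟩ˡ J) Fin.≤ inject₁ l → (z ⟨$⟩ˡ J) Fin.≤ inject₁ k
    J-forth pJ≤l = <suc⇒≤inject₁ k (subst ((z ⟨$⟩ˡ J) Fin.<_) zx
      (proj₂ (p≤z (proj₁ inRow , ≤⇒<x {p} px pJ≤l))))

    J-back : (z ⟨$⟩ˡ J) Fin.≤ inject₁ k → (p ⟨$⟩ˡ J) Fin.≤ inject₁ l
    J-back zJ≤k = decidable-stable ((p ⟨$⟩ˡ J) Fin.≤? inject₁ l) λ ≰ →
      absurd ≰ (≢⇒<∨> {x = J} {y} (J≢y ≰))
      where
      J≢y : ¬ ((p ⟨$⟩ˡ J) Fin.≤ inject₁ l) → J ≢ y
      J≢y ≰ J≡y = ≰ (Fin.≤-reflexive (≡.trans (cong (p ⟨$⟩ˡ_) J≡y) py))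
      absurd : ¬ ((p ⟨$⟩ˡ J) Fin.≤ inject₁ l) → ¬ (J Fin.< y ⊎ y Fin.< J)
      absurd ≰ (inj₁ J<y) = ℕ.<⇒≱ (proj₂ (p≤z (J<y , ≰⇒y< {p} py ≰)))
        (subst ((z ⟨$⟩ˡ J) Fin.≤_) (≡.sym zy) zJ≤k)
      absurd ≰ (inj₂ y<J) = exclusive {y} (z≤w (y<J , Fin.≤∧≢⇒<
        (subst ((z ⟨$⟩ˡ J) Fin.≤_) (≡.sym zy) zJ≤k) (J≢y ≰ ∘ ˡ-injective z))) inCol

-- Labels and down-degrees as sums over positions.

module Statistics {r ρ} (R : CommutativeRing r ρ) {m : ℕ} (w : Permutation′ (suc m)) where

  open CommutativeRing R hiding (zero)
  open Sums R
  open LowerInterval w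
  open OverPoset [e, w ]
  open import Relation.Binary.Reasoning.Setoid setoid

  descentsFrom descentsTo : Fin (suc m) → Permutation′ (suc m) → Carrier
  descentsFrom y u = sum λ k → ind (Descent? u k ×-dec ((u ⟨$⟩ʳ inject₁ k) Fin.≟ y))
  descentsTo   x u = sum λ k → ind (Descent? u k ×-dec ((u ⟨$⟩ʳ suc k) Fin.≟ x))

  toggle : P.Carrier → P.Carrier → Carrier
  toggle p u = ind (P.LabelsUp? p u) - ind (P.LabelsDown? p u)

  Raises : P.Carrier → Fin m → Set
  Raises u k = Ascent (proj₁ u) k × swapAt k (proj₁ u) ≤ʷ w

  Raises? : ∀ u k → Dec (Raises u k)
  Raises? u k = Ascent? (proj₁ u) k ×-dec FinitePoset._≤?_ (WeakOrder (suc m)) (swapAt k (proj₁ u)) w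

  raise : ∀ u k → Raises u k → P.Carrier
  raise u k (_ , ≤w) = upper u k λ {i} → ≤w {i}

  raise-descent : ∀ u k (b : Raises u k) → Descent (proj₁ (raise u k b)) k
  raise-descent u k (asc , _) = swapAt-descent k (proj₁ u) asc

  -- The label of the cover from `u` up to `raise u k b`, computed at its upper end, where the
  -- swapped pair is a descent.
  γ⁺ : ∀ u k → Raises u k → P.Carrier
  γ⁺ u k b = γ (raise u k b) k (raise-descent u k b)

  lower-raise : ∀ u k b → lower (raise u k b) k (raise-descent u k b) P.≈ u
  lower-raise u k b = swapAt-involutive k (proj₁ u)

  module _ (f : P.Carrier → Carrier) (f-cong : ∀ {p q} → p P.≈ q → f p ≈ f q) where

    labelsDown-sum : ∀ u → listSum (λ p → f p * ind (P.LabelsDown? p u)) P.elements ≈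
      sum (λ k → fromDec (λ desc → f (γ u k desc)) (Descent? (proj₁ u) k))
    labelsDown-sum u = listSum-fibres (λ p → P.LabelsDown p u) (λ p → P.LabelsDown? p u)
      (λ {p} {q} p≈q (x , c , lab) → x , c , isLabel-≈ {x} {u} {p} {q} p≈q lab)
      (Descent (proj₁ u)) (Descent? (proj₁ u)) (γ u)
      (λ k desc → lower u k desc , lower-⋖ u k desc , γ-isLabel u k desc)
      (λ p (x , c , lab) → covers p x lab (⋖⇒lower {x} {u} c))
      (λ desc desc′ → γ-injective u desc desc′) f (λ {p} {q} → f-cong {p} {q})
      where
      covers : ∀ p x → P.IsLabel x u p →
        (∃₂ λ k (desc : Descent (proj₁ u) k) → x P.≈ lower u k desc) →
        ∃ λ k → Descent (proj₁ u) k × (∀ desc → p P.≈ γ u k desc)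
      covers p x lab (k , desc , x≈) = k , desc , λ desc′ → γ-unique {x} {u} {p} k desc′ x≈ lab

    labelsUp-sum : ∀ u → listSum (λ p → f p * ind (P.LabelsUp? p u)) P.elements ≈
      sum (λ k → fromDec (λ b → f (γ⁺ u k b)) (Raises? u k))
    labelsUp-sum u = listSum-fibres (λ p → P.LabelsUp p u) (λ p → P.LabelsUp? p u)
      (λ {p} {q} p≈q (z , c , lab) → z , c , isLabel-≈ {u} {z} {p} {q} p≈q lab)
      (Raises u) (Raises? u) (γ⁺ u) sound
      (λ p (z , c , lab) → covers p z lab (⋖⇒upper {u} {z} c))
      (λ {k} {k′} b b′ eq → injective k k′ b b′ eq) f (λ {p} {q} → f-cong {p} {q})
      where
      sound : ∀ k b → P.LabelsUp (γ⁺ u k b) u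
      sound k b = raise u k b , upper-⋖ u k (λ {i} → proj₂ b {i}) (proj₁ b) ,
        P.IsLabel-resp-≈ {lower z k desc} {u} {z} {z} {γ⁺ u k b}
          (lower-raise u k b) (P.Eq.refl {z}) (γ-isLabel z k desc)
        where
        z : P.Carrier
        z = raise u k b
        desc : Descent (proj₁ z) k
        desc = raise-descent u k b
      covers : ∀ p z → P.IsLabel u z p →
        (∃ λ k → Ascent (proj₁ u) k × proj₁ z Perm.≈ swapAt k (proj₁ u)) →
        ∃ λ k → Raises u k × (∀ b → p P.≈ γ⁺ u k b)
      covers p z lab (k , asc , z≈) = k ,
        (asc , λ {i} inv → below-≤ z (≤ʷ-reflexive (swapAt k (proj₁ u)) (proj₁ z) (≡.sym ∘ z≈) {i} inv)) ,
        λ b → γ-unique {u} {raise u k b} {p} k (raise-descent u k b)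
          (≡.sym ∘ lower-raise u k b)
          (P.IsLabel-resp-≈ {u} {u} {z} {raise u k b} {p} (P.Eq.refl {u}) z≈ lab)
      injective : ∀ k k′ b b′ → γ⁺ u k b P.≈ γ⁺ u k′ b′ → k ≡ k′
      injective k k′ b b′ eq = Fin.inject₁-injective (ʳ-injective (proj₁ u)
        (≡.trans (≡.sym (swapAt-second k (proj₁ u))) (≡.trans
          (γ-smaller (raise u k b) (raise u k′ b′) (raise-descent u k b) (raise-descent u k′ b′) eq)
          (swapAt-second k′ (proj₁ u)))))

  ddeg-sum : ∀ u → P.ddeg u · 1# ≈ sum (λ k → ind (Descent? (proj₁ u) k))
  ddeg-sum u = begin
    P.ddeg u · 1#
      ≈⟨ length-filter (P._⋖? u) P.elements ⟩
    listSum (λ x → ind (x P.⋖? u)) P.elements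
      ≈⟨ listSum-cong (λ x → *-identityˡ (ind (x P.⋖? u))) P.elements ⟨
    listSum (λ x → 1# * ind (x P.⋖? u)) P.elements
      ≈⟨ listSum-fibres (P._⋖ u) (P._⋖? u)
           (λ {x} {y} x≈y c → P.⋖-resp-≈ {x} {y} {u} {u} x≈y (P.Eq.refl {u}) c)
           (Descent (proj₁ u)) (Descent? (proj₁ u)) (lower u) (lower-⋖ u)
           (λ x c → covers x (⋖⇒lower {x} {u} c))
           (λ {k} {k′} desc desc′ eq → injective k k′ desc eq) (λ _ → 1#) (λ _ → refl) ⟩
    sum (λ k → fromDec (λ _ → 1#) (Descent? (proj₁ u) k))
      ≈⟨ sum-cong-≋ {m} (λ k → fromDec-1 (Descent? (proj₁ u) k)) ⟩
    sum (λ k → ind (Descent? (proj₁ u) k)) ∎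
    where
    covers : ∀ x → (∃₂ λ k (desc : Descent (proj₁ u) k) → x P.≈ lower u k desc) →
      ∃ λ k → Descent (proj₁ u) k × (∀ desc → x P.≈ lower u k desc)
    covers x (k , desc , x≈) = k , desc , λ _ → x≈
    injective : ∀ k k′ (desc : Descent (proj₁ u) k) → swapAt k (proj₁ u) Perm.≈ swapAt k′ (proj₁ u) → k ≡ k′
    -- The pair at `k` is inverted in `u` but not after the swap at `k`. Since the swap at `k′`
    -- gives the same word, it must undo the same pair.
    injective k k′ desc eq with Inv⁻¹-swapAt k′ (proj₁ u) (descent-Inv⁻¹ k (proj₁ u) desc)
    ... | inj₂ (e , _) = Fin.suc-injective (ʳ-injective (proj₁ u) e)
    ... | inj₁ inv = contradiction
      (≤ʷ-reflexive (swapAt k′ (proj₁ u)) (swapAt k (proj₁ u)) (≡.sym ∘ eq) inv)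
      (descent-¬Inv⁻¹ k (proj₁ u))
    fromDec-1 : ∀ {B : Set} (B? : Dec B) → fromDec (λ _ → 1#) B? ≈ ind B?
    fromDec-1 (yes _) = refl
    fromDec-1 (no _)  = refl

-- The rook identity and its expectation.

module RookSum {r ρ} (R : CommutativeRing r ρ) {m : ℕ} (w : Permutation′ (suc m))
  (I J : Fin (suc m)) (box : Inv⁻¹ w (I , J))
  (full : ∀ {x y} → Inv⁻¹ w (x , J) → Inv⁻¹ w (I , y) → Inv⁻¹ w (x , y)) where

  open CommutativeRing R hiding (zero)
  open Sums R
  open LowerInterval w
  open OverPoset [e, w ]
  open Statistics R w
  open Rook w I J box full
  open import Algebra.Properties.Ring ring
    using (-‿distribˡ-*; -‿+-comm; -0#≈0#; -‿involutive; x[y-z]≈xy-xz)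
  open import Algebra.Properties.Group +-group using () renaming (x≈y⇒x∙y⁻¹≈ε to x≈y⇒x-y≈0#)
  open import Relation.Binary.Reasoning.Setoid setoid

  -- The two kinds of passages. By `full` the two letters of a passage form a box, so an up passage
  -- is an ascent whose swap stays below `w`, and a down passage is a descent: each belongs to a
  -- cover in the interval.
  Up? Down? : (u : Permutation′ (suc m)) (k : Fin m) → Dec _
  Up?   u k = Inverted? (u ⟨$⟩ʳ inject₁ k) J ×-dec Inverted? I (u ⟨$⟩ʳ suc k)
  Down? u k = Inverted? (u ⟨$⟩ʳ suc k) J ×-dec Inverted? I (u ⟨$⟩ʳ inject₁ k)

  upto : Fin (suc m) → Permutation′ (suc m) → Fin m → Carrier
  upto v u k = ind ((u ⟨$⟩ˡ v) Fin.≤? inject₁ k)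

  -- +1 on the stretch from `I` to `J` if `I` comes first, -1 on the stretch from `J` to `I`
  -- otherwise, and 0 elsewhere.
  side : Permutation′ (suc m) → Fin m → Carrier
  side u k = upto I u k - upto J u k

  minus-cong : ∀ {x x′ y y′} → x ≈ x′ → y ≈ y′ → x - y ≈ x′ - y′
  minus-cong x≈ y≈ = +-cong x≈ (-‿cong y≈)

  module _ (u : Permutation′ (suc m)) (u≤w : u ≤ʷ w) where

    inCol : Fin (suc m) → Carrier
    inCol p = ind (Inverted? I (u ⟨$⟩ʳ p))

    private
      -- Where each letter is of exactly one kind, an up passage raises `inCol` by one, a down
      -- passage lowers it by one, and otherwise neither happens.
      jump : ∀ k → Inverted (u ⟨$⟩ʳ inject₁ k) J ⊎ Inverted I (u ⟨$⟩ʳ inject₁ k) →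
        Inverted (u ⟨$⟩ʳ suc k) J ⊎ Inverted I (u ⟨$⟩ʳ suc k) →
        ind (Up? u k) - ind (Down? u k) ≈ inCol (suc k) - inCol (inject₁ k)
      jump k (inj₁ a) (inj₁ b) = minus-cong
        (trans (ind-no (Up? u k) (exclusive b ∘ proj₂)) (sym (ind-no (Inverted? I _) (exclusive b))))
        (trans (ind-no (Down? u k) (exclusive a ∘ proj₂)) (sym (ind-no (Inverted? I _) (exclusive a))))
      jump k (inj₁ a) (inj₂ b) = minus-cong
        (trans (ind-yes (Up? u k) (a , b)) (sym (ind-yes (Inverted? I _) b)))
        (trans (ind-no (Down? u k) (exclusive a ∘ proj₂)) (sym (ind-no (Inverted? I _) (exclusive a))))
      jump k (inj₂ a) (inj₁ b) = minus-cong
        (trans (ind-no (Up? u k) (exclusive b ∘ proj₂)) (sym (ind-no (Inverted? I _) (exclusive b))))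
        (trans (ind-yes (Down? u k) (b , a)) (sym (ind-yes (Inverted? I _) a)))
      jump k (inj₂ a) (inj₂ b) = trans
        (x≈y⇒x-y≈0# (trans (ind-no (Up? u k) (λ (c , _) → exclusive c a))
                 (sym (ind-no (Down? u k) (λ (c , _) → exclusive c b)))))
        (sym (x≈y⇒x-y≈0# (trans (ind-yes (Inverted? I _) b) (sym (ind-yes (Inverted? I _) a)))))

      -- `jump` is available only on the stretch between `I` and `J`. Elsewhere a letter need not be
      -- in the row or the column, but the sign vanishes.
      step : ∀ k → side u k * (ind (Up? u k) - ind (Down? u k)) ≈
        side u k * (inCol (suc k) - inCol (inject₁ k))
      step k = go ((u ⟨$⟩ˡ I) Fin.≤? inject₁ k) ((u ⟨$⟩ˡ J) Fin.≤? inject₁ k)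
        where
        vanish : ∀ {s x y} → s ≈ 0# → s * x ≈ s * y
        vanish s≈0 = trans (trans (*-congʳ s≈0) (zeroˡ _)) (sym (trans (*-congʳ s≈0) (zeroˡ _)))
        go : Dec ((u ⟨$⟩ˡ I) Fin.≤ inject₁ k) → Dec ((u ⟨$⟩ˡ J) Fin.≤ inject₁ k) →
          side u k * (ind (Up? u k) - ind (Down? u k)) ≈
          side u k * (inCol (suc k) - inCol (inject₁ k))
        go (yes I≤k) (yes J≤k) = vanish (x≈y⇒x-y≈0#
          (trans (ind-yes ((u ⟨$⟩ˡ I) Fin.≤? inject₁ k) I≤k)
            (sym (ind-yes ((u ⟨$⟩ˡ J) Fin.≤? inject₁ k) J≤k))))
        go (no I≰k)  (no J≰k)  = vanish (x≈y⇒x-y≈0#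
          (trans (ind-no ((u ⟨$⟩ˡ I) Fin.≤? inject₁ k) I≰k)
            (sym (ind-no ((u ⟨$⟩ˡ J) Fin.≤? inject₁ k) J≰k))))
        go (yes I≤k) (no J≰k)  = *-congˡ (jump k
          (between-IJ u u≤w I≤k (ℕ.<⇒≤ (ℕ.≰⇒> J≰k)))
          (between-IJ u u≤w (ℕ.≤-trans I≤k (ℕ.<⇒≤ (inject₁<suc k))) (inject₁<⇒suc≤ k (ℕ.≰⇒> J≰k))))
        go (no I≰k)  (yes J≤k) = *-congˡ (jump k
          (between-JI u u≤w J≤k (ℕ.<⇒≤ (ℕ.≰⇒> I≰k)))
          (between-JI u u≤w (ℕ.≤-trans J≤k (ℕ.<⇒≤ (inject₁<suc k))) (inject₁<⇒suc≤ k (ℕ.≰⇒> I≰k))))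

    Δ : Fin m → Carrier
    Δ k = inCol (suc k) - inCol (inject₁ k)

    -- The tails telescope to the value of `inCol` at `J` minus its value at `I`, which is 1 - 0.
    -- Reversing the order of `I` and `J` reverses both the sign and the direction of travel.
    side-sum : sum (λ k → side u k * (ind (Up? u k) - ind (Down? u k))) ≈ 1#
    side-sum = begin
      sum (λ k → side u k * (ind (Up? u k) - ind (Down? u k)))     ≈⟨ sum-cong-≋ {m} step ⟩
      sum (λ k → side u k * Δ k)                                   ≈⟨ sum-cong-≋ {m} (λ k →
        trans (distribʳ (Δ k) (upto I u k) (- upto J u k)) (+-congˡ (sym (-‿distribˡ-* (upto J u k) (Δ k))))) ⟩
      sum (λ k → upto I u k * Δ k - upto J u k * Δ k)
        ≈⟨ sum-distrib-minus {m} (λ k → upto I u k * Δ k) (λ k → upto J u k * Δ k) ⟩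
      sum (λ k → upto I u k * Δ k) - sum (λ k → upto J u k * Δ k)
        ≈⟨ minus-cong (telescope inCol (u ⟨$⟩ˡ I)) (telescope inCol (u ⟨$⟩ˡ J)) ⟩
      (inCol (fromℕ m) - inCol (u ⟨$⟩ˡ I)) - (inCol (fromℕ m) - inCol (u ⟨$⟩ˡ J))
        ≈⟨ minus-cong (minus-cong refl at-I) (minus-cong refl at-J) ⟩
      (inCol (fromℕ m) - 0#) - (inCol (fromℕ m) - 1#)
        ≈⟨ +-congʳ (trans (+-congˡ -0#≈0#) (+-identityʳ _)) ⟩
      inCol (fromℕ m) - (inCol (fromℕ m) - 1#)                     ≈⟨ +-congˡ (sym (-‿+-comm _ _)) ⟩
      inCol (fromℕ m) + (- inCol (fromℕ m) + - - 1#)               ≈⟨ sym (+-assoc _ _ _) ⟩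
      (inCol (fromℕ m) - inCol (fromℕ m)) + - - 1#                 ≈⟨ +-cong (-‿inverseʳ _) (-‿involutive 1#) ⟩
      0# + 1#                                                      ≈⟨ +-identityˡ 1# ⟩
      1#                                                           ∎
      where
      at-I : inCol (u ⟨$⟩ˡ I) ≈ 0#
      at-I = ind-no (Inverted? I _) λ inv → ℕ.<-irrefl (cong toℕ (≡.sym (Perm.inverseʳ u))) (proj₁ inv)
      at-J : inCol (u ⟨$⟩ˡ J) ≈ 1#
      at-J = ind-yes (Inverted? I _) (subst (Inverted I) (≡.sym (Perm.inverseʳ u)) box)

  -- The coefficient in the rook of the toggle at the label of z s_k ⋖ z.
  descentCoeff : Permutation′ (suc m) → Fin m → Carrier
  descentCoeff z k = ind (Down? z k) *
    (side z k + (ind ((z ⟨$⟩ʳ suc k) Fin.≟ I) + ind ((z ⟨$⟩ʳ inject₁ k) Fin.≟ J)))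

  -- At most one summand survives. The value is 0 for elements that are not labels, so that sums can
  -- run over the whole interval.
  labelCoeff : Permutation′ (suc m) → Carrier
  labelCoeff p = sum λ l → ind (SoleDescent? p l) * descentCoeff p l

  labelCoeff-sole : ∀ p {l} → SoleDescent p l → labelCoeff p ≈ descentCoeff p l
  labelCoeff-sole p {l} sole = trans
    (sum-single (λ l → ind (SoleDescent? p l) * descentCoeff p l) l λ l′ l′≢l →
      trans (*-congʳ (ind-no (SoleDescent? p l′) λ sole′ → l′≢l (proj₂ sole l′ (proj₁ sole′)))) (zeroˡ _))
    (trans (*-congʳ (ind-yes (SoleDescent? p l) sole)) (*-identityˡ _))

  labelCoeff-notSole : ∀ p → (∀ l → ¬ SoleDescent p l) → labelCoeff p ≈ 0#
  labelCoeff-notSole p none = sum-zero _ λ l →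
    trans (*-congʳ (ind-no (SoleDescent? p l) (none l))) (zeroˡ _)

  descentCoeff-cong : ∀ {p q} → p Perm.≈ q → ∀ l → descentCoeff p l ≈ descentCoeff q l
  descentCoeff-cong {p} {q} p≈q l = *-cong
    (ind-cong (Down? p l) (Down? q l)
      (λ (a , b) → subst (λ v → Inverted v J) (p≈q _) a , subst (Inverted I) (p≈q _) b)
      (λ (a , b) → subst (λ v → Inverted v J) (≡.sym (p≈q _)) a , subst (Inverted I) (≡.sym (p≈q _)) b))
    (+-cong (minus-cong (upto-cong I) (upto-cong J))
      (+-cong (letter-cong (suc l) I) (letter-cong (inject₁ l) J)))
    where
    upto-cong : ∀ v → upto v p l ≈ upto v q l
    upto-cong v = reflexive (cong (λ i → ind (i Fin.≤? inject₁ l)) (≈⇒ˡ p q p≈q v))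
    letter-cong : ∀ i v → ind ((p ⟨$⟩ʳ i) Fin.≟ v) ≈ ind ((q ⟨$⟩ʳ i) Fin.≟ v)
    letter-cong i v = reflexive (cong (λ x → ind (x Fin.≟ v)) (p≈q i))

  labelCoeff-cong : ∀ {p q} → p Perm.≈ q → labelCoeff p ≈ labelCoeff q
  labelCoeff-cong {p} {q} p≈q = sum-cong-≋ {m} λ l → *-cong
    (ind-cong (SoleDescent? p l) (SoleDescent? q l) (sole {p} {q} p≈q l) (sole {q} {p} (≡.sym ∘ p≈q) l))
    (descentCoeff-cong {p} {q} p≈q l)
    where
    sole : ∀ {p q} → p Perm.≈ q → ∀ l → SoleDescent p l → SoleDescent q l
    sole p≈q l (desc , only) = subst₂ Fin._<_ (p≈q _) (p≈q _) desc ,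
      λ l′ desc′ → only l′ (subst₂ Fin._<_ (≡.sym (p≈q _)) (≡.sym (p≈q _)) desc′)

  -- The label has the same two letters at its descent as `z` at `k`, and for a passage `I` and `J`
  -- stand on the same sides of both. If the pair is not a passage, both coefficients vanish.
  labelCoeff-γ : ∀ z k desc → labelCoeff (proj₁ (γ z k desc)) ≈ descentCoeff (proj₁ z) k
  labelCoeff-γ z k desc = trans (labelCoeff-sole L.label L.sole) (go (Down? (proj₁ z) k))
    where
    module L = Label (descentLabel (proj₁ z) k desc)
    down⇒ : Inverted (L.label ⟨$⟩ʳ suc L.place) J × Inverted I (L.label ⟨$⟩ʳ inject₁ L.place) →
      Inverted (proj₁ z ⟨$⟩ʳ suc k) J × Inverted I (proj₁ z ⟨$⟩ʳ inject₁ k)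
    down⇒ (a , b) = subst (λ v → Inverted v J) L.smaller a , subst (Inverted I) L.larger b
    down⇐ : Inverted (proj₁ z ⟨$⟩ʳ suc k) J × Inverted I (proj₁ z ⟨$⟩ʳ inject₁ k) →
      Inverted (L.label ⟨$⟩ʳ suc L.place) J × Inverted I (L.label ⟨$⟩ʳ inject₁ L.place)
    down⇐ (a , b) = subst (λ v → Inverted v J) (≡.sym L.smaller) a , subst (Inverted I) (≡.sym L.larger) b
    same-letters : ind ((L.label ⟨$⟩ʳ suc L.place) Fin.≟ I) + ind ((L.label ⟨$⟩ʳ inject₁ L.place) Fin.≟ J) ≈
      ind ((proj₁ z ⟨$⟩ʳ suc k) Fin.≟ I) + ind ((proj₁ z ⟨$⟩ʳ inject₁ k) Fin.≟ J)
    same-letters = +-cong (reflexive (cong (λ x → ind (x Fin.≟ I)) L.smaller))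
      (reflexive (cong (λ x → ind (x Fin.≟ J)) L.larger))
    go : Dec (Inverted (proj₁ z ⟨$⟩ʳ suc k) J × Inverted I (proj₁ z ⟨$⟩ʳ inject₁ k)) →
      descentCoeff L.label L.place ≈ descentCoeff (proj₁ z) k
    go (no ¬down) = trans
      (trans (*-congʳ (ind-no (Down? L.label L.place) (¬down ∘ down⇒))) (zeroˡ _))
      (sym (trans (*-congʳ (ind-no (Down? (proj₁ z) k) ¬down)) (zeroˡ _)))
    go (yes (a , b)) = *-cong
      (ind-cong (Down? L.label L.place) (Down? (proj₁ z) k) down⇒ down⇐)
      (+-cong (minus-cong
        (ind-cong (_ Fin.≤? _) (_ Fin.≤? _)
          (I-forth (proj₁ z) z≤w k L.label L.label≤ L.place L.larger L.smaller a b)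
          (I-back (proj₁ z) z≤w k L.label L.label≤ L.place L.larger L.smaller a b))
        (ind-cong (_ Fin.≤? _) (_ Fin.≤? _)
          (J-forth (proj₁ z) z≤w k L.label L.label≤ L.place L.larger L.smaller a b)
          (J-back (proj₁ z) z≤w k L.label L.label≤ L.place L.larger L.smaller a b)))
        same-letters)
      where
      z≤w : proj₁ z ≤ʷ w
      z≤w = below-≤ z

  module _ (u : P.Carrier) where

    private
      u₀ : Permutation′ (suc m)
      u₀ = proj₁ u
      u≤w : u₀ ≤ʷ w
      u≤w = below-≤ u

    down⇒descent : ∀ {k} → Inverted (u₀ ⟨$⟩ʳ suc k) J → Inverted I (u₀ ⟨$⟩ʳ inject₁ k) → Descent u₀ k
    down⇒descent a b = proj₁ (full a b)

    down-sum : listSum (λ p → labelCoeff (proj₁ p) * ind (P.LabelsDown? p u)) P.elements ≈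
      sum (descentCoeff u₀)
    down-sum = trans (labelsDown-sum (λ p → labelCoeff (proj₁ p))
        (λ {p} {q} p≈q → labelCoeff-cong {proj₁ p} {proj₁ q} p≈q) u)
      (sum-cong-≋ {m} λ k → go k (Descent? u₀ k))
      where
      go : ∀ k (desc? : Dec (Descent u₀ k)) →
        fromDec (λ desc → labelCoeff (proj₁ (γ u k desc))) desc? ≈ descentCoeff u₀ k
      go k (yes desc) = labelCoeff-γ u k desc
      go k (no ¬desc) = sym (trans (*-congʳ (ind-no (Down? u₀ k)
        λ (a , b) → ¬desc (down⇒descent a b))) (zeroˡ _))

    -- The coefficient is taken at `swapAt k u₀`, yet the result is the sign at `u₀`. The swap
    -- changes the sign only when it moves `I` rightwards from `inject₁ k` or `J` leftwards from
    -- `suc k`, and the two indicators undo exactly this. The opposite moves do not occur: a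
    -- column-`I` letter exceeds `I`, and a row-`J` letter is less than `J`.
    up-sum : listSum (λ p → labelCoeff (proj₁ p) * ind (P.LabelsUp? p u)) P.elements ≈
      sum (λ k → ind (Up? u₀ k) * side u₀ k)
    up-sum = trans (labelsUp-sum (λ p → labelCoeff (proj₁ p))
        (λ {p} {q} p≈q → labelCoeff-cong {proj₁ p} {proj₁ q} p≈q) u)
      (sum-cong-≋ {m} λ k → go k (Raises? u k))
      where
      up⇒raises : ∀ {k} → Inverted (u₀ ⟨$⟩ʳ inject₁ k) J → Inverted I (u₀ ⟨$⟩ʳ suc k) → Raises u k
      up⇒raises {k} a b = proj₁ (full a b) , below-w
        where
        below-w : swapAt k u₀ ≤ʷ w
        below-w inv with swapAt-Inv⁻¹ k u₀ inv
        ... | inj₁ inv′ = u≤w inv′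
        ... | inj₂ (≡.refl , ≡.refl) = full a b
      go : ∀ k (b? : Dec (Raises u k)) →
        fromDec (λ b → labelCoeff (proj₁ (γ⁺ u k b))) b? ≈ ind (Up? u₀ k) * side u₀ k
      go k (no ¬b) = sym (trans (*-congʳ (ind-no (Up? u₀ k)
        λ (a , b) → ¬b (up⇒raises a b))) (zeroˡ _))
      go k (yes b) = trans (labelCoeff-γ (raise u k b) k (raise-descent u k b))
        (both (Up? u₀ k))
        where
        z : Permutation′ (suc m)
        z = swapAt k u₀
        down⇒up : Inverted (z ⟨$⟩ʳ suc k) J × Inverted I (z ⟨$⟩ʳ inject₁ k) →
          Inverted (u₀ ⟨$⟩ʳ inject₁ k) J × Inverted I (u₀ ⟨$⟩ʳ suc k)
        down⇒up (a , b) = subst (λ v → Inverted v J) (swapAt-second k u₀) a ,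
          subst (Inverted I) (swapAt-first k u₀) b
        both : Dec (Inverted (u₀ ⟨$⟩ʳ inject₁ k) J × Inverted I (u₀ ⟨$⟩ʳ suc k)) →
          descentCoeff z k ≈ ind (Up? u₀ k) * side u₀ k
        both (no ¬up) = trans
          (trans (*-congʳ (ind-no (Down? z k) (¬up ∘ down⇒up))) (zeroˡ _))
          (sym (trans (*-congʳ (ind-no (Up? u₀ k) ¬up)) (zeroˡ _)))
        both (yes (a , b)) = *-cong
          (trans (ind-yes (Down? z k)
            (subst (λ v → Inverted v J) (≡.sym (swapAt-second k u₀)) a ,
             subst (Inverted I) (≡.sym (swapAt-first k u₀)) b))
            (sym (ind-yes (Up? u₀ k) (a , b))))
          sides
          where
          move-I : upto I z k + ind ((z ⟨$⟩ʳ suc k) Fin.≟ I) ≈ upto I u₀ k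
          move-I = trans (+-congˡ (reflexive (cong (λ v → ind (v Fin.≟ I)) (swapAt-second k u₀))))
            (cases ((u₀ ⟨$⟩ʳ inject₁ k) Fin.≟ I))
            where
            cases : Dec (u₀ ⟨$⟩ʳ inject₁ k ≡ I) →
              upto I z k + ind ((u₀ ⟨$⟩ʳ inject₁ k) Fin.≟ I) ≈ upto I u₀ k
            cases (yes ≡.refl) = trans (+-cong
              (ind-no (_ Fin.≤? _) λ le → ℕ.<⇒≱ (inject₁<suc k) (subst (Fin._≤ inject₁ k)
                (≡.trans (cong (PC.transpose (suc k) (inject₁ k)) (Perm.inverseˡ u₀))
                  (transpose-second (suc k) (inject₁ k))) le))
              (ind-yes ((u₀ ⟨$⟩ʳ inject₁ k) Fin.≟ (u₀ ⟨$⟩ʳ inject₁ k)) ≡.refl))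
              (trans (+-identityˡ 1#) (sym (ind-yes (_ Fin.≤? _) (Fin.≤-reflexive (Perm.inverseˡ u₀)))))
            cases (no ≢I) = trans (+-cong
              (reflexive (cong (λ i → ind (i Fin.≤? inject₁ k)) (transpose-other
                (λ e → ℕ.<-irrefl (cong toℕ (position⇒letter u₀ e)) (proj₁ b))
                (λ e → ≢I (≡.sym (position⇒letter u₀ e))))))
              (ind-no (_ Fin.≟ _) ≢I)) (+-identityʳ _)
          move-J : upto J u₀ k + ind ((z ⟨$⟩ʳ inject₁ k) Fin.≟ J) ≈ upto J z k
          move-J = trans (+-congˡ (reflexive (cong (λ v → ind (v Fin.≟ J)) (swapAt-first k u₀))))
            (cases ((u₀ ⟨$⟩ʳ suc k) Fin.≟ J))
            where
            cases : Dec (u₀ ⟨$⟩ʳ suc k ≡ J) →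
              upto J u₀ k + ind ((u₀ ⟨$⟩ʳ suc k) Fin.≟ J) ≈ upto J z k
            cases (yes ≡.refl) = trans (+-cong
              (ind-no (_ Fin.≤? _) λ le → ℕ.<⇒≱ (inject₁<suc k) (subst (Fin._≤ inject₁ k)
                (Perm.inverseˡ u₀) le))
              (ind-yes ((u₀ ⟨$⟩ʳ suc k) Fin.≟ (u₀ ⟨$⟩ʳ suc k)) ≡.refl))
              (trans (+-identityˡ 1#) (sym (ind-yes (_ Fin.≤? _) (Fin.≤-reflexive
                (≡.trans (cong (PC.transpose (suc k) (inject₁ k)) (Perm.inverseˡ u₀))
                  (transpose-first (suc k) (inject₁ k)))))))
            cases (no ≢J) = trans (+-cong
              (reflexive (cong (λ i → ind (i Fin.≤? inject₁ k)) (≡.sym (transpose-other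
                (λ e → ≢J (≡.sym (position⇒letter u₀ e)))
                (λ e → ℕ.<-irrefl (cong toℕ (≡.sym (position⇒letter u₀ e))) (proj₁ a))))))
              (ind-no (_ Fin.≟ _) ≢J)) (+-identityʳ _)
          sides : side z k + (ind ((z ⟨$⟩ʳ suc k) Fin.≟ I) + ind ((z ⟨$⟩ʳ inject₁ k) Fin.≟ J)) ≈ side u₀ k
          sides = begin
            (upto I z k - upto J z k) + (i + j)         ≈⟨ +-congˡ (+-comm i j) ⟩
            (upto I z k - upto J z k) + (j + i)         ≈⟨ +-assoc _ _ _ ⟨
            ((upto I z k - upto J z k) + j) + i         ≈⟨ +-congʳ (+-assoc _ _ _) ⟩
            (upto I z k + (- upto J z k + j)) + i       ≈⟨ +-congʳ (+-congˡ -Jz+j) ⟩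
            (upto I z k - upto J u₀ k) + i              ≈⟨ +-assoc _ _ _ ⟩
            upto I z k + (- upto J u₀ k + i)            ≈⟨ +-congˡ (+-comm _ _) ⟩
            upto I z k + (i - upto J u₀ k)              ≈⟨ +-assoc _ _ _ ⟨
            (upto I z k + i) - upto J u₀ k              ≈⟨ +-congʳ move-I ⟩
            upto I u₀ k - upto J u₀ k                   ∎
            where
            i j : Carrier
            i = ind ((z ⟨$⟩ʳ suc k) Fin.≟ I)
            j = ind ((z ⟨$⟩ʳ inject₁ k) Fin.≟ J)
            -Jz+j : - upto J z k + j ≈ - upto J u₀ k
            -Jz+j = begin
              - upto J z k + j             ≈⟨ +-congʳ (-‿cong move-J) ⟨
              - (upto J u₀ k + j) + j      ≈⟨ +-congʳ (-‿+-comm _ _) ⟨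
              (- upto J u₀ k - j) + j      ≈⟨ +-assoc _ _ _ ⟩
              - upto J u₀ k + (- j + j)    ≈⟨ +-congˡ (-‿inverseˡ j) ⟩
              - upto J u₀ k + 0#           ≈⟨ +-identityʳ _ ⟩
              - upto J u₀ k                ∎

    corner-terms : ∀ k → descentCoeff u₀ k ≈ ind (Down? u₀ k) * side u₀ k +
      (ind (Descent? u₀ k ×-dec ((u₀ ⟨$⟩ʳ inject₁ k) Fin.≟ J)) +
       ind (Descent? u₀ k ×-dec ((u₀ ⟨$⟩ʳ suc k) Fin.≟ I)))
    corner-terms k = trans (distribˡ d (side u₀ k) _)
      (+-congˡ (trans (distribˡ d _ _) (trans (+-comm _ _) (+-cong from-J to-I))))
      where
      d : Carrier
      d = ind (Down? u₀ k)
      ind-* : ∀ {A B C : Set} (A? : Dec A) (B? : Dec B) (C? : Dec C) →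
        (A → B → C) → (C → A × B) → ind A? * ind B? ≈ ind C?
      ind-* (yes a) (yes b) C? f g = trans (*-identityˡ 1#) (sym (ind-yes C? (f a b)))
      ind-* (yes a) (no ¬b) C? f g = trans (zeroʳ 1#) (sym (ind-no C? (¬b ∘ proj₂ ∘ g)))
      ind-* (no ¬a) B? C? f g = trans (zeroˡ _) (sym (ind-no C? (¬a ∘ proj₁ ∘ g)))
      inverted : Descent u₀ k → Inverted (u₀ ⟨$⟩ʳ suc k) (u₀ ⟨$⟩ʳ inject₁ k)
      inverted desc = u≤w (descent-Inv⁻¹ k u₀ desc)
      from-J : d * ind ((u₀ ⟨$⟩ʳ inject₁ k) Fin.≟ J) ≈
        ind (Descent? u₀ k ×-dec ((u₀ ⟨$⟩ʳ inject₁ k) Fin.≟ J))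
      from-J = ind-* (Down? u₀ k) ((u₀ ⟨$⟩ʳ inject₁ k) Fin.≟ J)
        (Descent? u₀ k ×-dec ((u₀ ⟨$⟩ʳ inject₁ k) Fin.≟ J))
        (λ (a , b) eq → down⇒descent a b , eq)
        (λ (desc , eq) → (subst (Inverted (u₀ ⟨$⟩ʳ suc k)) eq (inverted desc) ,
          subst (Inverted I) (≡.sym eq) box) , eq)
      to-I : d * ind ((u₀ ⟨$⟩ʳ suc k) Fin.≟ I) ≈
        ind (Descent? u₀ k ×-dec ((u₀ ⟨$⟩ʳ suc k) Fin.≟ I))
      to-I = ind-* (Down? u₀ k) ((u₀ ⟨$⟩ʳ suc k) Fin.≟ I)
        (Descent? u₀ k ×-dec ((u₀ ⟨$⟩ʳ suc k) Fin.≟ I))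
        (λ (a , b) eq → down⇒descent a b , eq)
        (λ (desc , eq) → (subst (λ v → Inverted v J) (≡.sym eq) box ,
          subst (λ v → Inverted v (u₀ ⟨$⟩ʳ inject₁ k)) eq (inverted desc)) , eq)

    rook : listSum (λ p → labelCoeff (proj₁ p) * toggle p u) P.elements +
      (descentsFrom J u₀ + descentsTo I u₀) ≈ 1#
    rook = begin
      listSum (λ p → labelCoeff (proj₁ p) * toggle p u) P.elements + ends
        ≈⟨ +-congʳ (trans
             (listSum-cong (λ p → x[y-z]≈xy-xz (labelCoeff (proj₁ p))
               (ind (P.LabelsUp? p u)) (ind (P.LabelsDown? p u))) P.elements)
             (listSum-minus (λ p → labelCoeff (proj₁ p) * ind (P.LabelsUp? p u))
               (λ p → labelCoeff (proj₁ p) * ind (P.LabelsDown? p u)) P.elements)) ⟩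
      (listSum (λ p → labelCoeff (proj₁ p) * ind (P.LabelsUp? p u)) P.elements -
       listSum (λ p → labelCoeff (proj₁ p) * ind (P.LabelsDown? p u)) P.elements) + ends
        ≈⟨ +-congʳ (minus-cong up-sum (trans down-sum split)) ⟩
      (U - (V + ends)) + ends        ≈⟨ +-congʳ (+-congˡ (-‿+-comm V ends)) ⟨
      (U + (- V - ends)) + ends      ≈⟨ +-assoc _ _ _ ⟩
      U + ((- V - ends) + ends)      ≈⟨ +-congˡ (+-assoc _ _ _) ⟩
      U + (- V + (- ends + ends))    ≈⟨ +-congˡ (trans (+-congˡ (-‿inverseˡ ends)) (+-identityʳ _)) ⟩
      U - V
        ≈⟨ sum-distrib-minus {m} (λ k → ind (Up? u₀ k) * side u₀ k) (λ k → ind (Down? u₀ k) * side u₀ k) ⟨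
      sum (λ k → ind (Up? u₀ k) * side u₀ k - ind (Down? u₀ k) * side u₀ k)
        ≈⟨ sum-cong-≋ {m} (λ k → trans (minus-cong (*-comm _ _) (*-comm _ _))
             (sym (x[y-z]≈xy-xz (side u₀ k) (ind (Up? u₀ k)) (ind (Down? u₀ k))))) ⟩
      sum (λ k → side u₀ k * (ind (Up? u₀ k) - ind (Down? u₀ k)))
        ≈⟨ side-sum u₀ u≤w ⟩
      1#                             ∎
      where
      ends U V : Carrier
      ends = descentsFrom J u₀ + descentsTo I u₀
      U = sum (λ k → ind (Up? u₀ k) * side u₀ k)
      V = sum (λ k → ind (Down? u₀ k) * side u₀ k)
      from to : Fin m → Carrier
      from k = ind (Descent? u₀ k ×-dec ((u₀ ⟨$⟩ʳ inject₁ k) Fin.≟ J))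
      to   k = ind (Descent? u₀ k ×-dec ((u₀ ⟨$⟩ʳ suc k) Fin.≟ I))
      split : sum (descentCoeff u₀) ≈ V + ends
      split = trans (sum-cong-≋ {m} corner-terms) (trans
        (∑-distrib-+ {m} (λ k → ind (Down? u₀ k) * side u₀ k) (λ k → from k + to k))
        (+-congˡ (∑-distrib-+ {m} from to)))

  rook-expectation : (weight : P.Carrier → Carrier) →
    listSum weight P.elements ≈ 1# →
    (∀ p → P.JoinIrreducible p → listSum (λ u → weight u * toggle p u) P.elements ≈ 0#) →
    listSum (λ u → weight u * descentsFrom J (proj₁ u)) P.elements +
    listSum (λ u → weight u * descentsTo I (proj₁ u)) P.elements ≈ 1#
  rook-expectation weight total symmetric = begin
    listSum (λ u → weight u * descentsFrom J (proj₁ u)) P.elements +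
    listSum (λ u → weight u * descentsTo I (proj₁ u)) P.elements
      ≈⟨ listSum-+ (λ u → weight u * descentsFrom J (proj₁ u)) (λ u → weight u * descentsTo I (proj₁ u)) P.elements ⟨
    listSum (λ u → weight u * descentsFrom J (proj₁ u) + weight u * descentsTo I (proj₁ u)) P.elements
      ≈⟨ listSum-cong (λ u → distribˡ (weight u) _ _) P.elements ⟨
    listSum (λ u → weight u * ends u) P.elements
      ≈⟨ trans (+-congʳ toggles-vanish) (+-identityˡ _) ⟨
    listSum (λ u → weight u * toggles u) P.elements + listSum (λ u → weight u * ends u) P.elements
      ≈⟨ listSum-+ (λ u → weight u * toggles u) (λ u → weight u * ends u) P.elements ⟨
    listSum (λ u → weight u * toggles u + weight u * ends u) P.elements
      ≈⟨ listSum-cong (λ u → trans (sym (distribˡ (weight u) (toggles u) (ends u)))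
           (trans (*-congˡ (rook u)) (*-identityʳ (weight u)))) P.elements ⟩
    listSum weight P.elements
      ≈⟨ total ⟩
    1# ∎
    where
    ends toggles : P.Carrier → Carrier
    toggles u = listSum (λ p → labelCoeff (proj₁ p) * toggle p u) P.elements
    ends u = descentsFrom J (proj₁ u) + descentsTo I (proj₁ u)
    -- Toggle symmetry is given at join-irreducible elements only; at an element without a sole
    -- descent the coefficient is 0.
    labelCoeff-vanish : ∀ p → labelCoeff (proj₁ p) * listSum (λ u → weight u * toggle p u) P.elements ≈ 0#
    labelCoeff-vanish p = go (Fin.any? (SoleDescent? (proj₁ p)))
      where
      go : Dec (∃ λ l → SoleDescent (proj₁ p) l) →
        labelCoeff (proj₁ p) * listSum (λ u → weight u * toggle p u) P.elements ≈ 0#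
      go (yes (l , sole)) = trans (*-congˡ (symmetric p (soleDescent⇒joinIrreducible p sole))) (zeroʳ _)
      go (no none) = trans (*-congʳ (labelCoeff-notSole (proj₁ p) λ l sole → none (l , sole))) (zeroˡ _)
    toggles-vanish : listSum (λ u → weight u * toggles u) P.elements ≈ 0#
    toggles-vanish = begin
      listSum (λ u → weight u * toggles u) P.elements
        ≈⟨ listSum-cong (λ u → listSum-*ˡ (weight u) (λ p → labelCoeff (proj₁ p) * toggle p u) P.elements) P.elements ⟨
      listSum (λ u → listSum (λ p → weight u * (labelCoeff (proj₁ p) * toggle p u)) P.elements) P.elements
        ≈⟨ listSum-swap (λ u p → weight u * (labelCoeff (proj₁ p) * toggle p u)) P.elements P.elements ⟩
      listSum (λ p → listSum (λ u → weight u * (labelCoeff (proj₁ p) * toggle p u)) P.elements) P.elements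
        ≈⟨ listSum-cong (λ p → listSum-cong (λ u →
             exchange (weight u) (labelCoeff (proj₁ p)) (toggle p u)) P.elements) P.elements ⟩
      listSum (λ p → listSum (λ u → labelCoeff (proj₁ p) * (weight u * toggle p u)) P.elements) P.elements
        ≈⟨ listSum-cong (λ p → trans
             (listSum-*ˡ (labelCoeff (proj₁ p)) (λ u → weight u * toggle p u) P.elements)
             (labelCoeff-vanish p)) P.elements ⟩
      listSum (λ p → 0#) P.elements
        ≈⟨ listSum-zero P.elements ⟩
      0# ∎
      where
      exchange : ∀ x y z → x * (y * z) ≈ y * (x * z)
      exchange x y z = trans (sym (*-assoc x y z)) (trans (*-congʳ (*-comm x y)) (*-assoc y x z))

-- Toggle symmetry of the uniform distribution.

module UniformToggles {r ρ} (R : CommutativeRing r ρ) {m : ℕ} (w : Permutation′ (suc m)) where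

  open CommutativeRing R hiding (zero)
  open Sums R
  open LowerInterval w
  open OverPoset [e, w ]
  open Statistics R w
  open import Relation.Binary.Reasoning.Setoid setoid

  module _ (p : P.Carrier) where

    private
      Edge : P.Carrier → P.Carrier → Set
      Edge x z = x P.⋖ z × P.IsLabel x z p

      Edge? : ∀ x z → Dec (Edge x z)
      Edge? x z = (x P.⋖? z) ×-dec P.IsLabel? x z p

      edge-resp : ∀ {x x′ z z′} → x P.≈ x′ → z P.≈ z′ → Edge x z → Edge x′ z′
      edge-resp {x} {x′} {z} {z′} x≈ z≈ (cov , lab) =
        P.⋖-resp-≈ {x} {x′} {z} {z′} x≈ z≈ cov ,
        P.IsLabel-resp-≈ {x} {x′} {z} {z′} {p} x≈ z≈ lab

    -- Both sides count the cover edges labelled `p`. The lower end determines the upper one, as its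
    -- join with `p`; the upper end determines the lower one by `labelled-lower-unique`.
    labelsUp≈labelsDown :
      listSum (λ u → ind (P.LabelsUp? p u)) P.elements ≈
      listSum (λ u → ind (P.LabelsDown? p u)) P.elements
    labelsUp≈labelsDown = begin
      listSum (λ u → ind (P.LabelsUp? p u)) P.elements
        ≈⟨ listSum-cong (λ u → listSum-ind-∃ (Edge? u)
             (λ {z} {z′} z≈ e → edge-resp {u} {u} {z} {z′} (P.Eq.refl {u}) z≈ e)
             (λ {z} {z′} (_ , join , _) (_ , join′ , _) → join-unique {u} {p} {z} {z′} join join′)
             (P.LabelsUp? p u)) P.elements ⟩
      listSum (λ u → listSum (λ z → ind (Edge? u z)) P.elements) P.elements
        ≈⟨ listSum-swap (λ u z → ind (Edge? u z)) P.elements P.elements ⟩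
      listSum (λ z → listSum (λ u → ind (Edge? u z)) P.elements) P.elements
        ≈⟨ listSum-cong (λ z → listSum-ind-∃ (λ u → Edge? u z)
             (λ {u} {u′} u≈ e → edge-resp {u} {u′} {z} {z} u≈ (P.Eq.refl {z}) e)
             (λ {u} {u′} (cov , lab) (cov′ , lab′) →
               labelled-lower-unique {u} {u′} {z} {p} cov lab cov′ lab′)
             (P.LabelsDown? p z)) P.elements ⟨
      listSum (λ u → ind (P.LabelsDown? p u)) P.elements ∎

    uniform-toggle : ∀ x → listSum (λ u → x * toggle p u) P.elements ≈ 0#
    uniform-toggle x = begin
      listSum (λ u → x * toggle p u) P.elements
        ≈⟨ listSum-*ˡ x (toggle p) P.elements ⟩
      x * listSum (toggle p) P.elements
        ≈⟨ *-congˡ (listSum-minus (λ u → ind (P.LabelsUp? p u)) (λ u → ind (P.LabelsDown? p u)) P.elements) ⟩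
      x * (listSum (λ u → ind (P.LabelsUp? p u)) P.elements - listSum (λ u → ind (P.LabelsDown? p u)) P.elements)
        ≈⟨ *-congˡ (trans (+-congʳ labelsUp≈labelsDown) (-‿inverseʳ _)) ⟩
      x * 0#
        ≈⟨ zeroʳ x ⟩
      0# ∎

-- Division by natural numbers in the ordered field.

module Field {k k₁ k₂} (K : OrderedField k k₁ k₂) where

  private
    module K = OrderedField K

  ring : CommutativeRing k k₁
  ring = HeytingCommutativeRing.commutativeRing K.heytingCommutativeRing

  open CommutativeRing ring 
    using (_≈_; 0#; 1#; sym; trans; setoid; *-congˡ; *-congʳ; *-assoc; *-comm; *-identityˡ;
      +-congˡ; +-identityʳ)
    renaming (_+_ to _⊕_; _*_ to _⊛_; Carrier to C; ring to ring′)
  open import Algebra.Properties.Ring ring′ using (-0#≈0#)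
  open import Relation.Binary.Reasoning.Setoid setoid

  private
    module _ (n : ℕ) where

      N N⁻¹ : C
      N = K.fromℕ (suc n)
      N⁻¹ = proj₁ (K.#⇒invertible (Equivalence.from (K.#⇔<⊎> N 0#) (inj₂ (K.0<fromℕ-suc n))))

      N⁻¹N≈1 : N⁻¹ ⊛ N ≈ 1#
      -- The inverse at hand is that of `N - 0#`.
      N⁻¹N≈1 = trans (*-congˡ (sym (trans (+-congˡ -0#≈0#) (+-identityʳ N))))
        (proj₁ (proj₂ (K.#⇒invertible (Equivalence.from (K.#⇔<⊎> N 0#) (inj₂ (K.0<fromℕ-suc n))))))

  *⇒≈/ℕ : ∀ n {x y} → K.fromℕ (suc n) ⊛ x ≈ y → x ≈ y K./ℕ suc n
  *⇒≈/ℕ n {x} {y} Nx≈y = begin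
    x                ≈⟨ *-identityˡ x ⟨
    1# ⊛ x           ≈⟨ *-congʳ (N⁻¹N≈1 n) ⟨
    (N⁻¹ n ⊛ N n) ⊛ x  ≈⟨ *-assoc _ _ _ ⟩
    N⁻¹ n ⊛ (N n ⊛ x)  ≈⟨ *-congˡ Nx≈y ⟩
    N⁻¹ n ⊛ y          ≈⟨ *-comm _ _ ⟩
    y ⊛ N⁻¹ n          ∎

  *1/ℕ : ∀ n → K.fromℕ (suc n) ⊛ (1# K./ℕ suc n) ≈ 1#
  *1/ℕ n = trans (*-congˡ (*-identityˡ (N⁻¹ n))) (trans (*-comm _ _) (N⁻¹N≈1 n))

  open Sums ring

  listSum-const : ∀ {a} {A : Set a} (x : C) (xs : List A) → listSum (λ _ → x) xs ≈ (length xs · 1#) ⊛ x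
  listSum-const x []       = sym (CommutativeRing.zeroˡ ring x)
  listSum-const x (_ ∷ xs) = sym (trans (CommutativeRing.distribʳ ring x 1# (length xs · 1#))
    (CommutativeRing.+-cong ring (*-identityˡ x) (sym (listSum-const x xs))))

  -- The membership excludes the empty list, for which `/ℕ` takes its default value and the sum
  -- would be 0.
  listSum-uniform : ∀ {a} {A : Set a} {x : A} {Q : A → Set} (xs : List A) → Any Q xs →
    listSum (λ _ → 1# K./ℕ length xs) xs ≈ 1#
  listSum-uniform xs@(_ ∷ ys) _ = trans (listSum-const (1# K./ℕ length xs) xs) (*1/ℕ (length ys))

-- Not opened above, where rings use the same names.
open import Data.Nat.Base using (_+_; _*_; _≤_; _<_)

-- Geometry of balanced shapes

last-true : {Q : ℕ → Set} → (∀ i → Dec (Q i)) → ∀ {m n} → m ≤ n → Q m → ¬ Q n →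
  ∃ λ i → m ≤ i × i < n × Q i × ¬ Q (suc i)
last-true Q? {m} {n} m≤n qm ¬qn with ℕ.m≤n⇒m<n∨m≡n m≤n
... | inj₂ ≡.refl = contradiction qm ¬qn
... | inj₁ (s≤s {n = k} m≤k) with Q? k
...   | yes qk = k , m≤k , ℕ.≤-refl , qk , ¬qn
...   | no ¬qk with last-true Q? m≤k qm ¬qk
...     | i , m≤i , i<k , qi , ¬qsi = i , m≤i , ℕ.m<n⇒m<1+n i<k , qi , ¬qsi

-- A skew shape Out ∖ In, in matrix coordinates starting from 0, inside the
-- rectangle [a] × [b].
module Grid (a b : ℕ) (Out In : ℕ → ℕ → Set)
  (Out? : ∀ i j → Dec (Out i j)) (In? : ∀ i j → Dec (In i j))
  (Out↓ : ∀ {i i′ j j′} → i′ ≤ i → j′ ≤ j → Out i j → Out i′ j′)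
  (In↓ : ∀ {i i′ j j′} → i′ ≤ i → j′ ≤ j → In i j → In i′ j′) where

  Box : ℕ → ℕ → Set
  Box i j = Out i j × ¬ In i j

  Box? : ∀ i j → Dec (Box i j)
  Box? i j = Out? i j ×-dec ¬? (In? i j)

  -- Boxes are counted from 0, so the lattice point meant is (`suc p`, `suc q`). A missing northwest
  -- box gives a corner of the inner boundary, a missing southeast box one of the outer boundary.
  Corner : ℕ → ℕ → Set
  Corner p q = Box p (suc q) × Box (suc p) q × ¬ (Box p q × Box (suc p) (suc q))

  -- Rows p and p + 1 share column `q₀`, but only row p is still inside `Out` at column `q`. The
  -- corner is where row p + 1 ends. `in-corner` is the mirror image for the beginnings of the rows.
  out-corner : ∀ {p q q₀} → Out p q → ¬ Out (suc p) q → Box p q₀ → Box (suc p) q₀ →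
    ∃ λ q′ → q₀ ≤ q′ × q′ < q × Corner p q′
  out-corner {p} {q} {q₀} out ¬out box box′
    with last-true (Out? (suc p)) (ℕ.≮⇒≥ λ q≤q₀ → ¬out (Out↓ ℕ.≤-refl (ℕ.<⇒≤ q≤q₀) (proj₁ box′)))
           (proj₁ box′) ¬out
  ... | q′ , q₀≤q′ , q′<q , out′ , ¬out′ = q′ , q₀≤q′ , q′<q ,
    (Out↓ ℕ.≤-refl q′<q out , proj₂ box ∘ In↓ ℕ.≤-refl (ℕ.m≤n⇒m≤1+n q₀≤q′)) ,
    (out′ , proj₂ box′ ∘ In↓ ℕ.≤-refl q₀≤q′) ,
    λ (_ , out″ , _) → ¬out′ out″

  in-corner : ∀ {p q q₀} → In p q → ¬ In (suc p) q → Box p q₀ → Box (suc p) q₀ →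
    ∃ λ q′ → q ≤ q′ × q′ < q₀ × Corner p q′
  in-corner {p} {q} {q₀} in′ ¬in box box′
    with last-true (In? p) (ℕ.≮⇒≥ λ q₀<q → proj₂ box (In↓ ℕ.≤-refl (ℕ.<⇒≤ q₀<q) in′)) in′ (proj₂ box)
  ... | q′ , q≤q′ , q′<q₀ , inq′ , ¬inq′ = q′ , q≤q′ , q′<q₀ ,
    (Out↓ ℕ.≤-refl q′<q₀ (proj₁ box) , ¬inq′) ,
    (Out↓ ℕ.≤-refl (ℕ.<⇒≤ q′<q₀) (proj₁ box′) , ¬in ∘ In↓ ℕ.≤-refl q≤q′) ,
    λ ((_ , ¬inq) , _) → ¬inq inq′

  module _ (adjacent : ∀ {p} → suc p < a → ∃ λ q → Box p q × Box (suc p) q)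
    (column : ∀ {j} → j < b → ∃ λ i → i < a × Box i j)
    (balanced : ∀ {p q} → Corner p q → suc p * b + suc q * a ≡ a * b)
    {i j : ℕ} (i<a : i < a) (j<b : j < b)
    (above : i * b + j * a < a * b) (below : a * b < suc i * b + suc j * a) where

    private
      -- The antidiagonal passes strictly between the northwest and southeast corners of box (i, j),
      -- so a lattice point weakly southeast of the latter is strictly beyond it; `noCorner-NW` is
      -- the opposite case.
      noCorner-SE : ∀ {p q} → i ≤ p → j ≤ q → ¬ Corner p q
      noCorner-SE {p} {q} i≤p j≤q corner = ℕ.<-irrefl ≡.refl (ℕ.<-≤-trans below
        (subst (suc i * b + suc j * a ≤_) (balanced corner)
          (ℕ.+-mono-≤ (ℕ.*-monoˡ-≤ b (s≤s i≤p)) (ℕ.*-monoˡ-≤ a (s≤s j≤q)))))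

      noCorner-NW : ∀ {p q} → p < i → q < j → ¬ Corner p q
      noCorner-NW {p} {q} p<i q<j corner = ℕ.<-irrefl ≡.refl (ℕ.≤-<-trans
        (subst (_≤ i * b + j * a) (balanced corner)
          (ℕ.+-mono-≤ (ℕ.*-monoˡ-≤ b p<i) (ℕ.*-monoˡ-≤ a q<j))) above)

      ≤-of-Out : ∀ {i₁} → Out i₁ j → ¬ Out i j → i₁ ≤ i
      ≤-of-Out out ¬out = ℕ.≮⇒≥ λ i<i₁ → ¬out (Out↓ (ℕ.<⇒≤ i<i₁) ℕ.≤-refl out)

      ≤-of-In : ∀ {i₁} → In i j → ¬ In i₁ j → i ≤ i₁
      ≤-of-In in′ ¬in = ℕ.≮⇒≥ λ i₁<i → ¬in (In↓ (ℕ.<⇒≤ i₁<i) ℕ.≤-refl in′)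

    -- If (i, j) is outside `Out`, then column `j` has its boxes higher up and leaves `Out` between
    -- rows p and p + 1 with p < i. These rows share a box, so `out-corner` yields a forbidden
    -- corner to the northwest. If (i, j) is in `In`, the same argument downwards yields one to the
    -- southeast.
    antidiagonal-box : Box i j
    antidiagonal-box with Out? i j | In? i j | column j<b
    ... | yes out | no ¬in | _ = out , ¬in
    ... | no ¬out | _ | i₁ , _ , out₁ , _
      with last-true (λ p → Out? p j) (≤-of-Out out₁ ¬out) out₁ ¬out
    ...   | p , _ , p<i , out , ¬out′ with adjacent (ℕ.<-≤-trans (s≤s p<i) i<a)
    ...     | q₀ , box , box′ with out-corner out ¬out′ box box′
    ...       | q , _ , q<j , corner = contradiction corner (noCorner-NW p<i q<j)
    antidiagonal-box | yes _ | yes in′ | i₁ , i₁<a , _ , ¬in₁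
      with last-true (λ p → In? p j) (≤-of-In in′ ¬in₁) in′ ¬in₁
    ...   | p , i≤p , p<i₁ , inp , ¬inp with adjacent (ℕ.<-≤-trans (s≤s p<i₁) i₁<a)
    ...     | q₀ , box , box′ with in-corner inp ¬inp box box′
    ...       | q , j≤q , _ , corner = contradiction corner (noCorner-SE i≤p j≤q)

    -- If (i′, j′) lies northeast or southwest of (i, j), one given box bounds it by `Out` and the
    -- other keeps it out of `In`. To the southeast only `Out` can fail, and then column `j`
    -- supplies the shared box for a corner to the southeast; to the northwest only `In` can
    -- interfere, which yields a corner to the northwest.
    antidiagonal-full : ∀ {i′ j′} → Box i j′ → Box i′ j → Box i′ j′
    antidiagonal-full {i′} {j′} (out , ¬in) (out′ , ¬in′)
      with ℕ.<-cmp i i′ | ℕ.<-cmp j j′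
    ... | tri≈ _ ≡.refl _ | _ = out , ¬in
    ... | tri< _ _ _ | tri≈ _ ≡.refl _ = out′ , ¬in′
    ... | tri> _ _ _ | tri≈ _ ≡.refl _ = out′ , ¬in′
    ... | tri< i<i′ _ _ | tri> _ _ j′<j =
      Out↓ ℕ.≤-refl (ℕ.<⇒≤ j′<j) out′ , ¬in ∘ In↓ (ℕ.<⇒≤ i<i′) ℕ.≤-refl
    ... | tri> _ _ i′<i | tri< j<j′ _ _ =
      Out↓ (ℕ.<⇒≤ i′<i) ℕ.≤-refl out , ¬in′ ∘ In↓ ℕ.≤-refl (ℕ.<⇒≤ j<j′)
    ... | tri< i<i′ _ _ | tri< j<j′ _ _ with Out? i′ j′
    ...   | yes out″ = out″ , ¬in ∘ In↓ (ℕ.<⇒≤ i<i′) ℕ.≤-refl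
    ...   | no ¬out″ with last-true (λ p → Out? p j′) (ℕ.<⇒≤ i<i′) out ¬out″
    ...     | p , i≤p , p<i′ , outp , ¬outp with out-corner outp ¬outp
                (Out↓ (ℕ.<⇒≤ p<i′) ℕ.≤-refl out′ , proj₂ antidiagonal-box ∘ In↓ i≤p ℕ.≤-refl)
                (Out↓ p<i′ ℕ.≤-refl out′ , proj₂ antidiagonal-box ∘ In↓ (ℕ.m≤n⇒m≤1+n i≤p) ℕ.≤-refl)
    ...       | q , j≤q , _ , corner = contradiction corner (noCorner-SE i≤p j≤q)
    antidiagonal-full {i′} {j′} (out , ¬in) (out′ , ¬in′) | tri> _ _ i′<i | tri> _ _ j′<j
      with In? i′ j′
    ...   | no ¬in″ = Out↓ ℕ.≤-refl (ℕ.<⇒≤ j′<j) out′ , ¬in″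
    ...   | yes in″ with last-true (λ p → In? p j′) (ℕ.<⇒≤ i′<i) in″ ¬in
    ...     | p , i′≤p , p<i , inp , ¬inp with in-corner inp ¬inp
                (Out↓ (ℕ.<⇒≤ p<i) ℕ.≤-refl (proj₁ antidiagonal-box) , ¬in′ ∘ In↓ i′≤p ℕ.≤-refl)
                (Out↓ p<i ℕ.≤-refl (proj₁ antidiagonal-box) , ¬in′ ∘ In↓ (ℕ.m≤n⇒m≤1+n i′≤p) ℕ.≤-refl)
    ...       | q , _ , q<j , corner = contradiction corner (noCorner-NW p<i q<j)

-- Skew diagrams in the integer plane and connectedness.

open GroupProperties (AbelianGroup.group ℤ.+-0-abelianGroup) using () renaming (∙-cancelʳ to +-cancelʳ)

-- The successors avoid index 0, where `nth` has the default value 0.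
nth-antitone : ∀ {xs} → Linked ℕ._≥_ xs → ∀ {i j} → i ℕ.≤ j → nth xs (suc j) ℕ.≤ nth xs (suc i)
nth-antitone []  _ = z≤n
nth-antitone [-] {j = zero}  z≤n = ℕ.≤-refl
nth-antitone [-] {j = suc j} _   = z≤n
nth-antitone (_∷_ {x} {y} x≥y l) {zero} {zero}  _ = ℕ.≤-refl
nth-antitone (_∷_ {x} {y} x≥y l) {zero} {suc j} _ = ℕ.≤-trans (nth-antitone l (z≤n {j})) x≥y
nth-antitone (_∷_ {x} {y} x≥y l) {suc i} {suc j} (s≤s i≤j) = nth-antitone l i≤j

young? : ∀ lam → Decidable (young lam)
young? lam (i , j) = ((1ℤ ℤ.≤? i) ×-dec (i ℤ.≤? _)) ×-dec ((1ℤ ℤ.≤? j) ×-dec (j ℤ.≤? _))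

young-closed : ∀ lam {i i′ j j′} → 1ℤ ℤ.≤ i′ → 1ℤ ℤ.≤ j′ → i′ ℤ.≤ i → j′ ℤ.≤ j →
  (i , j) ∈ young lam → (i′ , j′) ∈ young lam
young-closed lam {+[1+ k ]} {+[1+ k′ ]} 1≤i′ 1≤j′ i′≤i@(+≤+ (s≤s k′≤k)) j′≤j ((_ , i≤) , (_ , j≤)) =
  (1≤i′ , ℤ.≤-trans i′≤i i≤) ,
  (1≤j′ , ℤ.≤-trans j′≤j (ℤ.≤-trans j≤ (+≤+ (nth-antitone (Partition.decreasing lam) k′≤k))))
young-closed lam {i} {+ zero} (+≤+ ())
young-closed lam {+ zero} {+[1+ k′ ]} _ _ (+≤+ ())

Convex : Diagram → Set
Convex D = ∀ {x y z} → x ∈ D → z ∈ D → x ≤ᵇ y → y ≤ᵇ z → y ∈ D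

diagram? : ∀ σ → Decidable (SkewShape.diagram σ)
diagram? σ x = young? (SkewShape.outer σ) x ×-dec ¬? (young? (SkewShape.inner σ) x)

diagram-convex : ∀ σ → Convex (SkewShape.diagram σ)
diagram-convex σ (((1≤i , _) , (1≤j , _)) , x∉) (z∈ , _) (i≤ , j≤) (≤i , ≤j) =
  young-closed (SkewShape.outer σ) (ℤ.≤-trans 1≤i i≤) (ℤ.≤-trans 1≤j j≤) ≤i ≤j z∈ ,
  x∉ ∘ young-closed (SkewShape.inner σ) 1≤i 1≤j i≤ j≤

module _ {D : Diagram} (convex : Convex D) where

  private
    _⋖_ : Rel (ℤ × ℤ) _
    _⋖_ = Covers (D ⊢_<_)

  -- A unit step from `x` towards `y` stays in `D` by convexity, so a cover leaves room for nothing
  -- but that step.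
  unit-step : ∀ {x y} → x ⋖ y →
    y ≡ (ℤ.suc (proj₁ x) , proj₂ x) ⊎ y ≡ (proj₁ x , ℤ.suc (proj₂ x))
  unit-step {i , j} {i′ , j′} ((x∈ , y∈ , (i≤i′ , j≤j′) , x≢y) , none)
    with i ℤ.≟ i′ | j ℤ.≟ j′
  ... | no i≢i′ | _ = inj₁ (decided (≡-dec ℤ._≟_ ℤ._≟_ _ _))
    where
    z≤y : (ℤ.suc i , j) ≤ᵇ (i′ , j′)
    z≤y = ℤ.i<j⇒suc[i]≤j (ℤ.≤∧≢⇒< i≤i′ i≢i′) , j≤j′
    x≤z : (i , j) ≤ᵇ (ℤ.suc i , j)
    x≤z = ℤ.i≤suc[i] i , ℤ.≤-refl
    z∈ : (ℤ.suc i , j) ∈ D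
    z∈ = convex x∈ y∈ x≤z z≤y
    decided : Dec ((i′ , j′) ≡ (ℤ.suc i , j)) → (i′ , j′) ≡ (ℤ.suc i , j)
    decided (yes eq) = eq
    decided (no y≢z) = ⊥-elim (none _
      ((x∈ , z∈ , x≤z , λ eq → ℤ.i≢suc[i] (cong proj₁ eq)) ,
       (z∈ , y∈ , z≤y , y≢z ∘ ≡.sym)))
  ... | yes ≡.refl | no j≢j′ = inj₂ (decided (≡-dec ℤ._≟_ ℤ._≟_ _ _))
    where
    z≤y : (i , ℤ.suc j) ≤ᵇ (i , j′)
    z≤y = ℤ.≤-refl , ℤ.i<j⇒suc[i]≤j (ℤ.≤∧≢⇒< j≤j′ j≢j′)
    x≤z : (i , j) ≤ᵇ (i , ℤ.suc j)
    x≤z = ℤ.≤-refl , ℤ.i≤suc[i] j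
    z∈ : (i , ℤ.suc j) ∈ D
    z∈ = convex x∈ y∈ x≤z z≤y
    decided : Dec ((i , j′) ≡ (i , ℤ.suc j)) → (i , j′) ≡ (i , ℤ.suc j)
    decided (yes eq) = eq
    decided (no y≢z) = ⊥-elim (none _
      ((x∈ , z∈ , x≤z , λ eq → ℤ.i≢suc[i] (cong proj₂ eq)) ,
       (z∈ , y∈ , z≤y , y≢z ∘ ≡.sym)))
  ... | yes ≡.refl | yes ≡.refl = contradiction ≡.refl x≢y

  -- The path is a zigzag, but `h` cannot rise along a backward step, so the first passage above `p`
  -- is made by a cover taken forwards.
  crossing : (h : ℤ × ℤ → ℤ) → (∀ {x y} → x ≤ᵇ y → h x ℤ.≤ h y) → ∀ p {x y} →
    EqClosure _⋖_ x y → h x ℤ.≤ p → ¬ h y ℤ.≤ p →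
    ∃₂ λ u v → u ⋖ v × h u ℤ.≤ p × ¬ h v ℤ.≤ p
  crossing h mono p ε hx hy = contradiction hx hy
  crossing h mono p {x} (_◅_ {j = z} step path) hx hy with h z ℤ.≤? p
  ... | yes hz = crossing h mono p path hz hy
  crossing h mono p {x} (_◅_ {j = z} (fwd x⋖z) path) hx hy | no hz = x , z , x⋖z , hx , hz
  crossing h mono p {x} (_◅_ {j = z} (bwd z⋖x) path) hx hy | no hz =
    contradiction (ℤ.≤-trans (mono (proj₁ (proj₂ (proj₂ (proj₁ z⋖x))))) hx) hz

  ≤-antisym-suc : ∀ {i p} → i ℤ.≤ p → ¬ ℤ.suc i ℤ.≤ p → i ≡ p
  ≤-antisym-suc {i} {p} i≤p ¬suc with i ℤ.≟ p
  ... | yes eq = eq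
  ... | no i≢p = contradiction (ℤ.i<j⇒suc[i]≤j (ℤ.≤∧≢⇒< i≤p i≢p)) ¬suc

  module _ (connected : ∀ x y → x ∈ D → y ∈ D → EqClosure _⋖_ x y) {x y : ℤ × ℤ}
    (x∈ : x ∈ D) (y∈ : y ∈ D) (p : ℤ) where

    rows-meet : proj₁ x ℤ.≤ p → ¬ proj₁ y ℤ.≤ p →
      ∃ λ j → (p , j) ∈ D × (ℤ.suc p , j) ∈ D
    rows-meet x≤p y≰p with crossing proj₁ proj₁ p (connected x y x∈ y∈) x≤p y≰p
    ... | (i , j) , _ , cov@((u∈ , v∈ , _) , _) , i≤p , ≰p with unit-step cov
    ...   | inj₂ ≡.refl = contradiction i≤p ≰p
    ...   | inj₁ ≡.refl with ≤-antisym-suc i≤p ≰p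
    ...     | ≡.refl = j , u∈ , v∈

    columns-meet : proj₂ x ℤ.≤ p → ¬ proj₂ y ℤ.≤ p →
      ∃ λ i → (i , p) ∈ D × (i , ℤ.suc p) ∈ D
    columns-meet x≤p y≰p with crossing proj₂ proj₂ p (connected x y x∈ y∈) x≤p y≰p
    ... | (i , j) , _ , cov@((u∈ , v∈ , _) , _) , j≤p , ≰p with unit-step cov
    ...   | inj₁ ≡.refl = contradiction j≤p ≰p
    ...   | inj₂ ≡.refl with ≤-antisym-suc j≤p ≰p
    ...     | ≡.refl = i , u∈ , v∈

-- The coordinate that the i-th row (or column), counted from 0, of the
-- translated diagram has before the translation by r.
coordinate : ℤ → ℕ → ℤ
coordinate r i = +[1+ i ] ℤ.- r

coordinate-suc : ∀ r i → ℤ.suc (coordinate r i) ≡ coordinate r (suc i)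
coordinate-suc r i = ≡.sym (ℤ.+-assoc 1ℤ +[1+ i ] (ℤ.- r))

coordinate-injective : ∀ r {i j} → coordinate r i ≡ coordinate r j → i ≡ j
coordinate-injective r eq = ℕ.suc-injective (ℤ.+-injective (+-cancelʳ (ℤ.- r) _ _ eq))

coordinate-mono : ∀ r {i j} → i ℕ.≤ j → coordinate r i ℤ.≤ coordinate r j
coordinate-mono r i≤j = ℤ.+-monoˡ-≤ (ℤ.- r) (+≤+ (s≤s i≤j))

-- The shape inside its smallest rectangle.

module Frame (D : Diagram) (D? : Decidable D) (a b : ℕ) (r c : ℤ)
  (fits : translate r c D ⊆ Rectangle a b)
  (minimal : ∀ a′ b′ → FitsIn D a′ b′ → a ℕ.≤ a′ × b ℕ.≤ b′)
  (nonempty : ∃ D) where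

  within : ∀ {s} {n} → 1ℤ ℤ.≤ s → s ℤ.≤ + n → ∃ λ i → i ℕ.< n × s ≡ +[1+ i ]
  within {+[1+ i ]} _ (+≤+ i<n) = i , i<n , ≡.refl
  within {+ zero} (+≤+ ()) _

  untranslate : ∀ r s → (s ℤ.+ r) ℤ.- r ≡ s
  untranslate r s = ≡.trans (ℤ.+-assoc s r (ℤ.- r)) (≡.trans (cong (λ t → s ℤ.+ t) (ℤ.+-inverseʳ r)) (ℤ.+-identityʳ s))

  located : ∀ {s t} → (s , t) ∈ D → ∃₂ λ i j → i ℕ.< a × j ℕ.< b × s ≡ coordinate r i × t ≡ coordinate c j
  located {s} {t} st∈ with fits {s ℤ.+ r , t ℤ.+ c}
    (subst₂ (λ s t → (s , t) ∈ D) (≡.sym (untranslate r s)) (≡.sym (untranslate c t)) st∈)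
  ... | (1≤s , s≤a) , (1≤t , t≤b) with within 1≤s s≤a | within 1≤t t≤b
  ... | i , i<a , eqi | j , j<b , eqj = i , j , i<a , j<b ,
    ≡.trans (≡.sym (untranslate r s)) (cong (ℤ._- r) eqi) ,
    ≡.trans (≡.sym (untranslate c t)) (cong (ℤ._- c) eqj)

  row? : ∀ i → Dec (∃ λ (j : Fin b) → (coordinate r i , coordinate c (toℕ j)) ∈ D)
  row? i = Fin.any? λ j → D? (coordinate r i , coordinate c (toℕ j))

  -- If the first row were empty, the translation by `r ℤ.- 1ℤ`, one row higher, would fit into a
  -- rectangle with one row less.
  first-row : ∃ λ t → (coordinate r 0 , t) ∈ D
  first-row with row? 0
  ... | yes (_ , ∈D) = _ , ∈D
  ... | no none with located (proj₂ nonempty)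
  ...   | i₀ , _ , s≤s {n = a′} _ , _ = contradiction
    (proj₁ (minimal a′ b (r ℤ.- 1ℤ , c , λ {x} → shifted {x}))) ℕ.1+n≰n
    where
    solve-shift : ∀ {i k} → i ℤ.- (r ℤ.- 1ℤ) ≡ +[1+ k ] ℤ.- r → i ≡ + k
    solve-shift {i} {k} eq = +-cancelʳ (ℤ.- (r ℤ.- 1ℤ)) i (+ k) (≡.trans eq
      (≡.trans (ℤ.+-assoc 1ℤ (+ k) (ℤ.- r)) (≡.trans (ℤ.+-comm 1ℤ (+ k ℤ.- r)) (≡.trans (ℤ.+-assoc (+ k) (ℤ.- r) 1ℤ)
        (cong (λ t → + k ℤ.+ t) (≡.sym (ℤ.neg-distrib-+ r (ℤ.- 1ℤ))))))))
    shifted : translate (r ℤ.- 1ℤ) c D ⊆ Rectangle a′ b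
    shifted {i , j} ∈D with located ∈D
    ... | k , l , k<a , l<b , eqi , eqj with solve-shift {i} {k} eqi | +-cancelʳ (ℤ.- c) j +[1+ l ] eqj
    shifted ∈D | zero , l , _ , l<b , eqi , eqj | ≡.refl | ≡.refl = contradiction
      (fromℕ< l<b , subst₂ (λ s t → (s , t) ∈ D) eqi
        (cong (coordinate c) (≡.sym (Fin.toℕ-fromℕ< l<b))) ∈D) none
    shifted ∈D | suc k , l , s≤s k<a , l<b , _ | ≡.refl | ≡.refl =
      (+≤+ (s≤s z≤n) , +≤+ k<a) , (+≤+ (s≤s z≤n) , +≤+ l<b)

  last-row : ∃₂ λ k t → a ≡ suc k × (coordinate r k , t) ∈ D
  last-row with located (proj₂ nonempty)
  ... | i₀ , _ , s≤s {n = a′} _ , _ with row? a′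
  ...   | yes (_ , ∈D) = a′ , _ , ≡.refl , ∈D
  ...   | no none = contradiction
    (proj₁ (minimal a′ b (r , c , λ {x} → smaller {x}))) ℕ.1+n≰n
    where
    smaller : translate r c D ⊆ Rectangle a′ b
    smaller {i , j} ∈D with located ∈D
    ... | k , l , s≤s k≤a′ , l<b , eqi , eqj
      with +-cancelʳ (ℤ.- r) i +[1+ k ] eqi | +-cancelʳ (ℤ.- c) j +[1+ l ] eqj
    ...   | ≡.refl | ≡.refl with ℕ.m≤n⇒m<n∨m≡n k≤a′
    ...     | inj₁ k<a′ = (+≤+ (s≤s z≤n) , +≤+ k<a′) , (+≤+ (s≤s z≤n) , +≤+ l<b)
    ...     | inj₂ ≡.refl = contradiction (fromℕ< l<b , subst (λ l → (coordinate r a′ , coordinate c l) ∈ D)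
      (≡.sym (Fin.toℕ-fromℕ< l<b)) ∈D) none

module SkewFrame (σ : SkewShape) (a b : ℕ) (balanced : Balanced (SkewShape.diagram σ)) (r c : ℤ)
  (fits : translate r c (SkewShape.diagram σ) ⊆ Rectangle a b)
  (minimal : ∀ a′ b′ → FitsIn (SkewShape.diagram σ) a′ b′ → a ℕ.≤ a′ × b ℕ.≤ b′) where

  D : Diagram
  D = SkewShape.diagram σ

  open SkewShape σ using (outer; inner)
  open Frame D (diagram? σ) a b r c fits minimal (proj₁ (proj₁ balanced)) public
  private
    fitsᵀ : ∀ {a b r c} → translate r c D ⊆ Rectangle a b → translate c r (D ∘ swap) ⊆ Rectangle b a
    fitsᵀ fits {i , j} ∈D = swap (fits {j , i} ∈D)

    fitsInᵀ : ∀ {a b} → FitsIn (D ∘ swap) b a → FitsIn D a b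
    fitsInᵀ (c , r , fits) = r , c , λ { {i , j} ∈D → swap (fits {j , i} ∈D) }

    minimalᵀ : ∀ b′ a′ → FitsIn (D ∘ swap) b′ a′ → b ≤ b′ × a ≤ a′
    minimalᵀ b′ a′ = swap ∘ minimal a′ b′ ∘ fitsInᵀ

    nonemptyᵀ : ∃ (D ∘ swap)
    nonemptyᵀ = swap (proj₁ (proj₁ (proj₁ balanced))) , proj₂ (proj₁ (proj₁ balanced))

    -- Statements about columns are those about rows of the transposed diagram.
    module Transposed = Frame (D ∘ swap) (diagram? σ ∘ swap) b a c r
      (fitsᵀ {a} {b} {r} {c} fits) minimalᵀ nonemptyᵀ

    -- The first row of the rectangle meets the shape, which has positive coordinates only. So the
    -- whole quadrant indexed by ℕ is positive, and Young diagrams are closed towards the northwest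
    -- there.
    1≤row : ∀ i → 1ℤ ℤ.≤ coordinate r i
    1≤row i = ℤ.≤-trans (proj₁ (proj₁ (proj₁ (proj₂ first-row)))) (coordinate-mono r z≤n)

    1≤column : ∀ j → 1ℤ ℤ.≤ coordinate c j
    1≤column j = ℤ.≤-trans (proj₁ (proj₂ (proj₁ (proj₂ Transposed.first-row)))) (coordinate-mono c z≤n)

  Out In : ℕ → ℕ → Set
  Out i j = (coordinate r i , coordinate c j) ∈ young outer
  In  i j = (coordinate r i , coordinate c j) ∈ young inner

  open Grid a b Out In
    (λ i j → young? outer (coordinate r i , coordinate c j))
    (λ i j → young? inner (coordinate r i , coordinate c j))
    (λ {i} {i′} {j} {j′} i′≤i j′≤j →
      young-closed outer (1≤row i′) (1≤column j′) (coordinate-mono r i′≤i) (coordinate-mono c j′≤j))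
    (λ {i} {i′} {j} {j′} i′≤i j′≤j →
      young-closed inner (1≤row i′) (1≤column j′) (coordinate-mono r i′≤i) (coordinate-mono c j′≤j))
    public

  private
    coordinate-< : ∀ r {i j} → i ℕ.< j → ¬ coordinate r j ℤ.≤ coordinate r i
    coordinate-< r {i} {j} i<j le = ℤ.<⇒≱ (ℤ.+-monoˡ-< (ℤ.- r) (ℤ.+<+ (s≤s i<j))) le

    adjacent : ∀ {p} → suc p ℕ.< a → ∃ λ q → Box p q × Box (suc p) q
    adjacent {p} sp<a with first-row | last-row
    ... | t , first∈ | k , t′ , ≡.refl , last∈
      with rows-meet (diagram-convex σ) (proj₂ (proj₁ balanced)) first∈ last∈ (coordinate r p)
             (coordinate-mono r z≤n) (coordinate-< r (ℕ.s<s⁻¹ sp<a))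
    ...   | j , p∈ , sp∈ with located p∈
    ...     | _ , q , _ , _ , _ , ≡.refl =
      q , p∈ , subst (λ s → (s , coordinate c q) ∈ D) (coordinate-suc r p) sp∈

    column-nonempty : ∀ j → j ℕ.< b → ∃ λ s → (s , coordinate c j) ∈ D
    column-nonempty zero    _    = Transposed.first-row
    column-nonempty (suc j) sj<b with Transposed.first-row | Transposed.last-row
    ... | s , first∈ | k , s′ , ≡.refl , last∈
      with columns-meet (diagram-convex σ) (proj₂ (proj₁ balanced)) first∈ last∈ (coordinate c j)
             (coordinate-mono c z≤n) (coordinate-< c (ℕ.s<s⁻¹ sj<b))
    ...   | i , _ , i∈ = i , subst (λ t → (i , t) ∈ D) (coordinate-suc c j) i∈

    row-nonempty : ∀ i → i ℕ.< a → ∃ λ t → (coordinate r i , t) ∈ D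
    row-nonempty zero    _    = first-row
    row-nonempty (suc i) si<a with adjacent si<a
    ... | q , _ , box = coordinate c q , box

    column : ∀ {j} → j ℕ.< b → ∃ λ i → i ℕ.< a × Box i j
    column {j} j<b with column-nonempty j j<b
    ... | s , ∈D with located ∈D
    ...   | i , _ , i<a , _ , ≡.refl , _ = i , i<a , ∈D

    D′ : Diagram
    D′ = translate r c D

    shift : ∀ p (s : Fin 2) → +[1+ p ] ℤ.+ + toℕ s ≡ +[1+ toℕ s ℕ.+ p ]
    shift p 0F = cong +_ (ℕ.+-identityʳ (suc p))
    shift p 1F = cong +_ (ℕ.+-comm (suc p) 1)

    around-box : ∀ p q s t →
      D′ (around D′ +[1+ p ] +[1+ q ] s t) ≡ Box (toℕ s ℕ.+ p) (toℕ t ℕ.+ q)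
    around-box p q s t = cong₂ (λ i j → D′ (i , j)) (shift p s) (shift q t)

    corner-outward : ∀ {p q} → Corner p q → OutwardCorner D′ +[1+ p ] +[1+ q ]
    -- The corner is witnessed by the missing box: northwest is `0F , 0F` and southeast is
    -- `1F , 1F`.
    corner-outward {p} {q} (ne , sw , ¬both) with Box? p q
    ... | no ¬nw = 0F , 0F ,
      inj₂ (missing , box 1F 0F sw) , inj₂ (missing , box 0F 1F ne) , missing
      where
      box : ∀ s t → Box (toℕ s ℕ.+ p) (toℕ t ℕ.+ q) → D′ (around D′ +[1+ p ] +[1+ q ] s t)
      box s t = subst (λ A → A) (≡.sym (around-box p q s t))
      missing : ¬ D′ (around D′ +[1+ p ] +[1+ q ] 0F 0F)
      missing = ¬nw ∘ subst (λ A → A) (around-box p q 0F 0F)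
    ... | yes nw = 1F , 1F ,
      inj₁ (box 0F 1F ne , missing) , inj₁ (box 1F 0F sw , missing) , missing
      where
      box : ∀ s t → Box (toℕ s ℕ.+ p) (toℕ t ℕ.+ q) → D′ (around D′ +[1+ p ] +[1+ q ] s t)
      box s t = subst (λ A → A) (≡.sym (around-box p q s t))
      missing : ¬ D′ (around D′ +[1+ p ] +[1+ q ] 1F 1F)
      missing = (λ se → ¬both (nw , se)) ∘ subst (λ A → A) (around-box p q 1F 1F)

    corner-antidiagonal : ∀ {p q} → Corner p q → suc p ℕ.* b ℕ.+ suc q ℕ.* a ≡ a ℕ.* b
    corner-antidiagonal {p} {q} corner = ℤ.+-injective (≡.trans
      (≡.trans (ℤ.pos-+ (suc p ℕ.* b) (suc q ℕ.* a)) (cong₂ ℤ._+_ (ℤ.pos-* (suc p) b) (ℤ.pos-* (suc q) a)))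
      (≡.trans (proj₂ balanced a b ((r , c , λ {x} → fits {x}) , minimal) r c (λ {x} → fits {x})
        +[1+ p ] +[1+ q ] (corner-outward corner)) (≡.sym (ℤ.pos-* a b))))

  row-box : ∀ {i} → i ℕ.< a → ∃ λ j → Box i j
  row-box {i} i<a with row-nonempty i i<a
  ... | t , ∈D with located ∈D
  ...   | _ , j , _ , _ , _ , ≡.refl = j , ∈D

  column-box : ∀ {j} → j ℕ.< b → ∃ λ i → Box i j
  column-box j<b with column j<b
  ... | i , _ , box = i , box

  antidiagonal : ∀ {i j} → i ℕ.< a → j ℕ.< b →
    i ℕ.* b ℕ.+ j ℕ.* a ℕ.< a ℕ.* b → a ℕ.* b ℕ.< suc i ℕ.* b ℕ.+ suc j ℕ.* a →
    Box i j × (∀ {i′ j′} → Box i j′ → Box i′ j → Box i′ j′)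
  antidiagonal i<a j<b above below =
    antidiagonal-box adjacent column corner-antidiagonal i<a j<b above below ,
    antidiagonal-full adjacent column corner-antidiagonal i<a j<b above below

-- Points of the antidiagonal, and letters as rows and columns.

position-injective : ∀ {n} {i j : Fin n} → position i ≡ position j → i ≡ j
position-injective eq = Fin.toℕ-injective (ℕ.suc-injective (ℤ.+-injective eq))

-- The t-th point of the antidiagonal, t < ab, lies in row t / b and in column
-- b - 1 - t / a, counted from 0.
module _ {a b : ℕ} (t : Fin (a * b)) where

  antidiagonalRow : Fin a
  antidiagonalRow = proj₁ (remQuot {a} b t)

  antidiagonalColumn : Fin b
  antidiagonalColumn = proj₁ (remQuot {b} a (cast (ℕ.*-comm a b) t))

  private
    i j : ℕ
    i = toℕ antidiagonalRow
    j = toℕ (opposite antidiagonalColumn)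

    quotient-bounds : ∀ m n (s : Fin (m * n)) →
      n * toℕ (proj₁ (remQuot {m} n s)) ℕ.≤ toℕ s ×
      toℕ s ℕ.< n * suc (toℕ (proj₁ (remQuot {m} n s)))
    quotient-bounds m n s =
      subst (n * toℕ q ℕ.≤_) eq (ℕ.m≤m+n (n * toℕ q) (toℕ x)) ,
      subst₂ ℕ._<_ eq (≡.trans (ℕ.+-comm (n * toℕ q) n) (≡.sym (ℕ.*-suc n (toℕ q))))
        (ℕ.+-monoʳ-< (n * toℕ q) (Fin.toℕ<n x))
      where
      q : Fin m
      q = proj₁ (remQuot {m} n s)
      x : Fin n
      x = proj₂ (remQuot {m} n s)
      eq : n * toℕ q + toℕ x ≡ toℕ s
      eq = ≡.trans (≡.sym (Fin.toℕ-combine q x)) (cong toℕ (Fin.combine-remQuot {m} n s))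

    row-bounds : b * i ℕ.≤ toℕ t × toℕ t ℕ.< b * suc i
    row-bounds = quotient-bounds a b t

    column-bounds : a * toℕ antidiagonalColumn ℕ.≤ toℕ t × toℕ t ℕ.< a * suc (toℕ antidiagonalColumn)
    column-bounds = subst (λ s → a * toℕ antidiagonalColumn ℕ.≤ s × s ℕ.< a * suc (toℕ antidiagonalColumn))
      (Fin.toℕ-cast (ℕ.*-comm a b) t) (quotient-bounds b a (cast (ℕ.*-comm a b) t))

    j+ : suc (toℕ antidiagonalColumn) + j ≡ b
    j+ = ≡.trans (cong (λ x → suc (toℕ antidiagonalColumn) + x) (Fin.opposite-prop antidiagonalColumn))
      (ℕ.m+[n∸m]≡n (Fin.toℕ<n antidiagonalColumn))

  -- With c for `antidiagonalColumn`, the two quotients bound the same `t`: b i ≤ t < a (c + 1),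
  -- where c + 1 + j = b. `antidiagonal-below` uses a c ≤ t < b (i + 1). Together they say that the
  -- antidiagonal crosses the interior of box (i, j).
  antidiagonal-above : i * b + j * a ℕ.< a * b
  antidiagonal-above = subst₂ ℕ._<_ (cong (_+ j * a) (ℕ.*-comm b i))
    (≡.trans (≡.sym (≡.trans (ℕ.*-distribˡ-+ a (suc (toℕ antidiagonalColumn)) j)
      (cong (λ x → a * suc (toℕ antidiagonalColumn) + x) (ℕ.*-comm a j)))) (cong (a *_) j+))
    (ℕ.+-monoˡ-< (j * a) (ℕ.≤-<-trans (proj₁ row-bounds) (proj₂ column-bounds)))

  antidiagonal-below : a * b ℕ.< suc i * b + suc j * a
  antidiagonal-below = subst₂ ℕ._<_
    (≡.trans (≡.sym (≡.trans (ℕ.*-distribˡ-+ a (toℕ antidiagonalColumn) (suc j))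
      (cong (λ x → a * toℕ antidiagonalColumn + x) (ℕ.*-comm a (suc j)))))
      (cong (a *_) (≡.trans (ℕ.+-suc (toℕ antidiagonalColumn) j) j+)))
    (cong (_+ suc j * a) (ℕ.*-comm b (suc i)))
    (ℕ.+-monoˡ-< (suc j * a) (ℕ.≤-<-trans (proj₁ column-bounds) (proj₂ row-bounds)))

module Arrangement (σ : SkewShape) (a b : ℕ) (balanced : Balanced (SkewShape.diagram σ)) (r c : ℤ)
  (fits : translate r c (SkewShape.diagram σ) ⊆ Rectangle a b)
  (minimal : ∀ a′ b′ → FitsIn (SkewShape.diagram σ) a′ b′ → a ℕ.≤ a′ × b ℕ.≤ b′)
  {n : ℕ} (w : Permutation′ n) (ρ κ : ℤ ↔ ℤ)
  (shaped : ∀ x y → 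
    (x , y) ∈ rothe w ⇔ (Inverse.to ρ x , Inverse.to κ y) ∈ SkewShape.diagram σ) where

  open SkewFrame σ a b balanced r c fits minimal

  -- The Rothe box of an inverted pair of letters x < y lies in the row of the position of y and in
  -- the column of x itself.
  rowOf columnOf : Fin n → ℤ
  rowOf    y = Inverse.to ρ (position (w ⟨$⟩ˡ y))
  columnOf x = Inverse.to κ (position x)

  rowOf-injective : ∀ {y y′} → rowOf y ≡ rowOf y′ → y ≡ y′
  rowOf-injective = ˡ-injective w ∘ position-injective ∘ Injection.injective (↔⇒↣ ρ)

  columnOf-injective : ∀ {x x′} → columnOf x ≡ columnOf x′ → x ≡ x′
  columnOf-injective = position-injective ∘ Injection.injective (↔⇒↣ κ)

  inverted⇒box : ∀ {x y} → Inv⁻¹ w (x , y) → (rowOf y , columnOf x) ∈ D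
  inverted⇒box {x} {y} (x<y , inv) = Equivalence.to (shaped (position (w ⟨$⟩ˡ y)) (position x))
    (w ⟨$⟩ˡ y , w ⟨$⟩ˡ x , (inv , subst₂ Fin._<_ (≡.sym (Perm.inverseʳ w)) (≡.sym (Perm.inverseʳ w)) x<y) ,
     ≡.refl , cong position (≡.sym (Perm.inverseʳ w)))

  box⇒inverted : ∀ {x y} → (rowOf y , columnOf x) ∈ D → Inv⁻¹ w (x , y)
  box⇒inverted {x} {y} ∈D with Equivalence.from (shaped (position (w ⟨$⟩ˡ y)) (position x)) ∈D
  ... | i , j , (i<j , wj<wi) , eqi , eqj =
    subst₂ Fin._<_ (≡.sym x≡) (≡.sym y≡) wj<wi ,
    subst₂ Fin._<_ (≡.sym (position-injective eqi)) (≡.trans (≡.sym (Perm.inverseˡ w)) (cong (w ⟨$⟩ˡ_) (≡.sym x≡))) i<j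
    where
    x≡ : x ≡ w ⟨$⟩ʳ j
    x≡ = position-injective eqj
    y≡ : y ≡ w ⟨$⟩ʳ i
    y≡ = position⇒letter w (position-injective eqi)

  box-letters : ∀ {s t} → (s , t) ∈ D → (∃ λ y → rowOf y ≡ s) × (∃ λ x → columnOf x ≡ t)
  box-letters {s} {t} ∈D with Equivalence.from (shaped (Inverse.from ρ s) (Inverse.from κ t))
    (subst₂ (λ s t → (s , t) ∈ D) (≡.sym (Inverse.strictlyInverseˡ ρ s)) (≡.sym (Inverse.strictlyInverseˡ κ t)) ∈D)
  ... | i , j , _ , eqi , eqj =
    (w ⟨$⟩ʳ i , ≡.trans (cong (Inverse.to ρ) (≡.trans (cong position (Perm.inverseˡ w)) (≡.sym eqi)))
      (Inverse.strictlyInverseˡ ρ s)) ,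
    (w ⟨$⟩ʳ j , ≡.trans (cong (Inverse.to κ) (≡.sym eqj)) (Inverse.strictlyInverseˡ κ t))

  abstract
    row-letter : (i : Fin a) → ∃ λ y → rowOf y ≡ coordinate r (toℕ i)
    row-letter i = proj₁ (box-letters (proj₂ (row-box (Fin.toℕ<n i))))

    -- Columns are numbered from the right, so that row and column numbers both increase along the
    -- antidiagonal from its northeast end.
    column-letter : (j : Fin b) → ∃ λ x → columnOf x ≡ coordinate c (toℕ (opposite j))
    column-letter j = proj₂ (box-letters (proj₂ (column-box (Fin.toℕ<n (opposite j)))))

  row : Fin a → Fin n
  row i = proj₁ (row-letter i)

  column : Fin b → Fin n
  column j = proj₁ (column-letter j)

  row-injective : ∀ {i i′} → row i ≡ row i′ → i ≡ i′
  row-injective {i} {i′} eq = Fin.toℕ-injective (coordinate-injective r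
    (≡.trans (≡.sym (proj₂ (row-letter i))) (≡.trans (cong rowOf eq) (proj₂ (row-letter i′)))))

  column-injective : ∀ {j j′} → column j ≡ column j′ → j ≡ j′
  column-injective {j} {j′} eq = ≡.trans (≡.sym (Fin.opposite-involutive j)) (≡.trans (cong opposite
    (Fin.toℕ-injective (coordinate-injective c (≡.trans (≡.sym (proj₂ (column-letter j)))
      (≡.trans (cong columnOf eq) (proj₂ (column-letter j′))))))) (Fin.opposite-involutive j′))

  -- With injectivity, this shows that every descent below `w` has its larger letter in exactly one
  -- row, so summing `descentsFrom` over the rows recovers the down-degree.
  row-surjective : ∀ {x y} → Inv⁻¹ w (x , y) → ∃ λ i → row i ≡ y
  row-surjective inv with located (inverted⇒box inv)
  ... | i , _ , i<a , _ , eq , _ = fromℕ< i<a , rowOf-injective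
    (≡.trans (proj₂ (row-letter (fromℕ< i<a)))
      (≡.trans (cong (coordinate r) (Fin.toℕ-fromℕ< i<a)) (≡.sym eq)))

  column-surjective : ∀ {x y} → Inv⁻¹ w (x , y) → ∃ λ j → column j ≡ x
  column-surjective inv with located (inverted⇒box inv)
  ... | _ , j , _ , j<b , _ , eq = opposite (fromℕ< j<b) , columnOf-injective
    (≡.trans (proj₂ (column-letter (opposite (fromℕ< j<b))))
      (≡.trans (cong (coordinate c) (≡.trans (cong toℕ (Fin.opposite-involutive (fromℕ< j<b))) (Fin.toℕ-fromℕ< j<b)))
        (≡.sym eq)))

  module _ (t : Fin (a * b)) where

    private
      i : Fin a
      i = antidiagonalRow {a} {b} t
      j : Fin b
      j = antidiagonalColumn {a} {b} t
      grid : Box (toℕ i) (toℕ (opposite j)) ×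
        (∀ {i′ j′} → Box (toℕ i) j′ → Box i′ (toℕ (opposite j)) → Box i′ j′)
      grid = antidiagonal (Fin.toℕ<n i) (Fin.toℕ<n (opposite j))
        (antidiagonal-above {a} {b} t) (antidiagonal-below {a} {b} t)

    antidiagonal-inverted : Inv⁻¹ w (column j , row i)
    antidiagonal-inverted = box⇒inverted (subst₂ (λ s t → (s , t) ∈ D)
      (≡.sym (proj₂ (row-letter i))) (≡.sym (proj₂ (column-letter j))) (proj₁ grid))

    antidiagonal-rectangle : ∀ {x y} →
      Inv⁻¹ w (x , row i) → Inv⁻¹ w (column j , y) → Inv⁻¹ w (x , y)
    antidiagonal-rectangle invx invy with located (inverted⇒box invx) | located (inverted⇒box invy)
    ... | _ , j′ , _ , _ , _ , eqx | i′ , _ , _ , _ , eqy , _ = box⇒inverted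
      (subst₂ (λ s t → (s , t) ∈ D) (≡.sym eqy) (≡.sym eqx) (proj₂ grid
        (subst₂ (λ s t → (s , t) ∈ D) (proj₂ (row-letter i)) eqx (inverted⇒box invx))
        (subst₂ (λ s t → (s , t) ∈ D) eqy (proj₂ (column-letter j)) (inverted⇒box invy))))

-- The expected down-degree.

module Expectation {r ρ′} (R : CommutativeRing r ρ′) (σ : SkewShape) (a b : ℕ)
  (balanced : Balanced (SkewShape.diagram σ)) (r₀ c₀ : ℤ)
  (fits : translate r₀ c₀ (SkewShape.diagram σ) ⊆ Rectangle a b)
  (minimal : ∀ a′ b′ → FitsIn (SkewShape.diagram σ) a′ b′ → a ℕ.≤ a′ × b ℕ.≤ b′)
  {m : ℕ} (w : Permutation′ (suc m)) (ρ κ : ℤ ↔ ℤ)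
  (shaped : ∀ x y →
    (x , y) ∈ rothe w ⇔ (Inverse.to ρ x , Inverse.to κ y) ∈ SkewShape.diagram σ) where

  open CommutativeRing R using (Carrier; _≈_; 0#; 1#; refl; sym; trans; setoid; reflexive; *-congˡ; +-cong)
    renaming (_+_ to _⊕_; _*_ to _⊛_)
  open Sums R
  open LowerInterval w
  open Statistics R w
  open Arrangement σ a b balanced r₀ c₀ fits minimal w ρ κ shaped
  open import Relation.Binary.Reasoning.Setoid setoid

  private
    ends-sum : ∀ {n} {A : Set} (A? : Dec A) (f : Fin n → Fin (suc m)) (v : Fin (suc m)) →
      (∀ {i j} → f i ≡ f j → i ≡ j) → (A → ∃ λ i → f i ≡ v) →
      sum (λ i → ind (A? ×-dec (v Fin.≟ f i))) ≈ ind A?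
    ends-sum {n} A? f v inj surj = go A?
      where
      go : (A? : Dec _) → sum (λ i → ind (A? ×-dec (v Fin.≟ f i))) ≈ ind A?
      go (no _) = sum-zero {n} _ λ _ → refl
      go (yes x) with surj x
      ... | i , fi≡v = trans (sum-single _ i λ j j≢i →
          ind-no (v Fin.≟ f j) λ v≡fj → j≢i (inj (≡.trans (≡.sym v≡fj) (≡.sym fi≡v))))
        (ind-yes (v Fin.≟ f i) (≡.sym fi≡v))

  descent-inverted : ∀ (u : P.Carrier) k → Descent (proj₁ u) k →
    Inv⁻¹ w (proj₁ u ⟨$⟩ʳ suc k , proj₁ u ⟨$⟩ʳ inject₁ k)
  descent-inverted u k desc = below-≤ u (descent-Inv⁻¹ k (proj₁ u) desc)

  descentsFrom-sum : ∀ u → sum (λ i → descentsFrom (row i) (proj₁ u)) ≈ P.ddeg u · 1#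
  descentsFrom-sum u = begin
    sum (λ i → descentsFrom (row i) (proj₁ u))
      ≈⟨ ∑-comm {a} {m} (λ i k → ind (Descent? (proj₁ u) k ×-dec ((proj₁ u ⟨$⟩ʳ inject₁ k) Fin.≟ row i))) ⟩
    sum (λ k → sum (λ i → ind (Descent? (proj₁ u) k ×-dec ((proj₁ u ⟨$⟩ʳ inject₁ k) Fin.≟ row i))))
      ≈⟨ sum-cong-≋ {m} (λ k → ends-sum (Descent? (proj₁ u) k) row (proj₁ u ⟨$⟩ʳ inject₁ k) row-injective
           (λ desc → row-surjective (descent-inverted u k desc))) ⟩
    sum (λ k → ind (Descent? (proj₁ u) k))
      ≈⟨ ddeg-sum u ⟨
    P.ddeg u · 1# ∎

  descentsTo-sum : ∀ u → sum (λ j → descentsTo (column j) (proj₁ u)) ≈ P.ddeg u · 1#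
  descentsTo-sum u = begin
    sum (λ j → descentsTo (column j) (proj₁ u))
      ≈⟨ ∑-comm {b} {m} (λ j k → ind (Descent? (proj₁ u) k ×-dec ((proj₁ u ⟨$⟩ʳ suc k) Fin.≟ column j))) ⟩
    sum (λ k → sum (λ j → ind (Descent? (proj₁ u) k ×-dec ((proj₁ u ⟨$⟩ʳ suc k) Fin.≟ column j))))
      ≈⟨ sum-cong-≋ {m} (λ k → ends-sum (Descent? (proj₁ u) k) column (proj₁ u ⟨$⟩ʳ suc k) column-injective
           (λ desc → column-surjective (descent-inverted u k desc))) ⟩
    sum (λ k → ind (Descent? (proj₁ u) k))
      ≈⟨ ddeg-sum u ⟨
    P.ddeg u · 1# ∎

  module _ (weight : P.Carrier → Carrier)
    (total : listSum weight P.elements ≈ 1#)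
    (symmetric : ∀ p → P.JoinIrreducible p →
      listSum (λ u → weight u ⊛ toggle p u) P.elements ≈ 0#) where

    private
      expectation : (P.Carrier → Carrier) → Carrier
      expectation f = listSum (λ u → weight u ⊛ f u) P.elements

      expectation-sum : ∀ {n} (f : Fin n → P.Carrier → Carrier) (g : P.Carrier → Carrier) →
        (∀ u → sum (λ i → f i u) ≈ g u) → sum (λ i → expectation (f i)) ≈ expectation g
      expectation-sum {n} f g f≈g = begin
        sum (λ i → expectation (f i))
          ≈⟨ listSum-sum (λ u i → weight u ⊛ f i u) P.elements ⟨
        listSum (λ u → sum (λ i → weight u ⊛ f i u)) P.elements
          ≈⟨ listSum-cong (λ u → trans (sym (*-distribˡ-sum (weight u) (λ i → f i u)))
               (*-congˡ (f≈g u))) P.elements ⟩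
        expectation g ∎

    -- Summed over rows, and likewise over columns, the expected descents give the expected
    -- down-degree. The rook at the t-th point of the antidiagonal ties the two families together.
    ddeg-expectation : ((a + b) · 1#) ⊛ listSum (λ u → weight u ⊛ (P.ddeg u · 1#)) P.elements ≈ (a * b) · 1#
    ddeg-expectation = sum-antidiagonal a b
      (λ i → expectation (λ u → descentsFrom (row i) (proj₁ u)))
      (λ j → expectation (λ u → descentsTo (column j) (proj₁ u)))
      (expectation-sum (λ i u → descentsFrom (row i) (proj₁ u)) (λ u → P.ddeg u · 1#) descentsFrom-sum)
      (expectation-sum (λ j u → descentsTo (column j) (proj₁ u)) (λ u → P.ddeg u · 1#) descentsTo-sum)
      (λ t → RookSum.rook-expectation R w
        (column (antidiagonalColumn {a} {b} t)) (row (antidiagonalRow {a} {b} t))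
        (antidiagonal-inverted t) (λ {x} {y} → antidiagonal-rectangle t {x} {y})
        weight total symmetric)

theorem5p18 : ∀ {k k₁ k₂} (K : OrderedField k k₁ k₂)
    (σ : SkewShape) (a b : ℕ) →
    Balanced (SkewShape.diagram σ) → HasHeightWidth (SkewShape.diagram σ) a b →
    (n : ℕ) (w : Permutation′ n) → SkewVexillary w σ →
    Toggling.IsTCDE K [e, w ] ×
    OrderedField._≈_ K (Toggling.edgeDensity K [e, w ])
    (OrderedField._/ℕ_ K (OrderedField.fromℕ K (a * b)) (a + b))
-- The empty permutation has no inversions, while a balanced shape, being connected, has a box.
theorem5p18 K σ a b balanced ((r , c , fits) , minimal) zero w (ρ , κ , shaped) =
  contradiction (proj₁ (Equivalence.from (shaped (Inverse.from ρ s) (Inverse.from κ t)) box)) λ ()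
  where
  s t : ℤ
  s = proj₁ (proj₁ (proj₁ (proj₁ balanced)))
  t = proj₂ (proj₁ (proj₁ (proj₁ balanced)))
  box : (Inverse.to ρ (Inverse.from ρ s) , Inverse.to κ (Inverse.from κ t)) ∈ SkewShape.diagram σ
  box = subst₂ (λ s t → (s , t) ∈ SkewShape.diagram σ)
    (≡.sym (Inverse.strictlyInverseˡ ρ s)) (≡.sym (Inverse.strictlyInverseˡ κ t)) (proj₂ (proj₁ (proj₁ balanced)))
theorem5p18 K σ a b balanced ((r , c , fits) , minimal) (suc m) w (ρ , κ , shaped) =
  -- Both claims come from `density`, since the uniform weights are toggle-symmetric too.
  (λ μ symmetric → trans (density (Distribution.weight μ) (Distribution.total μ) symmetric) (sym uniform)) , uniform
  where
  module K = OrderedField K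
  open Toggling K [e, w ]
  open Field K
  open CommutativeRing ring using (_≈_; 0#; 1#; sym; trans)
  open UniformToggles ring w using (uniform-toggle)
  module P = FinitePoset [e, w ]

  divide : ∀ N {x y} → 0 ℕ.< N → (K.fromℕ N K.* x) ≈ y → x ≈ (y K./ℕ N)
  divide (suc N) _ = *⇒≈/ℕ N

  -- A nonempty shape has a row; for a + b = 0 the quotient would be the default 0.
  0<a+b : 0 ℕ.< a + b
  0<a+b = ℕ.<-≤-trans (positive (SkewFrame.last-row σ a b balanced r c (λ {x} → fits {x}) minimal)) (ℕ.m≤m+n a b)
    where
    positive : ∀ {Q : ℕ → ℤ → Set} → (∃₂ λ k t → a ≡ suc k × Q k t) → 0 ℕ.< a
    positive (_ , _ , ≡.refl , _) = s≤s z≤n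

  density : (weight : P.Carrier → K.Carrier) → ∑ weight ≈ 1# →
    (∀ p → P.JoinIrreducible p → 𝔼 weight (𝒯 p) ≈ 0#) →
    𝔼 weight ddeg ≈ (K.fromℕ (a * b) K./ℕ (a + b))
  density weight total symmetric = divide (a + b) 0<a+b
    (Expectation.ddeg-expectation ring σ a b balanced r c (λ {x} → fits {x}) minimal w ρ κ shaped
      weight total symmetric)

  uniform : edgeDensity ≈ (K.fromℕ (a * b) K./ℕ (a + b))
  uniform = density uni (listSum-uniform {x = bottom} P.elements (P.complete bottom))
    λ p _ → uniform-toggle p (1# K./ℕ P.size)
    where
    bottom : P.Carrier
    bottom = LowerInterval.below w Perm.id λ {i} → id-least w {i}
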